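{- Let $p$ be an odd prime, let $\mathbf{C}^{(p)}=(c_i)_{i\ge 0}$ be the $p$-Cantor sequence over $\mathbb{F}_p$, and extend it to the doubly infinite sequence $\mathbf{C}^{(p,L)}=(c_i)_{i\in\mathbb{Z}}$ by setting $c_i=0$ for $i<0$. Let $W=W_p(\mathbf{C}^{(p,L)})$ be its number wall over $\mathbb{F}_p$. Then \[\big(\chi(W)[m,n]\big)_{m,n\ge 0}=\Pi\big(\Phi_p^\infty(A)\big),\] where $\Phi_p$, $\Pi$, $A$ are as described in the context.
   Context: Notation: $p_2=(p-1)/2$. For real $a,b$, $\binom{a}{b}=\frac{a!}{b!(a-b)!}$ if $a,b$ are nonnegative integers with $a\ge b$, and $\binom{a}{b}=0$ otherwise. The $p$-Cantor sequence: let $\phi_p$ be the substitution on the alphabet $\{0,1,\dots,p-1\}$ (identified with $\mathbb{F}_p$) sending each letter $n$ to the word of length $p$ whose $i$-th letter ($0\le i\le p-1$) is $n\binom{p_2}{i/2}\bmod p$, extended to words by concatenation; $\mathbf{C}^{(p)}=(c_i)_{i\ge0}=\lim_{k\to\infty}\phi_p^k(1)$ (the fixed point of $\phi_p$ beginning with $1$). Number wall: for a doubly infinite sequence $\mathbf{S}=(s_i)_{i\in\mathbb{Z}}$ over $\mathbb{F}_p$, $W_p(\mathbf{S})[m,n]=\det\big((s_{i-j+n})_{0\le i,j\le m}\big)$ for $m\ge0$, $W_p(\mathbf{S})[m,n]=1$ for $m=-1$ and $0$ for $m<-1$ ($m$ is the row index, $n$ the column index). The profile $\chi(W)$ is the array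 with $\chi(W)[m,n]=0$ if $W[m,n]=0$ and $\chi(W)[m,n]=X$ otherwise, where $X$ is a fixed symbol. Alphabet $\mathcal{A}=\{A,B,F,0,E_N,E_E,E_S,E_W,C_{NE},C_{SE},C_{SW},C_{NW}\}$. $\Phi_p$ is the two-dimensional $[p,p]$-morphism: each letter is sent to a $p\times p$ array (entries indexed by $0\le m,n\le p-1$, $m$ = row, $n$ = column), and an array of letters is sent to the block array obtained by replacing each letter by its image. The images are: - $\Phi_p(A)_{m,n}$ is $A$ if $m,n$ both even; $0$ if $m$ even, $n$ odd; $F$ if $m$ odd, $n$ even; $B$ if $m,n$ both odd. - $\Phi_p(B)_{m,n}$ is $B$ if $m,n$ both even; $F$ if $m$ even, $n$ odd; $0$ if $m$ odd, $n$ even; $A$ if $m,n$ both odd. - $\Phi_p(0)$ is the all-$0$ array. - $\Phi_p(F)$: $C_{NW}$ at $(0,0)$, $C_{NE}$ at $(0,p-1)$, $C_{SW}$ at $(p-1,0)$, $C_{SE}$ at $(p-1,p-1)$; $E_N$ at $(0,n)$, $E_S$ at $(p-1,n)$ for $0<n<p-1$; $E_W$ at $(m,0)$, $E_E$ at $(m,p-1)$ for $0<m<p-1$; $0$ elsewhere. - $\Phi_p(E_N)$: $E_N$ on row $0$, $0$ elsewhere; $\Phi_p(E_S)$: $E_S$ on row $p-1$, $0$ elsewhere; $\Phi_p(E_E)$: $E_E$ on column $p-1$, $0$ elsewhere; $\Phi_p(E_W)$: $E_W$ on column $0$, $0$ elsewhere. - $\Phi_p(C_{NW})$: $C_{NW}$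 at $(0,0)$, $E_N$ at $(0,n)$ for $n\neq0$, $E_W$ at $(m,0)$ for $m\ne0$, $0$ elsewhere. - $\Phi_p(C_{NE})$: $C_{NE}$ at $(0,p-1)$, $E_N$ at $(0,n)$ for $n\ne p-1$, $E_E$ at $(m,p-1)$ for $m\ne0$, $0$ elsewhere. - $\Phi_p(C_{SE})$: $C_{SE}$ at $(p-1,p-1)$, $E_S$ at $(p-1,n)$ for $n\ne p-1$, $E_E$ at $(m,p-1)$ for $m\ne p-1$, $0$ elsewhere. - $\Phi_p(C_{SW})$: $C_{SW}$ at $(p-1,0)$, $E_S$ at $(p-1,n)$ for $n\ne0$, $E_W$ at $(m,0)$ for $m\ne p-1$, $0$ elsewhere. Since $\Phi_p(A)_{0,0}=A$, the arrays $\Phi_p^k(A)$ ($p^k\times p^k$) are each the top-left block of the next, and $\Phi_p^\infty(A)$ is their limit, an infinite array indexed by $m,n\ge0$. $\Pi$ is the letter-by-letter coding $\Pi(0)=0$ and $\Pi(L)=X$ for every letter $L\ne 0$. -}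

module Defs where

open import Data.Nat as ℕ using (ℕ; zero; suc; _+_; _*_; _∸_; _^_; _≡ᵇ_)
open import Data.Nat.DivMod using (_%_; _/_)
open import Data.Nat.Combinatorics using (_C_)
open import Data.Nat.Divisibility using (_∣?_)
open import Data.Integer as ℤ using (ℤ; +_; -[1+_]; 0ℤ; 1ℤ)
open import Data.Fin using (Fin; toℕ; punchIn) renaming (zero to fz; suc to fs)
open import Data.List using (List; []; _∷_; map; concatMap; foldr; upTo; allFin)
open import Data.Bool using (Bool; true; false; if_then_else_; _∧_)
open import Relation.Nullary using (does)

-- Safe division / remainder by p (p is prime in the theorem, so p ≠ 0;
-- for p = 0 these return garbage that is never used).

modP : ℕ → ℕ → ℕ
modP zero    n = n
modP (suc q) n = n % suc q

divP : ℕ → ℕ → ℕ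
divP zero    n = 0
divP (suc q) n = n / suc q

isEven : ℕ → Bool
isEven n = (n % 2) ≡ᵇ 0

half : ℕ → ℕ
half p = (p ∸ 1) / 2

-- binom(p₂, i/2) with the real-argument convention: 0 unless i/2 is a
-- nonnegative integer ≤ p₂.  (_C_ from the stdlib is 0 when k > n.)
coef : ℕ → ℕ → ℕ
coef p i = if isEven i then half p C (i / 2) else 0

φ : ℕ → List ℕ → List ℕ
φ p = concatMap (λ n → map (λ i → modP p (n * coef p i)) (upTo p))

φ^ : ℕ → ℕ → List ℕ → List ℕ
φ^ p zero    w = w
φ^ p (suc k) w = φ p (φ^ p k w)

at : List ℕ → ℕ → ℕ
at []      _       = 0
at (x ∷ _) zero    = x
at (_ ∷ w) (suc i) = at w i

-- The p-Cantor sequence: c_i is the i-th letter of φ_p^k(1) for any k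
-- with p^k > i; we take k = i + 1 (p ≥ 2 so p^(i+1) > i).
cantor : ℕ → ℕ → ℕ
cantor p i = at (φ^ p (suc i) (1 ∷ [])) i

cantorL : ℕ → ℤ → ℤ
cantorL p (+ i)    = + cantor p i
cantorL p -[1+ i ] = 0ℤ

-- Determinants (Laplace expansion along the first row), over ℤ.
-- For a matrix with entries in {0,…,p-1}, its determinant over F_p is
-- the integer determinant reduced mod p.

sumℤ : List ℤ → ℤ
sumℤ = foldr ℤ._+_ 0ℤ

det : (n : ℕ) → (Fin n → Fin n → ℤ) → ℤ
det zero    M = 1ℤ
det (suc n) M = sumℤ (map term (allFin (suc n)))
  where
  sgn : Fin (suc n) → ℤ → ℤ
  sgn j x = if isEven (toℕ j) then x else ℤ.- x
  term : Fin (suc n) → ℤ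
  term j = sgn j (M fz j ℤ.* det n (λ i k → M (fs i) (punchIn j k)))

-- Number wall W(S)[m,n] (as an integer; its value in F_p is the residue mod p)
wall : (ℤ → ℤ) → ℤ → ℤ → ℤ
wall S (+ m)          n = det (suc m) (λ i j → S ((+ toℕ i ℤ.- + toℕ j) ℤ.+ n))
wall S -[1+ zero ]    n = 1ℤ
wall S -[1+ suc _ ]   n = 0ℤ

data Sym : Set where
  O X : Sym

χ : ℕ → ℤ → Sym
χ p w = if does (p ∣? ℤ.∣ w ∣) then O else X

data Letter : Set where
  A B F Z EN EE ES EW CNE CSE CSW CNW : Letter

-- Φ_p(L)_{m,n} for 0 ≤ m,n ≤ p-1
img : ℕ → Letter → ℕ → ℕ → Letter
img p A m n = if isEven m then (if isEven n then A else Z)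
                          else (if isEven n then F else B)
img p B m n = if isEven m then (if isEven n then B else F)
                          else (if isEven n then Z else A)
img p Z m n = Z
img p F m n =
  if (m ≡ᵇ 0) ∧ (n ≡ᵇ 0) then CNW else
  if (m ≡ᵇ 0) ∧ (n ≡ᵇ (p ∸ 1)) then CNE else
  if (m ≡ᵇ (p ∸ 1)) ∧ (n ≡ᵇ 0) then CSW else
  if (m ≡ᵇ (p ∸ 1)) ∧ (n ≡ᵇ (p ∸ 1)) then CSE else
  if m ≡ᵇ 0 then EN else
  if m ≡ᵇ (p ∸ 1) then ES else
  if n ≡ᵇ 0 then EW else
  if n ≡ᵇ (p ∸ 1) then EE else Z
img p EN m n = if m ≡ᵇ 0 then EN else Z
img p ES m n = if m ≡ᵇ (p ∸ 1) then ES else Z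
img p EE m n = if n ≡ᵇ (p ∸ 1) then EE else Z
img p EW m n = if n ≡ᵇ 0 then EW else Z
img p CNW m n =
  if (m ≡ᵇ 0) ∧ (n ≡ᵇ 0) then CNW else
  if m ≡ᵇ 0 then EN else
  if n ≡ᵇ 0 then EW else Z
img p CNE m n =
  if (m ≡ᵇ 0) ∧ (n ≡ᵇ (p ∸ 1)) then CNE else
  if m ≡ᵇ 0 then EN else
  if n ≡ᵇ (p ∸ 1) then EE else Z
img p CSE m n =
  if (m ≡ᵇ (p ∸ 1)) ∧ (n ≡ᵇ (p ∸ 1)) then CSE else
  if m ≡ᵇ (p ∸ 1) then ES else
  if n ≡ᵇ (p ∸ 1) then EE else Z
img p CSW m n =
  if (m ≡ᵇ (p ∸ 1)) ∧ (n ≡ᵇ 0) then CSW else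
  if m ≡ᵇ (p ∸ 1) then ES else
  if n ≡ᵇ 0 then EW else Z

-- Φ_p^k(A)[m,n] for 0 ≤ m,n < p^k: the entry (m,n) of Φ_p^{k+1}(A) lies
-- in block (⌊m/p⌋,⌊n/p⌋), which is Φ_p applied to Φ_p^k(A)[⌊m/p⌋,⌊n/p⌋].
Φ^ : ℕ → ℕ → ℕ → ℕ → Letter
Φ^ p zero    m n = A
Φ^ p (suc k) m n = img p (Φ^ p k (divP p m) (divP p n)) (modP p m) (modP p n)

-- Φ_p^∞(A)[m,n] = Φ_p^k(A)[m,n] for any k with p^k > m, n;
-- we take k = m + n + 1.
Φ∞ : ℕ → ℕ → ℕ → Letter
Φ∞ p m n = Φ^ p (suc (m + n)) m n

Π : Letter → Sym
Π Z = O
Π _ = X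

module Submission where

open import Defs

-- Over F_p the Cantor series is (1 + x²)^(-1/2), so up to powers of 2 the wall entry is a Toeplitz
-- determinant of the integers β 0 k = (-1)^k binom(2k, k) interleaved with zeros, a checkerboard matrix.
-- The ratio k β_t(k) = (4t + 2 - 4k) β_t(k-1) of consecutive coefficients of (1 + 4x)^(t-1/2) turns
-- column elimination into a recursion t ↦ t + 1, and the determinant becomes a quotient of two
-- products of factors 4i - 4l - 2 and i + l + 1. Comparing, for each power q of p, how many factors of
-- either kind are divisible by q shows that the entry at (m, n) vanishes modulo p iff for some q the
-- point (m, n) lies in a zero tile of the q × q tiling (Dead below). The substitution produces the
-- same set, digit by digit in base p.

-- The closed formula cannot be used modulo `p` directly, because it divides by numbers that may be
-- multiples of `p`. Hence the entries are lifted to integers, the determinant is computed exactly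
-- up to sign, and only then are valuations compared. The powers of 2 come from binom(-1/2, k) =
-- (-1)^k binom(2k, k) / 4^k: they make the lift integral, and as the (i, j) entry has index i - j +
-- n they split into a row factor and a column factor, both units modulo `p`. The comparison works
-- scale by scale because at every `q` the numerator has at least as many factors divisible by `q`
-- as the denominator, so a surplus at one scale is never cancelled at another. Cells with m even
-- and n odd escape the formula: there the blocks of the checkerboard are not square and the matrix
-- is singular, which is the zero tile for `q` = 1. A letter of the substitution records a single
-- scale; smaller scales cannot kill a cell on a frame, because the frame digits 0 and `p` - 1 are
-- both even.

module Determinants where

  -- Laplace determinants and column operations.

  open import Data.Nat as ℕ using (ℕ; zero; suc; s≤s; z≤n; _<_)
  import Data.Nat.Properties as ℕP
  open import Data.Integer using (ℤ; 0ℤ; 1ℤ; _+_; _-_; _*_; -_)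
  open import Data.Integer.Properties
  open import Data.Integer.Tactic.RingSolver using (solve-∀)
  open import Data.Fin using (Fin; toℕ; punchIn) renaming (zero to fz; suc to fs)
  open import Data.Bool using (if_then_else_)
  open import Data.List using (foldr; tabulate)
  open import Data.List.Properties using (map-tabulate)
  open import Data.Product using (∃; _×_; _,_)
  open import Data.Sum using (_⊎_; inj₁; inj₂)
  open import Function using (_∘_; id)
  open import Relation.Binary.Definitions using (tri<; tri≈; tri>)
  open import Relation.Nullary using (yes; no; contradiction)
  open import Relation.Binary.PropositionalEquality
  open ≡-Reasoning

  Matrix : Set
  Matrix = ℕ → ℕ → ℤ

  alt : ℕ → (ℕ → ℤ) → ℤ
  alt zero    f = 0ℤ
  alt (suc n) f = f 0 - alt n (f ∘ suc)

  -- The counterpart of `punchIn` on natural numbers: the increasing enumeration of all indices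
  -- other than the first argument.
  skip : ℕ → ℕ → ℕ
  skip zero    k       = suc k
  skip (suc j) zero    = zero
  skip (suc j) (suc k) = suc (skip j k)

  minor : ℕ → Matrix → Matrix
  minor j M i k = M (suc i) (skip j k)

  -- Indexing by ℕ instead of Fin n makes column operations free of bound proofs.
  Det : ℕ → Matrix → ℤ
  Det zero    M = 1ℤ
  Det (suc n) M = alt (suc n) (λ j → M 0 j * Det n (minor j M))

  alt-cong : ∀ n {f g} → (∀ j → j < n → f j ≡ g j) → alt n f ≡ alt n g
  alt-cong zero    f≗g = refl
  alt-cong (suc n) f≗g =
    cong₂ _-_ (f≗g 0 (s≤s z≤n)) (alt-cong n (λ j j<n → f≗g (suc j) (s≤s j<n)))

  alt-linear : ∀ n α β f g → alt n (λ j → α * f j + β * g j) ≡ α * alt n f + β * alt n g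
  alt-linear zero    α β f g = lem α β
    where lem : ∀ α β → 0ℤ ≡ α * 0ℤ + β * 0ℤ
          lem = solve-∀
  alt-linear (suc n) α β f g = begin
    (α * f 0 + β * g 0) - alt n (λ j → α * f (suc j) + β * g (suc j))
      ≡⟨ cong (λ z → (α * f 0 + β * g 0) - z) (alt-linear n α β (f ∘ suc) (g ∘ suc)) ⟩
    (α * f 0 + β * g 0) - (α * alt n (f ∘ suc) + β * alt n (g ∘ suc))
      ≡⟨ lem α β (f 0) (g 0) (alt n (f ∘ suc)) (alt n (g ∘ suc)) ⟩
    α * (f 0 - alt n (f ∘ suc)) + β * (g 0 - alt n (g ∘ suc)) ∎
    where lem : ∀ α β a b x y → (α * a + β * b) - (α * x + β * y) ≡ α * (a - x) + β * (b - y)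
          lem = solve-∀

  alt-zero : ∀ n {f} → (∀ j → j < n → f j ≡ 0ℤ) → alt n f ≡ 0ℤ
  alt-zero zero    f≗0 = refl
  alt-zero (suc n) f≗0 = cong₂ _-_ (f≗0 0 (s≤s z≤n)) (alt-zero n (λ j j<n → f≗0 (suc j) (s≤s j<n)))

  alt-adjacent : ∀ n c {f} → suc c < n → f c ≡ f (suc c) →
    (∀ j → j < n → j ≢ c → j ≢ suc c → f j ≡ 0ℤ) → alt n f ≡ 0ℤ
  alt-adjacent (suc (suc n)) zero {f} _ eq f≗0 = begin
    f 0 - (f 1 - alt n (λ j → f (suc (suc j))))
      ≡⟨ cong₂ (λ x y → x - (f 1 - y)) eq
           (alt-zero n (λ j j<n → f≗0 (suc (suc j)) (s≤s (s≤s j<n)) (λ ()) (λ ()))) ⟩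
    f 1 - (f 1 - 0ℤ) ≡⟨ lem (f 1) ⟩
    0ℤ ∎
    where lem : ∀ a → a - (a - 0ℤ) ≡ 0ℤ
          lem = solve-∀
  alt-adjacent (suc n) (suc c) (s≤s c<n) eq f≗0 =
    cong₂ _-_ (f≗0 0 (s≤s z≤n) (λ ()) (λ ()))
      (alt-adjacent n c c<n eq
        (λ j j<n j≢c j≢c+1 → f≗0 (suc j) (s≤s j<n) (j≢c ∘ ℕP.suc-injective) (j≢c+1 ∘ ℕP.suc-injective)))

  skip< : ∀ j {k n} → k < n → skip j k < suc n
  skip< zero            k<n       = s≤s k<n
  skip< (suc j) {zero}  k<n       = s≤s z≤n
  skip< (suc j) {suc k} (s≤s k<n) = s≤s (skip< j k<n)

  skip≢ : ∀ j k → skip j k ≢ j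
  skip≢ (suc j) (suc k) eq = skip≢ j k (ℕP.suc-injective eq)

  skip-injective : ∀ j {k l} → skip j k ≡ skip j l → k ≡ l
  skip-injective zero    eq = ℕP.suc-injective eq
  skip-injective (suc j) {zero}  {zero}  eq = refl
  skip-injective (suc j) {suc k} {suc l} eq = cong suc (skip-injective j (ℕP.suc-injective eq))

  skip-surjective : ∀ j c {n} → j ≢ c → c < suc n → j < suc n → ∃ λ c′ → c′ < n × skip j c′ ≡ c
  skip-surjective zero    zero    j≢c _ _ = contradiction refl j≢c
  skip-surjective zero    (suc c) j≢c (s≤s c<n) _ = c , c<n , refl
  skip-surjective (suc j) zero    {suc n} j≢c _ _ = 0 , s≤s z≤n , refl
  skip-surjective (suc j) zero    {zero} j≢c _ (s≤s ())
  skip-surjective (suc j) (suc c) {zero} j≢c (s≤s ()) _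
  skip-surjective (suc j) (suc c) {suc n} j≢c (s≤s c<n) (s≤s j<n)
    with c′ , c′<n , eq ← skip-surjective j c (j≢c ∘ cong suc) c<n j<n
    = suc c′ , s≤s c′<n , cong suc eq

  skip-surjective-adjacent : ∀ j c {n} → j ≢ c → j ≢ suc c → suc c < suc n → j < suc n →
    ∃ λ c′ → suc c′ < n × skip j c′ ≡ c × skip j (suc c′) ≡ suc c
  skip-surjective-adjacent zero zero j≢c _ _ _ = contradiction refl j≢c
  skip-surjective-adjacent zero (suc c) _ _ (s≤s c<n) _ = c , c<n , refl , refl
  skip-surjective-adjacent (suc zero) zero _ j≢1 _ _ = contradiction refl j≢1
  skip-surjective-adjacent (suc (suc j)) zero {suc (suc n)} _ _ _ _ = 0 , s≤s (s≤s z≤n) , refl , refl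
  skip-surjective-adjacent (suc (suc j)) zero {suc zero} _ _ _ (s≤s (s≤s ()))
  skip-surjective-adjacent (suc (suc j)) zero {zero} _ _ (s≤s ()) _
  skip-surjective-adjacent (suc j) (suc c) {suc n} j≢c j≢c+1 (s≤s c<n) (s≤s j<n)
    with c′ , c′<n , eq , eq′ ←
      skip-surjective-adjacent j c (j≢c ∘ cong suc) (j≢c+1 ∘ cong suc) c<n j<n
    = suc c′ , s≤s c′<n , cong suc eq , cong suc eq′

  -- Deleting column `c` or column `c + 1` leaves the same columns except at one position, where the
  -- other of the two survives. This is what makes the two minors in `Det-adjacent` equal.
  skip-suc : ∀ c k → skip c k ≡ skip (suc c) k ⊎ (skip c k ≡ suc c × skip (suc c) k ≡ c)
  skip-suc zero    zero    = inj₂ (refl , refl)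
  skip-suc zero    (suc k) = inj₁ refl
  skip-suc (suc c) zero    = inj₁ refl
  skip-suc (suc c) (suc k) with skip-suc c k
  ... | inj₁ eq         = inj₁ (cong suc eq)
  ... | inj₂ (eq , eq′) = inj₂ (cong suc eq , cong suc eq′)

  Det-cong : ∀ n {M M′} → (∀ i j → j < n → M i j ≡ M′ i j) → Det n M ≡ Det n M′
  Det-cong zero    eq = refl
  Det-cong (suc n) eq = alt-cong (suc n) (λ j j<n →
    cong₂ _*_ (eq 0 j j<n) (Det-cong n (λ i k k<n → eq (suc i) (skip j k) (skip< j k<n))))

  -- In the expansion along row 0, column `c` enters either through the entry, when `j` is `c` and
  -- the three minors agree, or through the minor, where it sits at position `c′` and induction
  -- applies.
  Det-linear : ∀ n c α β {M M₁ M₂} → c < n →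
    (∀ i j → j ≢ c → M i j ≡ M₁ i j) → (∀ i j → j ≢ c → M i j ≡ M₂ i j) →
    (∀ i → M i c ≡ α * M₁ i c + β * M₂ i c) →
    Det n M ≡ α * Det n M₁ + β * Det n M₂
  Det-linear (suc n) c α β {M} {M₁} {M₂} c<n eq₁ eq₂ eqc = begin
    Det (suc n) M ≡⟨ alt-cong (suc n) term ⟩
    alt (suc n) (λ j → α * f₁ j + β * f₂ j) ≡⟨ alt-linear (suc n) α β f₁ f₂ ⟩
    α * Det (suc n) M₁ + β * Det (suc n) M₂ ∎
    where
    f f₁ f₂ : ℕ → ℤ
    f  j = M 0 j * Det n (minor j M)
    f₁ j = M₁ 0 j * Det n (minor j M₁)
    f₂ j = M₂ 0 j * Det n (minor j M₂)
    distribʳ : ∀ α β x y d → (α * x + β * y) * d ≡ α * (x * d) + β * (y * d)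
    distribʳ = solve-∀
    distribˡ : ∀ α β x d e → x * (α * d + β * e) ≡ α * (x * d) + β * (x * e)
    distribˡ = solve-∀
    term : ∀ j → j < suc n → f j ≡ α * f₁ j + β * f₂ j
    term j j<n with j ℕP.≟ c
    ... | yes refl = begin
      M 0 j * Det n (minor j M)
        ≡⟨ cong (_* Det n (minor j M)) (eqc 0) ⟩
      (α * M₁ 0 j + β * M₂ 0 j) * Det n (minor j M)
        ≡⟨ distribʳ α β (M₁ 0 j) (M₂ 0 j) (Det n (minor j M)) ⟩
      α * (M₁ 0 j * Det n (minor j M)) + β * (M₂ 0 j * Det n (minor j M))
        ≡⟨ cong₂ (λ x y → α * (M₁ 0 j * x) + β * (M₂ 0 j * y))
             (Det-cong n (λ i k _ → eq₁ (suc i) (skip j k) (skip≢ j k)))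
             (Det-cong n (λ i k _ → eq₂ (suc i) (skip j k) (skip≢ j k))) ⟩
      α * f₁ j + β * f₂ j ∎
    ... | no j≢c with c′ , c′<n , refl ← skip-surjective j c j≢c c<n j<n = begin
      M 0 j * Det n (minor j M)
        ≡⟨ cong (M 0 j *_) (Det-linear n c′ α β c′<n
             (λ i k k≢c′ → eq₁ (suc i) (skip j k) (k≢c′ ∘ skip-injective j))
             (λ i k k≢c′ → eq₂ (suc i) (skip j k) (k≢c′ ∘ skip-injective j))
             (λ i → eqc (suc i))) ⟩
      M 0 j * (α * Det n (minor j M₁) + β * Det n (minor j M₂))
        ≡⟨ distribˡ α β (M 0 j) (Det n (minor j M₁)) (Det n (minor j M₂)) ⟩
      α * (M 0 j * Det n (minor j M₁)) + β * (M 0 j * Det n (minor j M₂))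
        ≡⟨ cong₂ (λ x y → α * (x * Det n (minor j M₁)) + β * (y * Det n (minor j M₂)))
             (eq₁ 0 j j≢c) (eq₂ 0 j j≢c) ⟩
      α * f₁ j + β * f₂ j ∎

  -- The terms at `c` and `c + 1` cancel, having equal minors and opposite signs; every other minor
  -- still contains the two columns side by side, so induction applies to it.
  Det-adjacent : ∀ n c {M} → suc c < n → (∀ i → M i c ≡ M i (suc c)) → Det n M ≡ 0ℤ
  Det-adjacent (suc n) c {M} c<n eq = alt-adjacent (suc n) c c<n
    (cong₂ _*_ (eq 0) (Det-cong n (λ i k _ → same (suc i) k)))
    other
    where
    same : ∀ i k → M i (skip c k) ≡ M i (skip (suc c) k)
    same i k with skip-suc c k
    ... | inj₁ e = cong (M i) e
    ... | inj₂ (e , e′) rewrite e | e′ = sym (eq i)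
    other : ∀ j → j < suc n → j ≢ c → j ≢ suc c → M 0 j * Det n (minor j M) ≡ 0ℤ
    other j j<n j≢c j≢c+1
      with c′ , c′<n , e , e′ ← skip-surjective-adjacent j c j≢c j≢c+1 c<n j<n
      = trans (cong (M 0 j *_) (Det-adjacent n c′ c′<n
                (λ i → trans (cong (M (suc i)) e) (trans (eq (suc i)) (sym (cong (M (suc i)) e′))))))
              (*-zeroʳ (M 0 j))

  infixl 10 _[_≔_]
  _[_≔_] : Matrix → ℕ → (ℕ → ℤ) → Matrix
  (M [ c ≔ v ]) i j with j ℕP.≟ c
  ... | yes _ = v i
  ... | no  _ = M i j

  ≔-same : ∀ M c v i → (M [ c ≔ v ]) i c ≡ v i
  ≔-same M c v i with c ℕP.≟ c
  ... | yes _  = refl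
  ... | no c≢c = contradiction refl c≢c

  ≔-other : ∀ M c v i {j} → j ≢ c → (M [ c ≔ v ]) i j ≡ M i j
  ≔-other M c v i {j} j≢c with j ℕP.≟ c
  ... | yes j≡c = contradiction j≡c j≢c
  ... | no _    = refl

  -- Expand the vanishing determinant with columns (x , y + x , y + x) in positions c, c+1, c+2.
  Det-distance-two : ∀ n c {M} → suc (suc c) < n → (∀ i → M i c ≡ M i (suc (suc c))) → Det n M ≡ 0ℤ
  Det-distance-two n c {M} c+2<n eq = begin
    Det n M                         ≡⟨ lem (Det n M) ⟩
    1ℤ * (1ℤ * 0ℤ + 1ℤ * 0ℤ) + 1ℤ * (1ℤ * Det n M + 1ℤ * 0ℤ) ≡⟨ cong₂ (λ u v → 1ℤ * u + 1ℤ * v) (sym second-y) (sym second-x) ⟩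
    1ℤ * Det n Nʸ + 1ℤ * Det n Nˣ   ≡⟨ sym third ⟩
    Det n N                         ≡⟨ Det-adjacent n c₁ c+2<n (λ i → trans (N₁ i) (sym (N₂ i))) ⟩
    0ℤ ∎
    where
    c₁ = suc c
    c₂ = suc (suc c)
    x y x+y : ℕ → ℤ
    x i = M i c
    y i = M i c₁
    x+y i = 1ℤ * y i + 1ℤ * x i
    c₁<n : c₁ < n
    c₁<n = ℕP.<-trans (ℕP.n<1+n c₁) c+2<n
    c≢c₁ : c ≢ c₁
    c≢c₁ = ℕP.<⇒≢ (ℕP.n<1+n c)
    c≢c₂ : c ≢ c₂
    c≢c₂ = ℕP.<⇒≢ (ℕP.m<n⇒m<1+n (ℕP.n<1+n c))
    c₁≢c₂ : c₁ ≢ c₂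
    c₁≢c₂ = ℕP.<⇒≢ (ℕP.n<1+n c₁)
    T : (ℕ → ℤ) → (ℕ → ℤ) → Matrix
    T u v = M [ c₁ ≔ u ] [ c₂ ≔ v ]
    T₀ : ∀ u v i → T u v i c ≡ x i
    T₀ u v i = trans (≔-other (M [ c₁ ≔ u ]) c₂ v i c≢c₂) (≔-other M c₁ u i c≢c₁)
    T₁ : ∀ u v i → T u v i c₁ ≡ u i
    T₁ u v i = trans (≔-other (M [ c₁ ≔ u ]) c₂ v i c₁≢c₂) (≔-same M c₁ u i)
    T₂ : ∀ u v i → T u v i c₂ ≡ v i
    T₂ u v i = ≔-same (M [ c₁ ≔ u ]) c₂ v i
    T-third : ∀ u v w i j → j ≢ c₂ → T u v i j ≡ T u w i j
    T-third u v w i j j≢ = trans (≔-other (M [ c₁ ≔ u ]) c₂ v i j≢) (sym (≔-other (M [ c₁ ≔ u ]) c₂ w i j≢))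
    T-second : ∀ u u′ v i j → j ≢ c₁ → T u v i j ≡ T u′ v i j
    T-second u u′ v i j j≢ with j ℕP.≟ c₂
    ... | yes _ = refl
    ... | no _  = trans (≔-other M c₁ u i j≢) (sym (≔-other M c₁ u′ i j≢))
    N Nˣ Nʸ : Matrix
    N  = T x+y x+y
    Nʸ = T x+y y
    Nˣ = T x+y x
    N₁ : ∀ i → N i c₁ ≡ x+y i
    N₁ = T₁ x+y x+y
    N₂ : ∀ i → N i c₂ ≡ x+y i
    N₂ = T₂ x+y x+y
    third : Det n N ≡ 1ℤ * Det n Nʸ + 1ℤ * Det n Nˣ
    third = Det-linear n c₂ 1ℤ 1ℤ c+2<n (T-third x+y x+y y) (T-third x+y x+y x)
      (λ i → trans (N₂ i) (sym (cong₂ (λ u v → 1ℤ * u + 1ℤ * v) (T₂ x+y y i) (T₂ x+y x i))))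
    second : ∀ v → Det n (T x+y v) ≡ 1ℤ * Det n (T y v) + 1ℤ * Det n (T x v)
    second v = Det-linear n c₁ 1ℤ 1ℤ c₁<n (T-second x+y y v) (T-second x+y x v)
      (λ i → trans (T₁ x+y v i) (sym (cong₂ (λ u v → 1ℤ * u + 1ℤ * v) (T₁ y v i) (T₁ x v i))))
    T-yy : Det n (T y y) ≡ 0ℤ
    T-yy = Det-adjacent n c₁ c+2<n (λ i → trans (T₁ y y i) (sym (T₂ y y i)))
    T-x : ∀ v → Det n (T x v) ≡ 0ℤ
    T-x v = Det-adjacent n c c₁<n (λ i → trans (T₀ x v i) (sym (T₁ x v i)))
    T-yx : Det n (T y x) ≡ Det n M
    T-yx = Det-cong n (λ i j _ → restore i j)
      where
      restore : ∀ i j → T y x i j ≡ M i j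
      restore i j with j ℕP.≟ c₂
      ... | yes refl = eq i
      ... | no _ with j ℕP.≟ c₁
      ...   | yes refl = refl
      ...   | no _     = refl
    second-y : Det n Nʸ ≡ 1ℤ * 0ℤ + 1ℤ * 0ℤ
    second-y = trans (second y) (cong₂ (λ u v → 1ℤ * u + 1ℤ * v) T-yy (T-x y))
    second-x : Det n Nˣ ≡ 1ℤ * Det n M + 1ℤ * 0ℤ
    second-x = trans (second x) (cong₂ (λ u v → 1ℤ * u + 1ℤ * v) T-yx (T-x x))
    lem : ∀ d → d ≡ 1ℤ * (1ℤ * 0ℤ + 1ℤ * 0ℤ) + 1ℤ * (1ℤ * d + 1ℤ * 0ℤ)
    lem = solve-∀

  Det-column-op : ∀ n c α β {M M′} → suc (suc c) < n →
    (∀ i j → j ≢ suc (suc c) → M′ i j ≡ M i j) →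
    (∀ i → M′ i (suc (suc c)) ≡ α * M i (suc (suc c)) + β * M i c) →
    Det n M′ ≡ α * Det n M
  Det-column-op n c α β {M} {M′} c+2<n eq eqc = begin
    Det n M′                      ≡⟨ Det-linear n (suc (suc c)) α β c+2<n eq
                                       (λ i j j≢ → trans (eq i j j≢) (sym (≔-other M c₂ v i j≢)))
                                       (λ i → trans (eqc i) (cong (λ z → α * M i c₂ + β * z) (sym (≔-same M c₂ v i)))) ⟩
    α * Det n M + β * Det n L     ≡⟨ cong (λ z → α * Det n M + β * z)
                                       (Det-distance-two n c c+2<n
                                         (λ i → trans (≔-other M c₂ v i c≢c₂) (sym (≔-same M c₂ v i)))) ⟩
    α * Det n M + β * 0ℤ          ≡⟨ lem α β (Det n M) ⟩
    α * Det n M ∎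
    where
    c₂ = suc (suc c)
    v : ℕ → ℤ
    v i = M i c
    L = M [ c₂ ≔ v ]
    c≢c₂ : c ≢ c₂
    c≢c₂ = ℕP.<⇒≢ (ℕP.m<n⇒m<1+n (ℕP.n<1+n c))
    lem : ∀ α β d → α * d + β * 0ℤ ≡ α * d
    lem = solve-∀

  ∏ : ℕ → (ℕ → ℤ) → ℤ
  ∏ zero    f = 1ℤ
  ∏ (suc n) f = f 0 * ∏ n (f ∘ suc)

  ∏-last : ∀ n f → ∏ (suc n) f ≡ ∏ n f * f n
  ∏-last zero    f = trans (*-identityʳ (f 0)) (sym (*-identityˡ (f 0)))
  ∏-last (suc n) f = trans (cong (f 0 *_) (∏-last n (f ∘ suc))) (sym (*-assoc (f 0) (∏ n (f ∘ suc)) (f (suc n))))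

  Det-column-ops : ∀ n (α β : ℕ → ℤ) {M M′} →
    (∀ i → M′ i 0 ≡ M i 0) → (∀ i → M′ i 1 ≡ M i 1) →
    (∀ i j → M′ i (suc (suc j)) ≡ α j * M i (suc (suc j)) + β j * M i j) →
    Det (suc (suc n)) M′ ≡ ∏ n α * Det (suc (suc n)) M
  Det-column-ops n α β {M} {M′} eq₀ eq₁ eq₂ =
    trans (Det-cong (suc (suc n)) (λ i j _ → sym (all i j)))
      (trans (reduce n ℕP.≤-refl)
        (cong (∏ n α *_) (Det-cong (suc (suc n)) (λ i j j< → mix-low n i j j<))))
    where
    -- Columns below `c + 2` come from `M`, the others from `M′`. Restoring the columns from left to
    -- right guarantees that the column used as operand is already the original one.
    mix : ℕ → Matrix
    mix c i j with j ℕ.<? suc (suc c)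
    ... | yes _ = M i j
    ... | no  _ = M′ i j
    mix-low : ∀ c i j → j < suc (suc c) → mix c i j ≡ M i j
    mix-low c i j j< with j ℕ.<? suc (suc c)
    ... | yes _ = refl
    ... | no ¬< = contradiction j< ¬<
    mix-high : ∀ c i j → suc (suc c) ℕ.≤ j → mix c i j ≡ M′ i j
    mix-high c i j ≤j with j ℕ.<? suc (suc c)
    ... | yes j< = contradiction j< (ℕP.≤⇒≯ ≤j)
    ... | no _   = refl
    all : ∀ i j → mix 0 i j ≡ M′ i j
    all i zero          = sym (eq₀ i)
    all i (suc zero)    = sym (eq₁ i)
    all i (suc (suc j)) = mix-high 0 i (suc (suc j)) (s≤s (s≤s z≤n))
    step-other : ∀ c i j → j ≢ suc (suc c) → mix c i j ≡ mix (suc c) i j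
    step-other c i j j≢ with ℕP.<-cmp j (suc (suc c))
    ... | tri< j< _ _ = trans (mix-low c i j j<) (sym (mix-low (suc c) i j (ℕP.m<n⇒m<1+n j<)))
    ... | tri≈ _ j≡ _ = contradiction j≡ j≢
    ... | tri> _ _ j> = trans (mix-high c i j (ℕP.<⇒≤ j>)) (sym (mix-high (suc c) i j j>))
    step-here : ∀ c i → mix c i (suc (suc c)) ≡ α c * mix (suc c) i (suc (suc c)) + β c * mix (suc c) i c
    step-here c i = begin
      mix c i (suc (suc c))                   ≡⟨ mix-high c i (suc (suc c)) ℕP.≤-refl ⟩
      M′ i (suc (suc c))                      ≡⟨ eq₂ i c ⟩
      α c * M i (suc (suc c)) + β c * M i c
        ≡⟨ cong₂ (λ x y → α c * x + β c * y)
             (sym (mix-low (suc c) i (suc (suc c)) ℕP.≤-refl))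
             (sym (mix-low (suc c) i c (ℕP.m<n⇒m<1+n (ℕP.m<n⇒m<1+n ℕP.≤-refl)))) ⟩
      α c * mix (suc c) i (suc (suc c)) + β c * mix (suc c) i c ∎
    reduce : ∀ c → c ℕ.≤ n → Det (suc (suc n)) (mix 0) ≡ ∏ c α * Det (suc (suc n)) (mix c)
    reduce zero    _   = sym (*-identityˡ _)
    reduce (suc c) c<n = begin
      Det (suc (suc n)) (mix 0)                          ≡⟨ reduce c (ℕP.<⇒≤ c<n) ⟩
      ∏ c α * Det (suc (suc n)) (mix c)
        ≡⟨ cong (∏ c α *_) (Det-column-op (suc (suc n)) c (α c) (β c) (s≤s (s≤s c<n)) (step-other c) (step-here c)) ⟩
      ∏ c α * (α c * Det (suc (suc n)) (mix (suc c)))    ≡⟨ sym (*-assoc (∏ c α) (α c) _) ⟩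
      ∏ c α * α c * Det (suc (suc n)) (mix (suc c))      ≡⟨ cong (_* Det (suc (suc n)) (mix (suc c))) (sym (∏-last c α)) ⟩
      ∏ (suc c) α * Det (suc (suc n)) (mix (suc c)) ∎

  Det-scale-rows : ∀ n (u : ℕ → ℤ) M → Det n (λ i j → u i * M i j) ≡ ∏ n u * Det n M
  Det-scale-rows zero    u M = refl
  Det-scale-rows (suc n) u M = begin
    alt (suc n) (λ j → (u 0 * M 0 j) * Det n (λ i k → u (suc i) * minor j M i k))
      ≡⟨ alt-cong (suc n) (λ j _ → trans
           (cong ((u 0 * M 0 j) *_) (Det-scale-rows n (u ∘ suc) (minor j M)))
           (lem (u 0) (M 0 j) (∏ n (u ∘ suc)) (Det n (minor j M)))) ⟩
    -- The summand `0ℤ * 0ℤ` pads a scalar multiple to the two-term shape of `alt-linear`.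
    alt (suc n) (λ j → (u 0 * ∏ n (u ∘ suc)) * (M 0 j * Det n (minor j M)) + 0ℤ * 0ℤ)
      ≡⟨ alt-linear (suc n) (u 0 * ∏ n (u ∘ suc)) 0ℤ (λ j → M 0 j * Det n (minor j M)) (λ _ → 0ℤ) ⟩
    (u 0 * ∏ n (u ∘ suc)) * Det (suc n) M + 0ℤ * alt (suc n) (λ _ → 0ℤ)
      ≡⟨ lem′ (u 0 * ∏ n (u ∘ suc)) (Det (suc n) M) (alt (suc n) (λ _ → 0ℤ)) ⟩
    (u 0 * ∏ n (u ∘ suc)) * Det (suc n) M ∎
    where
    lem : ∀ a x p d → (a * x) * (p * d) ≡ (a * p) * (x * d) + 0ℤ * 0ℤ
    lem = solve-∀
    lem′ : ∀ a d z → a * d + 0ℤ * z ≡ a * d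
    lem′ = solve-∀

  -- Reassembles the column factors in `Det-scale-columns`: the entry in column `j` contributes
  -- `v j`, its minor contributes all the others.
  ∏-skip : ∀ n (v : ℕ → ℤ) j → j < suc n → ∏ (suc n) v ≡ v j * ∏ n (v ∘ skip j)
  ∏-skip n       v zero    _ = refl
  ∏-skip (suc n) v (suc j) (s≤s j<n) = begin
    v 0 * ∏ (suc n) (v ∘ suc)                        ≡⟨ cong (v 0 *_) (∏-skip n (v ∘ suc) j j<n) ⟩
    v 0 * (v (suc j) * ∏ n (v ∘ suc ∘ skip j))       ≡⟨ lem (v 0) (v (suc j)) (∏ n (v ∘ suc ∘ skip j)) ⟩
    v (suc j) * (v 0 * ∏ n (v ∘ suc ∘ skip j))       ∎
    where lem : ∀ a b c → a * (b * c) ≡ b * (a * c)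
          lem = solve-∀
  ∏-skip zero v (suc j) (s≤s ())

  Det-scale-columns : ∀ n (v : ℕ → ℤ) M → Det n (λ i j → v j * M i j) ≡ ∏ n v * Det n M
  Det-scale-columns zero    v M = refl
  Det-scale-columns (suc n) v M = begin
    alt (suc n) (λ j → (v j * M 0 j) * Det n (λ i k → v (skip j k) * minor j M i k))
      ≡⟨ alt-cong (suc n) (λ j j<n → begin
           (v j * M 0 j) * Det n (λ i k → v (skip j k) * minor j M i k)
             ≡⟨ cong ((v j * M 0 j) *_) (Det-scale-columns n (v ∘ skip j) (minor j M)) ⟩
           (v j * M 0 j) * (∏ n (v ∘ skip j) * Det n (minor j M))
             ≡⟨ lem (v j) (M 0 j) (∏ n (v ∘ skip j)) (Det n (minor j M)) ⟩
           (v j * ∏ n (v ∘ skip j)) * (M 0 j * Det n (minor j M)) + 0ℤ * 0ℤ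
             ≡⟨ cong (λ z → z * (M 0 j * Det n (minor j M)) + 0ℤ * 0ℤ) (sym (∏-skip n v j j<n)) ⟩
           ∏ (suc n) v * (M 0 j * Det n (minor j M)) + 0ℤ * 0ℤ ∎) ⟩
    alt (suc n) (λ j → ∏ (suc n) v * (M 0 j * Det n (minor j M)) + 0ℤ * 0ℤ)
      ≡⟨ alt-linear (suc n) (∏ (suc n) v) 0ℤ (λ j → M 0 j * Det n (minor j M)) (λ _ → 0ℤ) ⟩
    ∏ (suc n) v * Det (suc n) M + 0ℤ * alt (suc n) (λ _ → 0ℤ)
      ≡⟨ lem′ (∏ (suc n) v) (Det (suc n) M) (alt (suc n) (λ _ → 0ℤ)) ⟩
    ∏ (suc n) v * Det (suc n) M ∎
    where
    lem : ∀ a x p d → (a * x) * (p * d) ≡ (a * p) * (x * d) + 0ℤ * 0ℤ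
    lem = solve-∀
    lem′ : ∀ a d z → a * d + 0ℤ * z ≡ a * d
    lem′ = solve-∀

  -- Removing the head shifts every index by one and so reverses all signs; the two parities have to
  -- be proved together.
  alternating-sum : ∀ n (t : Fin n → ℤ) (f : ℕ → ℤ) →
    (∀ j → t j ≡ (if isEven (toℕ j) then f (toℕ j) else - f (toℕ j))) →
    foldr _+_ 0ℤ (tabulate t) ≡ alt n f
  alternating-sum′ : ∀ n (t : Fin n → ℤ) (f : ℕ → ℤ) →
    (∀ j → t j ≡ (if isEven (suc (toℕ j)) then f (toℕ j) else - f (toℕ j))) →
    foldr _+_ 0ℤ (tabulate t) ≡ - alt n f
  alternating-sum zero    t f eq = refl
  alternating-sum (suc n) t f eq =
    cong₂ _+_ (eq fz) (alternating-sum′ n (t ∘ fs) (f ∘ suc) (eq ∘ fs))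
  alternating-sum′ zero    t f eq = refl
  alternating-sum′ (suc n) t f eq =
    -- `isEven` is invariant under adding two by computation, so `eq ∘ fs` already has the type
    -- required for the original parity.
    trans (cong₂ _+_ (eq fz) (alternating-sum n (t ∘ fs) (f ∘ suc) (eq ∘ fs)))
      (lem (f 0) (alt n (f ∘ suc)))
    where lem : ∀ a b → - a + b ≡ - (a - b)
          lem = solve-∀

  toℕ-punchIn : ∀ {n} (j : Fin (suc n)) k → toℕ (punchIn j k) ≡ skip (toℕ j) (toℕ k)
  toℕ-punchIn fz     k      = refl
  toℕ-punchIn (fs j) fz     = refl
  toℕ-punchIn (fs j) (fs k) = cong suc (toℕ-punchIn j k)

  det≡Det : ∀ n (M : Fin n → Fin n → ℤ) (M′ : Matrix) →
    (∀ i j → M i j ≡ M′ (toℕ i) (toℕ j)) → det n M ≡ Det n M′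
  det≡Det zero    M M′ eq = refl
  det≡Det (suc n) M M′ eq = trans (cong sumℤ (map-tabulate id term))
    (alternating-sum (suc n) term (λ j → M′ 0 j * Det n (minor j M′))
      (λ j → cong (λ z → if isEven (toℕ j) then z else - z)
        (cong₂ _*_ (eq fz j)
          (det≡Det n _ (minor (toℕ j) M′)
            (λ i k → trans (eq (fs i) (punchIn j k)) (cong (M′ (suc (toℕ i))) (toℕ-punchIn j k)))))))
    where
    -- Definitionally the summand inside `det`, spelled out so that `map-tabulate` can be
    -- instantiated.
    term : Fin (suc n) → ℤ
    term j = if isEven (toℕ j) then x else - x
      where x = M fz j * det n (λ i k → M (fs i) (punchIn j k))

-- Binomial identities and central binomial coefficients.

module Binomials where

  open import Data.Nat
  open import Data.Nat.Properties
  open import Data.Nat.Combinatorics using (_C_; nCk+nC[k+1]≡[n+1]C[k+1]; k>n⇒nCk≡0)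
  open import Data.Nat.Tactic.RingSolver using (solve-∀)
  open import Relation.Binary.PropositionalEquality
  open ≡-Reasoning

  pascal : ∀ n k → suc n C suc k ≡ n C k + n C suc k
  pascal n k = sym (nCk+nC[k+1]≡[n+1]C[k+1] n k)

  absorption : ∀ n k → suc k * (suc n C suc k) ≡ suc n * (n C k)
  absorption n zero = trans (+-identityʳ _) (trans (one n) (sym (*-identityʳ (suc n))))
    where
    one : ∀ n → suc n C 1 ≡ suc n
    one zero    = refl
    one (suc n) = trans (pascal (suc n) 0) (cong suc (one n))
  absorption zero (suc k) = begin
    suc (suc k) * (1 C suc (suc k)) ≡⟨ cong (suc (suc k) *_) (k>n⇒nCk≡0 {1} {suc (suc k)} (s≤s (s≤s z≤n))) ⟩
    suc (suc k) * 0                 ≡⟨ *-zeroʳ (suc (suc k)) ⟩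
    0                               ≡⟨ sym (cong (1 *_) (k>n⇒nCk≡0 {0} {suc k} (s≤s z≤n))) ⟩
    1 * (0 C suc k)                 ∎
  absorption (suc n) (suc k) = begin
    suc (suc k) * (suc (suc n) C suc (suc k))
      ≡⟨ cong (suc (suc k) *_) (pascal (suc n) (suc k)) ⟩
    suc (suc k) * (suc n C suc k + suc n C suc (suc k))
      ≡⟨ lem (suc k) (suc n C suc k) (suc n C suc (suc k)) ⟩
    suc n C suc k + (suc k * (suc n C suc k) + suc (suc k) * (suc n C suc (suc k)))
      ≡⟨ cong₂ (λ x y → suc n C suc k + (x + y)) (absorption n k) (absorption n (suc k)) ⟩
    suc n C suc k + (suc n * (n C k) + suc n * (n C suc k))
      ≡⟨ cong (suc n C suc k +_) (sym (*-distribˡ-+ (suc n) (n C k) (n C suc k))) ⟩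
    suc n C suc k + suc n * (n C k + n C suc k)
      ≡⟨ cong (λ z → suc n C suc k + suc n * z) (sym (pascal n k)) ⟩
    suc (suc n) * (suc n C suc k) ∎
    where lem : ∀ k x y → suc k * (x + y) ≡ x + (k * x + suc k * y)
          lem = solve-∀

  -- The ratio (n - k) / (k + 1) of neighbours in a row of Pascal's triangle; the term `k * (n C k)`
  -- stays on the left to avoid truncated subtraction.
  C-suc : ∀ n k → suc k * (n C suc k) + k * (n C k) ≡ n * (n C k)
  C-suc n k = +-cancelˡ-≡ (n C k) _ _ (begin
    n C k + (suc k * (n C suc k) + k * (n C k)) ≡⟨ lem k (n C suc k) (n C k) ⟩
    suc k * (n C k + n C suc k)                 ≡⟨ cong (suc k *_) (sym (pascal n k)) ⟩
    suc k * (suc n C suc k)                     ≡⟨ absorption n k ⟩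
    n C k + n * (n C k)                         ∎)
    where lem : ∀ k x y → y + (suc k * x + k * y) ≡ suc k * (y + x)
          lem = solve-∀

  central : ℕ → ℕ
  central k = (k + k) C k

  -- Two applications of `absorption`, with `C-suc` exchanging the two middle entries of row 2k + 1.
  -- Up to sign this is `β-ratio` for t = 0, the start of its induction.
  central-suc : ∀ k → suc k * central (suc k) ≡ 2 * (suc (k + k)) * central k
  central-suc k = *-cancelˡ-≡ _ _ (suc k) (begin
    suc k * (suc k * ((suc k + suc k) C suc k))
      ≡⟨ cong (λ z → suc k * (suc k * (suc z C suc k))) (+-suc k k) ⟩
    suc k * (suc k * (suc (suc (k + k)) C suc k))
      ≡⟨ cong (suc k *_) (absorption (suc (k + k)) k) ⟩
    suc k * (suc (suc (k + k)) * (suc (k + k) C k))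
      ≡⟨ lem₁ k (suc (k + k) C k) ⟩
    2 * suc k * (suc k * (suc (k + k) C k))
      ≡⟨ cong (2 * suc k *_) mid ⟩
    2 * suc k * (suc (k + k) * central k)
      ≡⟨ lem₂ k (central k) ⟩
    suc k * (2 * (suc (k + k)) * central k) ∎)
    where
    lem₁ : ∀ k x → suc k * (suc (suc (k + k)) * x) ≡ 2 * suc k * (suc k * x)
    lem₁ = solve-∀
    lem₂ : ∀ k x → 2 * suc k * (suc (k + k) * x) ≡ suc k * (2 * (suc (k + k)) * x)
    lem₂ = solve-∀
    lem₃ : ∀ k x → suc (k + k) * x ≡ suc k * x + k * x
    lem₃ = solve-∀
    mid : suc k * (suc (k + k) C k) ≡ suc (k + k) * central k
    mid = begin
      suc k * (suc (k + k) C k)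
        ≡⟨ +-cancelʳ-≡ (k * (suc (k + k) C k)) _ _
             (trans (sym (lem₃ k (suc (k + k) C k))) (sym (C-suc (suc (k + k)) k))) ⟩
      suc k * (suc (k + k) C suc k) ≡⟨ absorption (k + k) k ⟩
      suc (k + k) * central k ∎

-- Interleaved sequences, parity and products of naturals.

module Weaving where

  open import Data.Nat
  open import Data.Nat.Properties
  open import Data.Nat.DivMod
  open import Data.Nat.Tactic.RingSolver using (solve-∀)
  open import Function using (_∘_)
  open import Relation.Binary.PropositionalEquality

  -- Interleaving: `f` occupies the even positions and `g` the odd ones. Swapping the roles at each
  -- step makes parity a structural recursion, and `A` may itself be a type of rows.
  weave : {A : Set} → (ℕ → A) → (ℕ → A) → ℕ → A
  weave f g zero    = f 0
  weave f g (suc j) = weave g (f ∘ suc) j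

  -- Besides the parity of `j`, the view carries the value at `j` of every `weave`, so that one case
  -- split evaluates rows, multipliers and entries alike.
  data Half (j : ℕ) : Set₁ where
    even : ∀ k → j ≡ k + k → (∀ {A : Set} (f g : ℕ → A) → weave f g j ≡ f k) → Half j
    odd  : ∀ k → j ≡ suc (k + k) → (∀ {A : Set} (f g : ℕ → A) → weave f g j ≡ g k) → Half j

  half-view : ∀ j → Half j
  half-view zero = even 0 refl (λ _ _ → refl)
  half-view (suc j) with half-view j
  ... | even k eq w = odd k (cong suc eq) (λ f g → w g (f ∘ suc))
  ... | odd k eq w  = even (suc k) (cong suc (trans eq (sym (+-suc k k)))) (λ f g → w g (f ∘ suc))

  weave-double : ∀ {A : Set} (f g : ℕ → A) k → weave f g (k + k) ≡ f k
  weave-double f g zero    = refl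
  weave-double f g (suc k) = trans (cong (weave g (f ∘ suc)) (+-suc k k)) (weave-double (f ∘ suc) (g ∘ suc) k)

  weave-suc-double : ∀ {A : Set} (f g : ℕ → A) k → weave f g (suc (k + k)) ≡ g k
  weave-suc-double f g k = weave-double g (f ∘ suc) k

  double%2 : ∀ k → (k + k) % 2 ≡ 0
  double%2 k = trans (cong (_% 2) (lem k)) (m*n%n≡0 k 2)
    where lem : ∀ k → k + k ≡ k * 2
          lem = solve-∀

  suc-double%2 : ∀ k → suc (k + k) % 2 ≡ 1
  suc-double%2 k = trans (cong (_% 2) (lem k)) ([m+kn]%n≡m%n 1 k 2)
    where lem : ∀ k → suc (k + k) ≡ 1 + k * 2
          lem = solve-∀

  ∏ᴺ : ℕ → (ℕ → ℕ) → ℕ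
  ∏ᴺ zero    f = 1
  ∏ᴺ (suc n) f = f 0 * ∏ᴺ n (f ∘ suc)

  ∏ᴺ-cong : ∀ n {f g} → (∀ j → f j ≡ g j) → ∏ᴺ n f ≡ ∏ᴺ n g
  ∏ᴺ-cong zero    eq = refl
  ∏ᴺ-cong (suc n) eq = cong₂ _*_ (eq 0) (∏ᴺ-cong n (eq ∘ suc))

  ∏ᴺ-last : ∀ n f → ∏ᴺ (suc n) f ≡ ∏ᴺ n f * f n
  ∏ᴺ-last zero    f = *-comm (f 0) 1
  ∏ᴺ-last (suc n) f = trans (cong (f 0 *_) (∏ᴺ-last n (f ∘ suc))) (sym (*-assoc (f 0) _ _))

  ∏ᴺ-* : ∀ n f g → ∏ᴺ n (λ j → f j * g j) ≡ ∏ᴺ n f * ∏ᴺ n g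
  ∏ᴺ-* zero    f g = refl
  ∏ᴺ-* (suc n) f g = trans (cong (f 0 * g 0 *_) (∏ᴺ-* n (f ∘ suc) (g ∘ suc)))
    (lem (f 0) (g 0) (∏ᴺ n (f ∘ suc)) (∏ᴺ n (g ∘ suc)))
    where lem : ∀ a b x y → a * b * (x * y) ≡ a * x * (b * y)
          lem = solve-∀

  ∏ᴺ-weave : ∀ n f g → ∏ᴺ n (weave f g) ≡ ∏ᴺ ⌈ n /2⌉ f * ∏ᴺ ⌊ n /2⌋ g
  ∏ᴺ-weave zero    f g = refl
  ∏ᴺ-weave (suc n) f g = trans (cong (f 0 *_) (∏ᴺ-weave n g (f ∘ suc)))
    (lem (f 0) (∏ᴺ ⌈ n /2⌉ g) (∏ᴺ ⌊ n /2⌋ (f ∘ suc)))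
    where lem : ∀ a x y → a * (x * y) ≡ a * y * x
          lem = solve-∀

  ∏ᴺ-nonZero : ∀ n {f} → (∀ j → NonZero (f j)) → NonZero (∏ᴺ n f)
  ∏ᴺ-nonZero zero    nz = _
  ∏ᴺ-nonZero (suc n) {f} nz = m*n≢0 (f 0) (∏ᴺ n (f ∘ suc)) {{nz 0}} {{∏ᴺ-nonZero n (nz ∘ suc)}}

-- Integer coefficients, checkerboard matrices and one round of elimination.

module Elimination where

  open Binomials using (central; central-suc)
  open Weaving
  open Determinants
  open import Data.Bool using (Bool; true; false)
  open import Data.Nat as ℕ using (ℕ; zero; suc; ⌈_/2⌉; ⌊_/2⌋)
  import Data.Nat.Properties as ℕP
  import Data.Nat.Tactic.RingSolver as ℕSolver
  open import Data.Integer using (ℤ; +_; -[1+_]; 0ℤ; 1ℤ; _+_; _-_; _*_; -_; ∣_∣)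
  open import Data.Integer.Properties
  open import Data.Integer.Tactic.RingSolver using (solve-∀)
  open import Function using (_∘_)
  open import Relation.Binary.PropositionalEquality
  open ≡-Reasoning

  sign : ℕ → ℤ
  sign zero    = 1ℤ
  sign (suc k) = - sign k

  -- β t k is the coefficient of x^k in (1 + 4x)^(t - 1/2).
  β : ℕ → ℤ → ℤ
  β zero    (+ k)    = sign k * + central k
  β zero    -[1+ k ] = 0ℤ
  β (suc t) k        = β t k + + 4 * β t (k - 1ℤ)

  -- This is 4 ((t - 1/2) - (k - 1)), the factor that the binomial coefficient of exponent t - 1/2
  -- acquires from k - 1 to k.
  γ : ℤ → ℤ → ℤ
  γ t k = + 4 * t + + 2 - + 4 * k

  -- Passing from `t` to `t + 1` multiplies the series by 1 + 4x, so the relation for `t` is used at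
  -- `k` and at `k - 1`. Letting `k` range over all integers removes boundary cases.
  β-ratio : ∀ t k → k * β t k ≡ γ (+ t) k * β t (k - 1ℤ)
  β-ratio zero (+ zero)  = refl
  β-ratio zero (+ suc k) = begin
    + suc k * (- sign k * + central (suc k))     ≡⟨ lem₁ (+ suc k) (sign k) (+ central (suc k)) ⟩
    - sign k * (+ suc k * + central (suc k))     ≡⟨ cong (- sign k *_) (sym (pos-* (suc k) (central (suc k)))) ⟩
    - sign k * + (suc k ℕ.* central (suc k))     ≡⟨ cong (λ z → - sign k * + z) (central-suc k) ⟩
    - sign k * + (2 ℕ.* suc (k ℕ.+ k) ℕ.* central k)
      ≡⟨ cong (- sign k *_) (trans (pos-* (2 ℕ.* suc (k ℕ.+ k)) (central k)) (cong (_* + central k) (pos-* 2 (suc (k ℕ.+ k))))) ⟩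
    - sign k * (+ 2 * (1ℤ + (+ k + + k)) * + central k)
      ≡⟨ lem₂ (sign k) (+ k) (+ central k) ⟩
    γ 0ℤ (1ℤ + + k) * (sign k * + central k) ∎
    where
    lem₁ : ∀ k s c → k * (- s * c) ≡ - s * (k * c)
    lem₁ = solve-∀
    lem₂ : ∀ s k c → - s * (+ 2 * (1ℤ + (k + k)) * c) ≡ (+ 4 * 0ℤ + + 2 - + 4 * (1ℤ + k)) * (s * c)
    lem₂ = solve-∀
  β-ratio zero -[1+ k ] = trans (*-zeroʳ -[1+ k ]) (sym (*-zeroʳ (γ 0ℤ -[1+ k ])))
  β-ratio (suc t) k = begin
    k * (x + + 4 * y)                                  ≡⟨ lem₁ k x y ⟩
    k * x + + 4 * k * y                                ≡⟨ cong (_+ + 4 * k * y) (β-ratio t k) ⟩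
    γ (+ t) k * y + + 4 * k * y                        ≡⟨ lem₂ (+ t) k y ⟩
    γ (1ℤ + + t) k * y + + 4 * ((k - 1ℤ) * y)
      ≡⟨ cong (λ w → γ (1ℤ + + t) k * y + + 4 * w) (β-ratio t (k - 1ℤ)) ⟩
    γ (1ℤ + + t) k * y + + 4 * (γ (+ t) (k - 1ℤ) * z)  ≡⟨ lem₃ (+ t) k y z ⟩
    γ (1ℤ + + t) k * (y + + 4 * z) ∎
    where
    x = β t k
    y = β t (k - 1ℤ)
    z = β t (k - 1ℤ - 1ℤ)
    lem₁ : ∀ k x y → k * (x + + 4 * y) ≡ k * x + + 4 * k * y
    lem₁ = solve-∀
    lem₂ : ∀ t k y → (+ 4 * t + + 2 - + 4 * k) * y + + 4 * k * y
                   ≡ (+ 4 * (1ℤ + t) + + 2 - + 4 * k) * y + + 4 * ((k - 1ℤ) * y)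
    lem₂ = solve-∀
    lem₃ : ∀ t k y z → (+ 4 * (1ℤ + t) + + 2 - + 4 * k) * y + + 4 * ((+ 4 * t + + 2 - + 4 * (k - 1ℤ)) * z)
                     ≡ (+ 4 * (1ℤ + t) + + 2 - + 4 * k) * (y + + 4 * z)
    lem₃ = solve-∀

  β-negative : ∀ t k → β t -[1+ k ] ≡ 0ℤ
  β-negative zero    k = refl
  -- `-[1+ k ] - 1ℤ` computes to `-[1+ suc (k ℕ.+ 0) ]`, whence the form of the argument.
  β-negative (suc t) k = cong₂ (λ x y → x + + 4 * y) (β-negative t k) (β-negative t (suc (k ℕ.+ 0)))

  β-zero : ∀ t → β t 0ℤ ≡ 1ℤ
  β-zero zero    = refl
  β-zero (suc t) = cong₂ (λ x y → x + + 4 * y) (β-zero t) (β-negative t 0)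

  evenRow oddRow : ℕ → ℤ → ℕ → ℕ → ℤ
  evenRow t a i = weave (λ j → β t (a + + i - + j)) (λ _ → 0ℤ)
  oddRow  t b i = weave (λ _ → 0ℤ) (λ j → β t (b + + i - + j))

  -- With s_(2k) = β 0 k and s_(2k+1) = 0, the Toeplitz matrix (s_(i-j+n)) is board true 0 ν ν
  -- for n = 2ν and board false 0 (ν+1) ν for n = 2ν+1.
  board : Bool → ℕ → ℤ → ℤ → Matrix
  board true  t a b = weave (evenRow t a) (oddRow t b)
  board false t a b = weave (oddRow t b) (evenRow t a)

  scale shift : ℕ → ℤ → ℤ → ℕ → ℤ
  scale t a b = weave (λ j → γ (+ t) (a - + j)) (λ j → γ (+ t) (b - + j))
  shift t a b = weave (λ j → - (a - + j)) (λ j → - (b - + j))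

  -- With k = a + i - j, the two weights equal γ t k + 4i and i - k. The combination is therefore i
  -- (β t k + 4 β t (k - 1)) plus γ t k · β t (k - 1) - k · β t k, which vanishes by `β-ratio`. The
  -- weights depend only on the column and the surviving factor only on the row.
  entry-op : ∀ t a i j → γ (+ t) (a - + j) * β t (a + + i - + suc j) + - (a - + j) * β t (a + + i - + j)
                       ≡ + i * β (suc t) (a + + i - + j)
  entry-op t a i j = begin
    γ (+ t) (a - + j) * β t (a + + i - + suc j) + - (a - + j) * x
      ≡⟨ cong (λ k → γ (+ t) (a - + j) * β t k + - (a - + j) * x) (lem₀ a (+ i) (+ j)) ⟩
    γ (+ t) (a - + j) * y + - (a - + j) * x
      ≡⟨ lem₁ (+ t) a (+ i) (+ j) x y ⟩
    + i * (x + + 4 * y) + (γ (+ t) k * y - k * x)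
      ≡⟨ cong (λ z → + i * (x + + 4 * y) + (γ (+ t) k * y - z)) (β-ratio t k) ⟩
    + i * (x + + 4 * y) + (γ (+ t) k * y - γ (+ t) k * y)
      ≡⟨ lem₂ (+ i * (x + + 4 * y)) (γ (+ t) k * y) ⟩
    + i * (x + + 4 * y) ∎
    where
    k = a + + i - + j
    x = β t k
    y = β t (k - 1ℤ)
    lem₀ : ∀ a i j → a + i - (1ℤ + j) ≡ a + i - j - 1ℤ
    lem₀ = solve-∀
    lem₁ : ∀ t a i j x y → (+ 4 * t + + 2 - + 4 * (a - j)) * y + - (a - j) * x
         ≡ i * (x + + 4 * y) + ((+ 4 * t + + 2 - + 4 * (a + i - j)) * y - (a + i - j) * x)
    lem₁ = solve-∀
    lem₂ : ∀ c d → c + (d - d) ≡ c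
    lem₂ = solve-∀

  zero-op : ∀ x y z → x * 0ℤ + y * 0ℤ ≡ z * 0ℤ
  zero-op = solve-∀

  evenRow-op : ∀ t a b i j → scale t a b j * evenRow t a i (suc (suc j)) + shift t a b j * evenRow t a i j
                           ≡ + i * evenRow (suc t) a i j
  evenRow-op t a b i j with half-view j
  ... | even k _ w = subst₂ _≡_
    (sym (cong₂ _+_ (cong₂ _*_ (w _ _) (w _ _)) (cong₂ _*_ (w _ _) (w _ _)))) (sym (cong (+ i *_) (w _ _)))
    (entry-op t a i k)
  ... | odd k _ w = subst₂ _≡_
    (sym (cong₂ _+_ (cong₂ _*_ (w _ _) (w _ _)) (cong₂ _*_ (w _ _) (w _ _)))) (sym (cong (+ i *_) (w _ _)))
    (zero-op (γ (+ t) (b - + k)) (- (b - + k)) (+ i))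

  oddRow-op : ∀ t a b i j → scale t a b j * oddRow t b i (suc (suc j)) + shift t a b j * oddRow t b i j
                          ≡ + i * oddRow (suc t) b i j
  oddRow-op t a b i j with half-view j
  ... | even k _ w = subst₂ _≡_
    (sym (cong₂ _+_ (cong₂ _*_ (w _ _) (w _ _)) (cong₂ _*_ (w _ _) (w _ _)))) (sym (cong (+ i *_) (w _ _)))
    (zero-op (γ (+ t) (a - + k)) (- (a - + k)) (+ i))
  ... | odd k _ w = subst₂ _≡_
    (sym (cong₂ _+_ (cong₂ _*_ (w _ _) (w _ _)) (cong₂ _*_ (w _ _) (w _ _)))) (sym (cong (+ i *_) (w _ _)))
    (entry-op t b i k)

  -- Its value at a row is half the row index, rounded down. It vanishes on rows 0 and 1, and this
  -- is what clears them outside the first two columns.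
  rowFactor : ℕ → ℤ
  rowFactor = weave (+_) (+_)

  board-op : ∀ s t a b i j →
    scale t a b j * board s t a b i (suc (suc j)) + shift t a b j * board s t a b i j
      ≡ rowFactor i * board s (suc t) a b i j
  board-op true t a b i j with half-view i
  ... | even k _ w rewrite w (evenRow t a) (oddRow t b) | w (evenRow (suc t) a) (oddRow (suc t) b) | w (+_) (+_)
    = evenRow-op t a b k j
  ... | odd k _ w rewrite w (evenRow t a) (oddRow t b) | w (evenRow (suc t) a) (oddRow (suc t) b) | w (+_) (+_)
    = oddRow-op t a b k j
  board-op false t a b i j with half-view i
  ... | odd k _ w rewrite w (oddRow t b) (evenRow t a) | w (oddRow (suc t) b) (evenRow (suc t) a) | w (+_) (+_)
    = evenRow-op t a b k j
  ... | even k _ w rewrite w (oddRow t b) (evenRow t a) | w (oddRow (suc t) b) (evenRow (suc t) a) | w (+_) (+_)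
    = oddRow-op t a b k j

  row-shift : ∀ t a i j → β t (a + + suc i - + j) ≡ β t (1ℤ + a + + i - + j)
  row-shift t a i j = cong (β t) (lem a (+ i) (+ j))
    where lem : ∀ a i j → a + (1ℤ + i) - j ≡ 1ℤ + a + i - j
          lem = solve-∀

  evenRow-shift : ∀ t a i j → evenRow t a (suc i) j ≡ evenRow t (1ℤ + a) i j
  evenRow-shift t a i j with half-view j
  ... | even k _ w = trans (w _ _) (trans (row-shift t a i k) (sym (w _ _)))
  ... | odd  k _ w = trans (w _ _) (sym (w _ _))

  oddRow-shift : ∀ t b i j → oddRow t b (suc i) j ≡ oddRow t (1ℤ + b) i j
  oddRow-shift t b i j with half-view j
  ... | even k _ w = trans (w _ _) (sym (w _ _))
  ... | odd  k _ w = trans (w _ _) (trans (row-shift t b i k) (sym (w _ _)))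

  -- After elimination the columns are already renumbered by two. Deleting the first two rows as
  -- well raises both offsets by one, so the remaining minor is again a board.
  board-shift : ∀ s t a b i j → board s t a b (suc (suc i)) j ≡ board s t (1ℤ + a) (1ℤ + b) i j
  board-shift s t a b i j = shifted s (half-view i)
    where
    evens odds evens′ odds′ : ℕ → ℕ → ℤ
    evens  i = evenRow t a (suc i)
    odds   i = oddRow t b (suc i)
    evens′ = evenRow t (1ℤ + a)
    odds′  = oddRow t (1ℤ + b)
    shifted : ∀ s → Half i → board s t a b (suc (suc i)) j ≡ board s t (1ℤ + a) (1ℤ + b) i j
    shifted true (even k _ w) =
      trans (cong-app (w evens odds) j) (trans (evenRow-shift t a k j) (sym (cong-app (w evens′ odds′) j)))
    shifted true (odd k _ w) =
      trans (cong-app (w evens odds) j) (trans (oddRow-shift t b k j) (sym (cong-app (w evens′ odds′) j)))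
    shifted false (even k _ w) =
      trans (cong-app (w odds evens) j) (trans (oddRow-shift t b k j) (sym (cong-app (w odds′ evens′) j)))
    shifted false (odd k _ w) =
      trans (cong-app (w odds evens) j) (trans (evenRow-shift t a k j) (sym (cong-app (w odds′ evens′) j)))

  eliminated : Bool → ℕ → ℤ → ℤ → Matrix
  eliminated s t a b i zero          = board s t a b i 0
  eliminated s t a b i (suc zero)    = board s t a b i 1
  eliminated s t a b i (suc (suc j)) = rowFactor i * board s (suc t) a b i j

  Det-expand₀ : ∀ n M → (∀ j → M 0 (suc j) ≡ 0ℤ) → Det (suc n) M ≡ M 0 0 * Det n (minor 0 M)
  Det-expand₀ n M z = trans
    (cong (λ w → M 0 0 * Det n (minor 0 M) - w)
      (alt-zero n (λ j _ → cong (_* Det n (minor (suc j) M)) (z j))))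
    (+-identityʳ _)

  Det-expand₁ : ∀ n M → M 0 0 ≡ 0ℤ → (∀ j → M 0 (suc (suc j)) ≡ 0ℤ) →
    Det (suc (suc n)) M ≡ - (M 0 1 * Det (suc n) (minor 1 M))
  Det-expand₁ n M z₀ z = trans
    (cong₂ (λ v w → v - (M 0 1 * Det (suc n) (minor 1 M) - w))
      (cong (_* Det (suc n) (minor 0 M)) z₀)
      (alt-zero n (λ j _ → cong (_* Det (suc n) (minor (suc (suc j)) M)) (z j))))
    (lem (M 0 1 * Det (suc n) (minor 1 M)))
    where lem : ∀ x → 0ℤ - (x - 0ℤ) ≡ - x
          lem = solve-∀

  pivot : ∀ t a → β t (a + + 0 - + 0) ≡ β t a
  pivot t a = cong (β t) (lem a)
    where lem : ∀ a → a + + 0 - + 0 ≡ a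
          lem = solve-∀

  -- Rows 0 and 1 keep only their pivots, on the diagonal for `true` and on the antidiagonal for
  -- `false`; the absolute value absorbs the sign. `D` is tied to the remaining minor by an equation
  -- so that the caller may supply it in evaluated form.
  ∣eliminated∣ : ∀ s t a b n (D : ℤ) → Det n (λ i j → eliminated s t a b (suc (suc i)) (suc (suc j))) ≡ D →
    ∣ Det (suc (suc n)) (eliminated s t a b) ∣ ≡ ∣ β t a ∣ ℕ.* ∣ β t b ∣ ℕ.* ∣ D ∣
  ∣eliminated∣ true t a b n D refl = begin
    ∣ Det (suc (suc n)) E ∣
      ≡⟨ cong ∣_∣ (Det-expand₀ (suc n) E (λ { zero → refl ; (suc j) → refl })) ⟩
    ∣ β t (a + + 0 - + 0) * Det (suc n) (minor 0 E) ∣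
      ≡⟨ cong₂ (λ x y → ∣ x * y ∣) (pivot t a) (Det-expand₀ n (minor 0 E) (λ j → refl)) ⟩
    ∣ β t a * (β t (b + + 0 - + 0) * D) ∣
      ≡⟨ cong (λ x → ∣ β t a * (x * D) ∣) (pivot t b) ⟩
    ∣ β t a * (β t b * D) ∣
      ≡⟨ trans (abs-* (β t a) (β t b * D)) (cong (∣ β t a ∣ ℕ.*_) (abs-* (β t b) D)) ⟩
    ∣ β t a ∣ ℕ.* (∣ β t b ∣ ℕ.* ∣ D ∣)
      ≡⟨ sym (ℕP.*-assoc (∣ β t a ∣) (∣ β t b ∣) (∣ D ∣)) ⟩
    ∣ β t a ∣ ℕ.* ∣ β t b ∣ ℕ.* ∣ D ∣ ∎
    where E = eliminated true t a b
  ∣eliminated∣ false t a b n D refl = begin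
    ∣ Det (suc (suc n)) E ∣
      ≡⟨ cong ∣_∣ (Det-expand₁ n E refl (λ j → refl)) ⟩
    ∣ - (β t (b + + 0 - + 0) * Det (suc n) (minor 1 E)) ∣
      ≡⟨ ∣-i∣≡∣i∣ (β t (b + + 0 - + 0) * Det (suc n) (minor 1 E)) ⟩
    ∣ β t (b + + 0 - + 0) * Det (suc n) (minor 1 E) ∣
      ≡⟨ cong₂ (λ x y → ∣ x * y ∣) (pivot t b) (Det-expand₀ n (minor 1 E) (λ j → refl)) ⟩
    ∣ β t b * (β t (a + + 0 - + 0) * D) ∣
      ≡⟨ cong (λ x → ∣ β t b * (x * D) ∣) (pivot t a) ⟩
    ∣ β t b * (β t a * D) ∣
      ≡⟨ trans (abs-* (β t b) (β t a * D)) (cong (∣ β t b ∣ ℕ.*_) (abs-* (β t a) D)) ⟩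
    ∣ β t b ∣ ℕ.* (∣ β t a ∣ ℕ.* ∣ D ∣)
      ≡⟨ lem (∣ β t b ∣) (∣ β t a ∣) (∣ D ∣) ⟩
    ∣ β t a ∣ ℕ.* ∣ β t b ∣ ℕ.* ∣ D ∣ ∎
    where
    E = eliminated false t a b
    lem : ∀ x y z → x ℕ.* (y ℕ.* z) ≡ y ℕ.* x ℕ.* z
    lem = ℕSolver.solve-∀

  ∣∏∣ : ∀ n f → ∣ ∏ n f ∣ ≡ ∏ᴺ n (λ j → ∣ f j ∣)
  ∣∏∣ zero    f = refl
  ∣∏∣ (suc n) f = trans (abs-* (f 0) (∏ n (f ∘ suc))) (cong (∣ f 0 ∣ ℕ.*_) (∣∏∣ n (f ∘ suc)))

  ∣weave∣ : ∀ (f g : ℕ → ℤ) j → ∣ weave f g j ∣ ≡ weave (λ k → ∣ f k ∣) (λ k → ∣ g k ∣) j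
  ∣weave∣ f g zero    = refl
  ∣weave∣ f g (suc j) = ∣weave∣ g (f ∘ suc) j

  ∣∏-weave∣ : ∀ n f g → ∣ ∏ n (weave f g) ∣ ≡ ∏ᴺ ⌈ n /2⌉ (λ k → ∣ f k ∣) ℕ.* ∏ᴺ ⌊ n /2⌋ (λ k → ∣ g k ∣)
  ∣∏-weave∣ n f g = trans (∣∏∣ n (weave f g)) (trans (∏ᴺ-cong n (∣weave∣ f g)) (∏ᴺ-weave n _ _))

  -- One round of elimination with all divisions cleared: column multipliers on the left, the two
  -- pivots and the row factors on the right. Among `n` indices, ⌈n/2⌉ are even and ⌊n/2⌋ are odd.
  board-recursion : ∀ s t a b n →
    ∏ᴺ ⌈ n /2⌉ (λ j → ∣ γ (+ t) (a - + j) ∣) ℕ.* ∏ᴺ ⌊ n /2⌋ (λ j → ∣ γ (+ t) (b - + j) ∣)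
        ℕ.* ∣ Det (suc (suc n)) (board s t a b) ∣
      ≡ ∣ β t a ∣ ℕ.* ∣ β t b ∣
        ℕ.* (∏ᴺ ⌈ n /2⌉ suc ℕ.* ∏ᴺ ⌊ n /2⌋ suc ℕ.* ∣ Det n (board s (suc t) (1ℤ + a) (1ℤ + b)) ∣)
  board-recursion s t a b n = begin
    ∏ᴺ ⌈ n /2⌉ (λ j → ∣ γ (+ t) (a - + j) ∣) ℕ.* ∏ᴺ ⌊ n /2⌋ (λ j → ∣ γ (+ t) (b - + j) ∣) ℕ.* ∣ Dₙ₊₂ ∣
      ≡⟨ cong (ℕ._* ∣ Dₙ₊₂ ∣) (sym (∣∏-weave∣ n _ _)) ⟩
    ∣ ∏ n (scale t a b) ∣ ℕ.* ∣ Dₙ₊₂ ∣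
      ≡⟨ sym (abs-* (∏ n (scale t a b)) Dₙ₊₂) ⟩
    ∣ ∏ n (scale t a b) * Dₙ₊₂ ∣
      ≡⟨ cong ∣_∣ (sym (Det-column-ops n (scale t a b) (shift t a b) {M′ = eliminated s t a b} (λ _ → refl) (λ _ → refl)
           (λ i j → sym (board-op s t a b i j)))) ⟩
    ∣ Det (suc (suc n)) (eliminated s t a b) ∣
      ≡⟨ ∣eliminated∣ s t a b n (∏ n u * Dₙ) (trans
           (Det-cong n (λ i j _ → cong (u i *_) (board-shift s (suc t) a b i j)))
           (Det-scale-rows n u (board s (suc t) (1ℤ + a) (1ℤ + b)))) ⟩
    ∣ β t a ∣ ℕ.* ∣ β t b ∣ ℕ.* ∣ ∏ n u * Dₙ ∣
      ≡⟨ cong (∣ β t a ∣ ℕ.* ∣ β t b ∣ ℕ.*_) (trans (abs-* (∏ n u) Dₙ) (cong (ℕ._* ∣ Dₙ ∣) (∣∏-weave∣ n _ _))) ⟩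
    ∣ β t a ∣ ℕ.* ∣ β t b ∣ ℕ.* (∏ᴺ ⌈ n /2⌉ suc ℕ.* ∏ᴺ ⌊ n /2⌋ suc ℕ.* ∣ Dₙ ∣) ∎
    where
    u : ℕ → ℤ
    -- The surviving rows start at index 2, so their factors 1, 1, 2, 2, ... yield two factorials.
    u i = rowFactor (suc (suc i))
    Dₙ₊₂ = Det (suc (suc n)) (board s t a b)
    Dₙ = Det n (board s (suc t) (1ℤ + a) (1ℤ + b))

  gap : ℕ → ℕ → ℕ
  gap t l = ∣ + 4 * + t - + 4 * + l - + 2 ∣

  -- The K × K determinant of binom(x, ν + i - j) is the product of (x + i - l) / (i + l + 1) over i
  -- < K, l < ν. Here x = t - 1/2 and every numerator factor is multiplied by 4.
  numerator : ℕ → ℕ → ℕ → ℕ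
  numerator t K ν = ∏ᴺ K (λ i → ∏ᴺ ν (λ l → gap (t ℕ.+ i) l))

  denominator : ℕ → ℕ → ℕ
  denominator K ν = ∏ᴺ K (λ i → ∏ᴺ ν (λ l → suc (i ℕ.+ l)))

-- The determinant as a quotient of two products.

module ProductFormula where

  open Weaving
  open Determinants using (Det)
  open Elimination
  open import Data.Bool using (Bool; true; false)
  open import Data.Empty using (⊥)
  open import Data.Unit using (⊤)
  open import Data.Nat
  open import Data.Nat.Properties
  open import Data.Nat.Tactic.RingSolver using (solve-∀)
  open import Data.Integer as ℤ using (+_; 0ℤ; 1ℤ; ∣_∣)
  import Data.Integer.Properties as ℤP
  import Data.Integer.Tactic.RingSolver as ℤSolver
  open import Relation.Binary.PropositionalEquality
  open ≡-Reasoning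

  -- The number is twice the odd number 2 (t - l) - 1. This allows the multipliers to be cancelled
  -- and gives the numerator a finite valuation.
  gap≢0 : ∀ t l → NonZero (gap t l)
  gap≢0 t l = ≢-nonZero (λ eq → 2*n≢1 (∣ + t ℤ.- + l ∣) (begin
    2 * ∣ + t ℤ.- + l ∣                ≡⟨ sym (ℤP.abs-* (+ 2) (+ t ℤ.- + l)) ⟩
    ∣ + 2 ℤ.* (+ t ℤ.- + l) ∣          ≡⟨ cong ∣_∣ (sub (+ t) (+ l)) ⟩
    ∣ + 2 ℤ.* (+ t ℤ.- + l) ℤ.- 1ℤ ℤ.+ 1ℤ ∣
      ≡⟨ cong (λ z → ∣ z ℤ.+ 1ℤ ∣) (ℤP.∣i∣≡0⇒i≡0 {+ 2 ℤ.* (+ t ℤ.- + l) ℤ.- 1ℤ} (*-cancelˡ-≡ _ 0 2 (begin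
           2 * ∣ + 2 ℤ.* (+ t ℤ.- + l) ℤ.- 1ℤ ∣ ≡⟨ sym (ℤP.abs-* (+ 2) (+ 2 ℤ.* (+ t ℤ.- + l) ℤ.- 1ℤ)) ⟩
           ∣ + 2 ℤ.* (+ 2 ℤ.* (+ t ℤ.- + l) ℤ.- 1ℤ) ∣ ≡⟨ cong ∣_∣ (twice (+ t) (+ l)) ⟩
           gap t l                              ≡⟨ eq ⟩
           0                                    ∎))) ⟩
    1 ∎))
    where
    2*n≢1 : ∀ n → 2 * n ≢ 1
    2*n≢1 (suc n) eq with () ← trans (sym (+-suc n (n + 0))) (suc-injective eq)
    sub : ∀ t l → + 2 ℤ.* (t ℤ.- l) ≡ + 2 ℤ.* (t ℤ.- l) ℤ.- 1ℤ ℤ.+ 1ℤ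
    sub = ℤSolver.solve-∀
    twice : ∀ t l → + 2 ℤ.* (+ 2 ℤ.* (t ℤ.- l) ℤ.- 1ℤ) ≡ + 4 ℤ.* t ℤ.- + 4 ℤ.* l ℤ.- + 2
    twice = ℤSolver.solve-∀

  β-value : ∀ t ν → ∏ᴺ ν (gap t) ≡ ∏ᴺ ν suc * ∣ β t (+ ν) ∣
  β-value t zero    = sym (trans (+-identityʳ _) (cong ∣_∣ (β-zero t)))
  β-value t (suc ν) = begin
    ∏ᴺ (suc ν) (gap t)                              ≡⟨ ∏ᴺ-last ν (gap t) ⟩
    ∏ᴺ ν (gap t) * gap t ν                          ≡⟨ cong₂ _*_ (β-value t ν) (cong ∣_∣ (lem (+ t) (+ ν))) ⟩
    ∏ᴺ ν suc * ∣ β t (+ ν) ∣ * ∣ γ (+ t) (+ suc ν) ∣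
      ≡⟨ lem′ (∏ᴺ ν suc) (∣ β t (+ ν) ∣) (∣ γ (+ t) (+ suc ν) ∣) ⟩
    ∏ᴺ ν suc * (∣ γ (+ t) (+ suc ν) ∣ * ∣ β t (+ ν) ∣)
      ≡⟨ cong (∏ᴺ ν suc *_) (sym (ℤP.abs-* (γ (+ t) (+ suc ν)) (β t (+ ν)))) ⟩
    ∏ᴺ ν suc * ∣ γ (+ t) (+ suc ν) ℤ.* β t (+ ν) ∣
      ≡⟨ cong (λ z → ∏ᴺ ν suc * ∣ z ∣) (sym (β-ratio t (+ suc ν))) ⟩
    ∏ᴺ ν suc * ∣ + suc ν ℤ.* β t (+ suc ν) ∣
      ≡⟨ cong (∏ᴺ ν suc *_) (ℤP.abs-* (+ suc ν) (β t (+ suc ν))) ⟩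
    ∏ᴺ ν suc * (suc ν * ∣ β t (+ suc ν) ∣)           ≡⟨ sym (*-assoc (∏ᴺ ν suc) (suc ν) _) ⟩
    ∏ᴺ ν suc * suc ν * ∣ β t (+ suc ν) ∣             ≡⟨ cong (_* ∣ β t (+ suc ν) ∣) (sym (∏ᴺ-last ν suc)) ⟩
    ∏ᴺ (suc ν) suc * ∣ β t (+ suc ν) ∣ ∎
    where
    lem : ∀ t v → + 4 ℤ.* t ℤ.- + 4 ℤ.* v ℤ.- + 2 ≡ + 4 ℤ.* t ℤ.+ + 2 ℤ.- + 4 ℤ.* (1ℤ ℤ.+ v)
    lem = ℤSolver.solve-∀
    lem′ : ∀ f b g → f * b * g ≡ f * (g * b)
    lem′ = solve-∀

  multiplier : ℕ → ℕ → ℕ → ℕ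
  multiplier t K ν = ∏ᴺ K (λ j → ∣ γ (+ t) (+ ν ℤ.- + j) ∣)

  γ≡gap : ∀ t ν j → ∣ γ (+ t) (+ ν ℤ.- + j) ∣ ≡ gap (suc t + j) ν
  γ≡gap t ν j = cong ∣_∣ (lem (+ t) (+ ν) (+ j))
    where lem : ∀ t v j → + 4 ℤ.* t ℤ.+ + 2 ℤ.- + 4 ℤ.* (v ℤ.- j) ≡ + 4 ℤ.* (1ℤ ℤ.+ t ℤ.+ j) ℤ.- + 4 ℤ.* v ℤ.- + 2
          lem = ℤSolver.solve-∀

  multiplier≢0 : ∀ t K ν → NonZero (multiplier t K ν)
  multiplier≢0 t K ν = ∏ᴺ-nonZero K (λ j → subst NonZero (sym (γ≡gap t ν j)) (gap≢0 (suc t + j) ν))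

  -- Row i = 0 of the box splits off. The remaining rows, read with `t + 1`, receive from
  -- `multiplier` exactly the missing column l = ν.
  numerator-suc : ∀ t K ν →
    numerator t (suc K) ν * multiplier t K ν ≡ ∏ᴺ ν (gap t) * numerator (suc t) K (suc ν)
  numerator-suc t K ν = begin
    ∏ᴺ ν (gap (t + 0)) * N′ * multiplier t K ν
      ≡⟨ cong₂ (λ x y → ∏ᴺ ν (gap x) * N′ * y) (+-identityʳ t) (∏ᴺ-cong K (γ≡gap t ν)) ⟩
    ∏ᴺ ν (gap t) * N′ * ∏ᴺ K (λ j → gap (suc t + j) ν)
      ≡⟨ *-assoc (∏ᴺ ν (gap t)) N′ _ ⟩
    ∏ᴺ ν (gap t) * (N′ * ∏ᴺ K (λ j → gap (suc t + j) ν))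
      ≡⟨ cong (∏ᴺ ν (gap t) *_) (sym (∏ᴺ-* K _ _)) ⟩
    ∏ᴺ ν (gap t) * ∏ᴺ K (λ i → ∏ᴺ ν (gap (t + suc i)) * gap (suc t + i) ν)
      ≡⟨ cong (∏ᴺ ν (gap t) *_) (∏ᴺ-cong K (λ i →
           trans (cong (λ x → ∏ᴺ ν (gap x) * gap (suc t + i) ν) (+-suc t i))
                 (sym (∏ᴺ-last ν (gap (suc t + i)))))) ⟩
    ∏ᴺ ν (gap t) * numerator (suc t) K (suc ν) ∎
    where N′ = ∏ᴺ K (λ i → ∏ᴺ ν (gap (t + suc i)))

  -- Row i = 0 contributes ν!. The factor i + l + 2 of a later row is the factor at column l + 1
  -- after renumbering, and the factors of K! fill column 0.
  denominator-suc : ∀ K ν → denominator (suc K) ν * ∏ᴺ K suc ≡ ∏ᴺ ν suc * denominator K (suc ν)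
  denominator-suc K ν = begin
    ∏ᴺ ν suc * D′ * ∏ᴺ K suc       ≡⟨ *-assoc (∏ᴺ ν suc) D′ _ ⟩
    ∏ᴺ ν suc * (D′ * ∏ᴺ K suc)     ≡⟨ cong (∏ᴺ ν suc *_) (trans (*-comm D′ _) (sym (∏ᴺ-* K suc _))) ⟩
    ∏ᴺ ν suc * ∏ᴺ K (λ i → suc i * ∏ᴺ ν (λ l → suc (suc i + l)))
      ≡⟨ cong (∏ᴺ ν suc *_) (∏ᴺ-cong K (λ i → cong₂ _*_ (cong suc (sym (+-identityʳ i)))
           (∏ᴺ-cong ν (λ l → cong suc (sym (+-suc i l)))))) ⟩
    ∏ᴺ ν suc * denominator K (suc ν) ∎
    where D′ = ∏ᴺ K (λ i → ∏ᴺ ν (λ l → suc (suc i + l)))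

  factorials≢0 : ∀ K → NonZero (∏ᴺ K suc)
  factorials≢0 K = ∏ᴺ-nonZero K (λ _ → _)

  -- The balanced boards are those of block-square checkerboard shape; the others are singular.
  Balanced : Bool → ℕ → Set
  Balanced true  n             = ⊤
  Balanced false zero          = ⊤
  Balanced false (suc zero)    = ⊥
  Balanced false (suc (suc n)) = Balanced false n

  balanced-pred : ∀ s n → Balanced s (suc (suc n)) → Balanced s n
  balanced-pred true  n b = b
  balanced-pred false n b = b

  -- Sorting rows and columns by parity would split the board into two Toeplitz blocks, one for each
  -- factor. The induction instead removes two rows and two columns by `board-recursion` and cancels
  -- the nonzero multipliers. Size one with `false` is excluded by `Balanced`.
  product-formula : ∀ s N t a b → Balanced s N →
    ∣ Det N (board s t (+ a) (+ b)) ∣ * (denominator ⌈ N /2⌉ a * denominator ⌊ N /2⌋ b)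
      ≡ numerator t ⌈ N /2⌉ a * numerator t ⌊ N /2⌋ b
  product-formula s     zero       t a b _ = refl
  product-formula true  (suc zero) t a b _ = begin
    ∣ β t (+ a ℤ.+ + 0 ℤ.- + 0) ℤ.* 1ℤ ℤ.- 0ℤ ∣ * (∏ᴺ a suc * 1 * 1)
      ≡⟨ cong (λ z → ∣ z ∣ * (∏ᴺ a suc * 1 * 1)) (trans (lem _) (pivot t (+ a))) ⟩
    ∣ β t (+ a) ∣ * (∏ᴺ a suc * 1 * 1)   ≡⟨ lem′ (∣ β t (+ a) ∣) (∏ᴺ a suc) ⟩
    ∏ᴺ a suc * ∣ β t (+ a) ∣ * 1 * 1     ≡⟨ cong (λ z → z * 1 * 1) (sym (β-value t a)) ⟩
    ∏ᴺ a (gap t) * 1 * 1                 ≡⟨ cong (λ z → ∏ᴺ a (gap z) * 1 * 1) (sym (+-identityʳ t)) ⟩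
    ∏ᴺ a (gap (t + 0)) * 1 * 1           ∎
    where
    lem : ∀ x → x ℤ.* 1ℤ ℤ.- 0ℤ ≡ x
    lem = ℤSolver.solve-∀
    lem′ : ∀ x y → x * (y * 1 * 1) ≡ y * x * 1 * 1
    lem′ = solve-∀
  product-formula s (suc (suc N)) t a b bal =
    *-cancelʳ-≡ _ _ (A₁ * A₂ * (B₁ * B₂)) {{multipliers≢0}} (begin
      W * (denominator (suc K₁) a * denominator (suc K₂) b) * (A₁ * A₂ * (B₁ * B₂))
        ≡⟨ lem₁ W (denominator (suc K₁) a) (denominator (suc K₂) b) A₁ A₂ B₁ B₂ ⟩
      A₁ * A₂ * W * ((denominator (suc K₁) a * B₁) * (denominator (suc K₂) b * B₂))
        ≡⟨ cong₂ (λ x y → x * y) (board-recursion s t (+ a) (+ b) N)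
             (cong₂ _*_ (denominator-suc K₁ a) (denominator-suc K₂ b)) ⟩
      x * y * (B₁ * B₂ * W′) * (F₁ * denominator K₁ (suc a) * (F₂ * denominator K₂ (suc b)))
        ≡⟨ lem₂ x y (B₁ * B₂) W′ F₁ (denominator K₁ (suc a)) F₂ (denominator K₂ (suc b)) ⟩
      F₁ * x * (F₂ * y) * (B₁ * B₂) * (W′ * (denominator K₁ (suc a) * denominator K₂ (suc b)))
        ≡⟨ cong₂ (λ u v → u * (B₁ * B₂) * v) (sym (cong₂ _*_ (β-value t a) (β-value t b)))
             (product-formula s N (suc t) (suc a) (suc b) (balanced-pred s N bal)) ⟩
      ∏ᴺ a (gap t) * ∏ᴺ b (gap t) * (B₁ * B₂) * (numerator (suc t) K₁ (suc a) * numerator (suc t) K₂ (suc b))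
        ≡⟨ lem₃ (∏ᴺ a (gap t)) (∏ᴺ b (gap t)) (B₁ * B₂) (numerator (suc t) K₁ (suc a)) (numerator (suc t) K₂ (suc b)) ⟩
      ∏ᴺ a (gap t) * numerator (suc t) K₁ (suc a) * (∏ᴺ b (gap t) * numerator (suc t) K₂ (suc b)) * (B₁ * B₂)
        ≡⟨ cong (_* (B₁ * B₂)) (sym (cong₂ _*_ (numerator-suc t K₁ a) (numerator-suc t K₂ b))) ⟩
      numerator t (suc K₁) a * A₁ * (numerator t (suc K₂) b * A₂) * (B₁ * B₂)
        ≡⟨ lem₄ (numerator t (suc K₁) a) A₁ (numerator t (suc K₂) b) A₂ (B₁ * B₂) ⟩
      numerator t (suc K₁) a * numerator t (suc K₂) b * (A₁ * A₂ * (B₁ * B₂)) ∎)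
    where
    K₁ = ⌈ N /2⌉
    K₂ = ⌊ N /2⌋
    A₁ = multiplier t K₁ a
    A₂ = multiplier t K₂ b
    B₁ = ∏ᴺ K₁ suc
    B₂ = ∏ᴺ K₂ suc
    F₁ = ∏ᴺ a suc
    F₂ = ∏ᴺ b suc
    x = ∣ β t (+ a) ∣
    y = ∣ β t (+ b) ∣
    W  = ∣ Det (suc (suc N)) (board s t (+ a) (+ b)) ∣
    W′ = ∣ Det N (board s (suc t) (+ suc a) (+ suc b)) ∣
    multipliers≢0 : NonZero (A₁ * A₂ * (B₁ * B₂))
    multipliers≢0 = m*n≢0 (A₁ * A₂) (B₁ * B₂)
      {{m*n≢0 A₁ A₂ {{multiplier≢0 t K₁ a}} {{multiplier≢0 t K₂ b}}}}
      {{m*n≢0 B₁ B₂ {{factorials≢0 K₁}} {{factorials≢0 K₂}}}}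
    lem₁ : ∀ w d e a₁ a₂ b₁ b₂ → w * (d * e) * (a₁ * a₂ * (b₁ * b₂)) ≡ a₁ * a₂ * w * ((d * b₁) * (e * b₂))
    lem₁ = solve-∀
    lem₂ : ∀ x y b w f d g e → x * y * (b * w) * (f * d * (g * e)) ≡ f * x * (g * y) * b * (w * (d * e))
    lem₂ = solve-∀
    lem₃ : ∀ f g b n m → f * g * b * (n * m) ≡ f * n * (g * m) * b
    lem₃ = solve-∀
    lem₄ : ∀ n a m c b → n * a * (m * c) * b ≡ n * m * (a * c * b)
    lem₄ = solve-∀

  -- Here k + 1 rows are supported on only k columns. Elimination descends to size one, where the
  -- sole entry is a zero of the checkerboard.
  unbalanced-singular : ∀ k t a b → Det (suc (k + k)) (board false t (+ a) (+ b)) ≡ 0ℤ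
  unbalanced-singular zero    t a b = refl
  unbalanced-singular (suc k) t a b =
    subst (λ n → Det (suc (suc n)) (board false t (+ a) (+ b)) ≡ 0ℤ) (sym (+-suc k k))
      (ℤP.∣i∣≡0⇒i≡0 (m*n≡0⇒m≡0 _ (A₁ * A₂)
        {{m*n≢0 A₁ A₂ {{multiplier≢0 t ⌈ n /2⌉ a}} {{multiplier≢0 t ⌊ n /2⌋ b}}}}
        (trans (*-comm _ (A₁ * A₂)) (begin
          A₁ * A₂ * ∣ Det (suc (suc n)) (board false t (+ a) (+ b)) ∣
            ≡⟨ board-recursion false t (+ a) (+ b) n ⟩
          x * (y * ∣ Det n (board false (suc t) (+ suc a) (+ suc b)) ∣)
            ≡⟨ cong (λ z → x * (y * ∣ z ∣)) (unbalanced-singular k (suc t) (suc a) (suc b)) ⟩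
          x * (y * 0)
            ≡⟨ cong (x *_) (*-zeroʳ y) ⟩
          x * 0
            ≡⟨ *-zeroʳ x ⟩
          0 ∎))))
    where
    n = suc (k + k)
    A₁ = multiplier t ⌈ n /2⌉ a
    A₂ = multiplier t ⌊ n /2⌋ b
    x = ∣ β t (+ a) ∣ * ∣ β t (+ b) ∣
    y = ∏ᴺ ⌈ n /2⌉ suc * ∏ᴺ ⌊ n /2⌋ suc

-- Finite sums, indicators and counting residues.

module Sums where

  open import Data.Bool using (if_then_else_)
  open import Data.Nat
  open import Data.Nat.Properties
  open import Data.Nat.DivMod
  open import Data.Nat.Tactic.RingSolver using (solve-∀)
  open import Function using (_∘_; _⇔_)
  open import Relation.Binary.Definitions using (tri<; tri≈; tri>)
  open import Relation.Nullary using (Dec; does; ¬_)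
  open import Relation.Nullary.Decidable using (does-⇔; dec-true; dec-false)
  open import Relation.Binary.PropositionalEquality
  open ≡-Reasoning

  Σᴺ : ℕ → (ℕ → ℕ) → ℕ
  Σᴺ zero    f = 0
  Σᴺ (suc n) f = f 0 + Σᴺ n (f ∘ suc)

  Σᴺ-cong : ∀ n {f g} → (∀ j → f j ≡ g j) → Σᴺ n f ≡ Σᴺ n g
  Σᴺ-cong zero    eq = refl
  Σᴺ-cong (suc n) eq = cong₂ _+_ (eq 0) (Σᴺ-cong n (eq ∘ suc))

  Σᴺ-last : ∀ n f → Σᴺ (suc n) f ≡ Σᴺ n f + f n
  Σᴺ-last zero    f = +-comm (f 0) 0
  Σᴺ-last (suc n) f = trans (cong (f 0 +_) (Σᴺ-last n (f ∘ suc))) (sym (+-assoc (f 0) _ _))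

  Σᴺ-+ : ∀ n f g → Σᴺ n (λ j → f j + g j) ≡ Σᴺ n f + Σᴺ n g
  Σᴺ-+ zero    f g = refl
  Σᴺ-+ (suc n) f g = trans (cong (f 0 + g 0 +_) (Σᴺ-+ n (f ∘ suc) (g ∘ suc)))
    (lem (f 0) (g 0) (Σᴺ n (f ∘ suc)) (Σᴺ n (g ∘ suc)))
    where lem : ∀ a b x y → a + b + (x + y) ≡ a + x + (b + y)
          lem = solve-∀

  Σᴺ-const : ∀ n c → Σᴺ n (λ _ → c) ≡ n * c
  Σᴺ-const zero    c = refl
  Σᴺ-const (suc n) c = cong (c +_) (Σᴺ-const n c)

  Σᴺ-swap : ∀ m n (f : ℕ → ℕ → ℕ) → Σᴺ m (λ i → Σᴺ n (f i)) ≡ Σᴺ n (λ j → Σᴺ m (λ i → f i j))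
  Σᴺ-swap zero    n f = sym (trans (Σᴺ-const n 0) (*-zeroʳ n))
  Σᴺ-swap (suc m) n f = trans (cong (Σᴺ n (f 0) +_) (Σᴺ-swap m n (f ∘ suc)))
    (sym (Σᴺ-+ n (f 0) (λ j → Σᴺ m (λ i → f (suc i) j))))

  Σᴺ-split : ∀ m n f → Σᴺ (m + n) f ≡ Σᴺ m f + Σᴺ n (λ j → f (m + j))
  Σᴺ-split zero    n f = refl
  Σᴺ-split (suc m) n f = trans (cong (f 0 +_) (Σᴺ-split m n (f ∘ suc))) (sym (+-assoc (f 0) _ _))

  Σᴺ-periodic : ∀ q f → (∀ j → f (q + j) ≡ f j) → ∀ a r → Σᴺ (a * q + r) f ≡ a * Σᴺ q f + Σᴺ r f
  Σᴺ-periodic q f per zero    r = refl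
  Σᴺ-periodic q f per (suc a) r = begin
    Σᴺ (q + a * q + r) f                             ≡⟨ cong (λ n → Σᴺ n f) (+-assoc q (a * q) r) ⟩
    Σᴺ (q + (a * q + r)) f                           ≡⟨ Σᴺ-split q (a * q + r) f ⟩
    Σᴺ q f + Σᴺ (a * q + r) (λ j → f (q + j))
      ≡⟨ cong (Σᴺ q f +_) (trans (Σᴺ-cong (a * q + r) per) (Σᴺ-periodic q f per a r)) ⟩
    Σᴺ q f + (a * Σᴺ q f + Σᴺ r f)                   ≡⟨ sym (+-assoc (Σᴺ q f) _ _) ⟩
    Σᴺ q f + a * Σᴺ q f + Σᴺ r f ∎

  ind : {P : Set} → Dec P → ℕ
  ind d = if does d then 1 else 0

  ind-yes : {P : Set} (d : Dec P) → P → ind d ≡ 1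
  ind-yes d p = cong (if_then 1 else 0) (dec-true d p)

  ind-no : {P : Set} (d : Dec P) → ¬ P → ind d ≡ 0
  ind-no d ¬p = cong (if_then 1 else 0) (dec-false d ¬p)

  ind-⇔ : {P Q : Set} → P ⇔ Q → (d : Dec P) (e : Dec Q) → ind d ≡ ind e
  ind-⇔ P⇔Q d e = cong (if_then 1 else 0) (does-⇔ P⇔Q d e)

  Σ-residue : ∀ q .{{_ : NonZero q}} x s → s ≤ q → Σᴺ s (λ l → ind (x ≟ l % q)) ≡ ind (x <? s)
  Σ-residue q x zero    _   = sym (ind-no (x <? 0) λ ())
  Σ-residue q x (suc s) s<q = begin
    Σᴺ (suc s) (λ l → ind (x ≟ l % q))                 ≡⟨ Σᴺ-last s _ ⟩
    Σᴺ s (λ l → ind (x ≟ l % q)) + ind (x ≟ s % q)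
      ≡⟨ cong₂ (λ u v → u + ind (x ≟ v)) (Σ-residue q x s (<⇒≤ s<q)) (m<n⇒m%n≡m s<q) ⟩
    ind (x <? s) + ind (x ≟ s)                         ≡⟨ last ⟩
    ind (x <? suc s) ∎
    where
    last : ind (x <? s) + ind (x ≟ s) ≡ ind (x <? suc s)
    last with <-cmp x s
    ... | tri< x<s x≢s _ = trans (cong₂ _+_ (ind-yes (x <? s) x<s) (ind-no (x ≟ s) x≢s))
                                 (sym (ind-yes (x <? suc s) (m<n⇒m<1+n x<s)))
    ... | tri≈ x≮s x≡s _ = trans (cong₂ _+_ (ind-no (x <? s) x≮s) (ind-yes (x ≟ s) x≡s))
                                 (sym (ind-yes (x <? suc s) (s≤s (≤-reflexive x≡s))))
    ... | tri> x≮s x≢s s<x = trans (cong₂ _+_ (ind-no (x <? s) x≮s) (ind-no (x ≟ s) x≢s))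
                                 (sym (ind-no (x <? suc s) (λ x<1+s → x≢s (≤-antisym (s≤s⁻¹ x<1+s) (<⇒≤ s<x)))))

  -- Each of the `b` full periods meets the residue `x` exactly once; the incomplete one meets it
  -- iff `x` lies below `s`.
  Σ-residues : ∀ q .{{_ : NonZero q}} x → x < q → ∀ b s → s ≤ q →
    Σᴺ (b * q + s) (λ l → ind (x ≟ l % q)) ≡ b + ind (x <? s)
  Σ-residues q x x<q b s s≤q = begin
    Σᴺ (b * q + s) f        ≡⟨ Σᴺ-periodic q f per b s ⟩
    b * Σᴺ q f + Σᴺ s f     ≡⟨ cong₂ (λ u v → b * u + v) (trans (Σ-residue q x q ≤-refl) (ind-yes (x <? q) x<q)) (Σ-residue q x s s≤q) ⟩
    b * 1 + ind (x <? s)    ≡⟨ cong (_+ ind (x <? s)) (*-identityʳ b) ⟩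
    b + ind (x <? s)        ∎
    where
    f : ℕ → ℕ
    f l = ind (x ≟ l % q)
    per : ∀ j → f (q + j) ≡ f j
    per j = cong (λ v → ind (x ≟ v)) (trans (cong (_% q) (+-comm q j)) ([m+n]%n≡m%n j q))

-- How many factors are divisible by an odd modulus.

module Counting where

  open Sums
  open Elimination using (gap)
  open import Data.Nat
  open import Data.Nat.Properties
  open import Data.Nat.DivMod
  open import Data.Nat.Divisibility
  open import Data.Nat.Tactic.RingSolver using (solve-∀)
  open import Data.Integer as ℤ using (+_; -[1+_]; 1ℤ; ∣_∣)
  import Data.Integer.Properties as ℤP
  import Data.Integer.Divisibility.Signed as ℤ∣
  import Data.Integer.Tactic.RingSolver as ℤSolver
  open import Function using (_∘_; _⇔_; mk⇔; Equivalence)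
  open import Relation.Nullary using (yes; no; contradiction)
  open import Relation.Binary.PropositionalEquality
  open ≡-Reasoning

  ∣-difference⇔ : ∀ q .{{_ : NonZero q}} x l → + q ℤ∣.∣ + x ℤ.- + l ⇔ x % q ≡ l % q
  ∣-difference⇔ q x l = mk⇔ to from
    where
    to : + q ℤ∣.∣ + x ℤ.- + l → x % q ≡ l % q
    to (ℤ∣.divides (+ c) eq) = trans (cong (_% q) x≡) ([m+kn]%n≡m%n l c q)
      where
      x≡ : x ≡ l + c * q
      x≡ = ℤP.+-injective (trans (lem (+ x) (+ l)) (cong (λ z → + l ℤ.+ z) (trans eq (sym (ℤP.pos-* c q)))))
        where lem : ∀ x l → x ≡ l ℤ.+ (x ℤ.- l)
              lem = ℤSolver.solve-∀
    to (ℤ∣.divides -[1+ c ] eq) = sym (trans (cong (_% q) l≡) ([m+kn]%n≡m%n x (suc c) q))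
      where
      l≡ : l ≡ x + suc c * q
      l≡ = ℤP.+-injective (trans (lem (+ x) (+ l)) (cong (λ z → + x ℤ.+ z)
             (trans (cong ℤ.-_ eq) (trans (ℤP.neg-distribˡ-* -[1+ c ] (+ q)) (sym (ℤP.pos-* (suc c) q))))))
        where lem : ∀ x l → l ≡ x ℤ.+ ℤ.- (x ℤ.- l)
              lem = ℤSolver.solve-∀
    from : x % q ≡ l % q → + q ℤ∣.∣ + x ℤ.- + l
    from eq = ℤ∣.divides (+ (x / q) ℤ.- + (l / q)) (begin
      + x ℤ.- + l
        ≡⟨ cong₂ ℤ._-_ (split x) (split l) ⟩
      (+ (x % q) ℤ.+ + (x / q) ℤ.* + q) ℤ.- (+ (l % q) ℤ.+ + (l / q) ℤ.* + q)
        ≡⟨ cong (λ r → (+ r ℤ.+ + (x / q) ℤ.* + q) ℤ.- (+ (l % q) ℤ.+ + (l / q) ℤ.* + q)) eq ⟩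
      (+ (l % q) ℤ.+ + (x / q) ℤ.* + q) ℤ.- (+ (l % q) ℤ.+ + (l / q) ℤ.* + q)
        ≡⟨ lem (+ (l % q)) (+ (x / q)) (+ (l / q)) (+ q) ⟩
      (+ (x / q) ℤ.- + (l / q)) ℤ.* + q ∎)
      where
      split : ∀ x → + x ≡ + (x % q) ℤ.+ + (x / q) ℤ.* + q
      split x = trans (cong (λ z → + z) (m≡m%n+[m/n]*n x q)) (cong (λ z → + (x % q) ℤ.+ z) (ℤP.pos-* (x / q) q))
      lem : ∀ r a b q → (r ℤ.+ a ℤ.* q) ℤ.- (r ℤ.+ b ℤ.* q) ≡ (a ℤ.- b) ℤ.* q
      lem = ℤSolver.solve-∀

  modulus : ℕ → ℕ
  modulus h = suc (h + h)

  -- 4i - 4l - 2 = 4 (i + h - l) - 2q for q = 2h + 1, and 4 is invertible modulo q.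
  ∣gap⇔ : ∀ h i l → modulus h ∣ gap i l ⇔ (i + h) % modulus h ≡ l % modulus h
  ∣gap⇔ h i l = mk⇔ (Equivalence.to D ∘ to ∘ ℤ∣.∣ᵤ⇒∣) (ℤ∣.∣⇒∣ᵤ ∘ from ∘ Equivalence.from D)
    where
    q = modulus h
    D = ∣-difference⇔ q (i + h) l
    g = + 4 ℤ.* + i ℤ.- + 4 ℤ.* + l ℤ.- + 2
    to : + q ℤ∣.∣ g → + q ℤ∣.∣ + (i + h) ℤ.- + l
    -- With H = h + 1 one has 2H = q + 1, so H² inverts 4: 4H² = 1 + q (q + 2). The witness comes
    -- from multiplying g + 2q = 4d by H².
    to (ℤ∣.divides k eq) = ℤ∣.divides (H ℤ.* H ℤ.* (k ℤ.+ + 2) ℤ.- (+ q ℤ.+ + 2) ℤ.* d) (begin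
      d ≡⟨ lem₁ (+ i) (+ l) (+ h) ⟩
      H ℤ.* H ℤ.* (g ℤ.+ + 2 ℤ.* + q) ℤ.- (+ q ℤ.+ + 2) ℤ.* d ℤ.* + q
        ≡⟨ cong (λ z → H ℤ.* H ℤ.* (z ℤ.+ + 2 ℤ.* + q) ℤ.- (+ q ℤ.+ + 2) ℤ.* d ℤ.* + q) eq ⟩
      H ℤ.* H ℤ.* (k ℤ.* + q ℤ.+ + 2 ℤ.* + q) ℤ.- (+ q ℤ.+ + 2) ℤ.* d ℤ.* + q
        ≡⟨ lem₂ H k (+ q) d ⟩
      (H ℤ.* H ℤ.* (k ℤ.+ + 2) ℤ.- (+ q ℤ.+ + 2) ℤ.* d) ℤ.* + q ∎)
      where
      H = + suc h
      d = + (i + h) ℤ.- + l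
      lem₁ : ∀ i l h → i ℤ.+ h ℤ.- l ≡
        (1ℤ ℤ.+ h) ℤ.* (1ℤ ℤ.+ h) ℤ.* (+ 4 ℤ.* i ℤ.- + 4 ℤ.* l ℤ.- + 2 ℤ.+ + 2 ℤ.* (1ℤ ℤ.+ (h ℤ.+ h)))
          ℤ.- (1ℤ ℤ.+ (h ℤ.+ h) ℤ.+ + 2) ℤ.* (i ℤ.+ h ℤ.- l) ℤ.* (1ℤ ℤ.+ (h ℤ.+ h))
      lem₁ = ℤSolver.solve-∀
      lem₂ : ∀ H k q d → H ℤ.* H ℤ.* (k ℤ.* q ℤ.+ + 2 ℤ.* q) ℤ.- (q ℤ.+ + 2) ℤ.* d ℤ.* q
                       ≡ (H ℤ.* H ℤ.* (k ℤ.+ + 2) ℤ.- (q ℤ.+ + 2) ℤ.* d) ℤ.* q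
      lem₂ = ℤSolver.solve-∀
    from : + q ℤ∣.∣ + (i + h) ℤ.- + l → + q ℤ∣.∣ g
    from (ℤ∣.divides k eq) = ℤ∣.divides (+ 4 ℤ.* k ℤ.- + 2) (begin
      g                                       ≡⟨ lem₁ (+ i) (+ l) (+ h) ⟩
      + 4 ℤ.* d ℤ.- + 2 ℤ.* + q               ≡⟨ cong (λ z → + 4 ℤ.* z ℤ.- + 2 ℤ.* + q) eq ⟩
      + 4 ℤ.* (k ℤ.* + q) ℤ.- + 2 ℤ.* + q     ≡⟨ lem₂ k (+ q) ⟩
      (+ 4 ℤ.* k ℤ.- + 2) ℤ.* + q             ∎)
      where
      d = + (i + h) ℤ.- + l
      lem₁ : ∀ i l h → + 4 ℤ.* i ℤ.- + 4 ℤ.* l ℤ.- + 2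
           ≡ + 4 ℤ.* (i ℤ.+ h ℤ.- l) ℤ.- + 2 ℤ.* (1ℤ ℤ.+ (h ℤ.+ h))
      lem₁ = ℤSolver.solve-∀
      lem₂ : ∀ k q → + 4 ℤ.* (k ℤ.* q) ℤ.- + 2 ℤ.* q ≡ (+ 4 ℤ.* k ℤ.- + 2) ℤ.* q
      lem₂ = ℤSolver.solve-∀

  -- After reduction the sum lies between 1 and 2q - 1, so the only multiple of `q` available is `q`
  -- itself. It forces the residue of `l` to be the reflection q - 1 - i of that of `i`.
  ∣sum⇔ : ∀ h i l → modulus h ∣ suc (i + l) ⇔ h + h ∸ i % modulus h ≡ l % modulus h
  ∣sum⇔ h i l = mk⇔ to from
    where
    q = modulus h
    ī = i % q
    l̄ = l % q
    ī≤ : ī ≤ h + h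
    ī≤ = s≤s⁻¹ (m%n<n i q)
    l̄≤ : l̄ ≤ h + h
    l̄≤ = s≤s⁻¹ (m%n<n l q)
    reduce : suc (i + l) ≡ suc (ī + l̄) + (i / q + l / q) * q
    reduce = trans (cong₂ (λ x y → suc (x + y)) (m≡m%n+[m/n]*n i q) (m≡m%n+[m/n]*n l q))
      (lem ī l̄ (i / q) (l / q) q)
      where lem : ∀ x y a b q → suc (x + a * q + (y + b * q)) ≡ suc (x + y) + (a + b) * q
            lem = solve-∀
    to : q ∣ suc (i + l) → h + h ∸ ī ≡ l̄
    to q∣ = trans (cong (_∸ ī) (exact q∣′)) (m+n∸m≡n ī l̄)
      where
      q∣′ : q ∣ suc (ī + l̄)
      q∣′ = ∣m+n∣m⇒∣n (subst (q ∣_) (trans reduce (+-comm (suc (ī + l̄)) _)) q∣) (n∣m*n (i / q + l / q))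
      exact : q ∣ suc (ī + l̄) → h + h ≡ ī + l̄
      exact (divides (suc zero) eq) = sym (trans (suc-injective eq) (+-identityʳ (h + h)))
      -- A multiple of at least 2q exceeds the largest possible value (h + h) + (h + h) + 1.
      exact (divides (suc (suc c)) eq) = contradiction
        (≤-trans (s≤s (+-mono-≤ ī≤ l̄≤)) (≤-trans (≤-reflexive (sym (+-suc (h + h) (h + h)))) (+-monoʳ-≤ (h + h) (m≤m+n q (c * q)))))
        (<⇒≱ (≤-reflexive (cong suc (sym (suc-injective eq)))) ∘ s≤s⁻¹ ∘ s≤s)
    from : h + h ∸ ī ≡ l̄ → q ∣ suc (i + l)
    from eq = subst (q ∣_) (sym reduce)
      (∣m∣n⇒∣m+n (∣-reflexive (cong suc (trans (sym (m+[n∸m]≡n ī≤)) (cong (λ z → ī + z) eq)))) (n∣m*n (i / q + l / q)))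

  gapCount sumCount : ℕ → ℕ → ℕ → ℕ
  gapCount q K ν = Σᴺ K (λ i → Σᴺ ν (λ l → ind (q ∣? gap i l)))
  sumCount q K ν = Σᴺ K (λ i → Σᴺ ν (λ l → ind (q ∣? suc (i + l))))

  module _ (h : ℕ) where

    private
      q = modulus h

    -- `x i` is the one residue of `l` that makes the factor in row `i` divisible by `q`. It is i +
    -- h for the numerator and 2h - i for the denominator, reduced modulo `q`, so both counts share
    -- this evaluation.
    Σ-rows : ∀ (x : ℕ → ℕ) → (∀ i → x i < q) → (∀ i → x (q + i) ≡ x i) →
      ∀ a r b s → s ≤ q →
      Σᴺ (a * q + r) (λ i → Σᴺ (b * q + s) (λ l → ind (x i ≟ l % q)))
        ≡ (a * q + r) * b + (a * Σᴺ q (λ i → ind (x i <? s)) + Σᴺ r (λ i → ind (x i <? s)))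
    Σ-rows x x<q per a r b s s≤q = begin
      Σᴺ (a * q + r) (λ i → Σᴺ (b * q + s) (λ l → ind (x i ≟ l % q)))
        ≡⟨ Σᴺ-cong (a * q + r) (λ i → Σ-residues q (x i) (x<q i) b s s≤q) ⟩
      Σᴺ (a * q + r) (λ i → b + ind (x i <? s))
        ≡⟨ Σᴺ-+ (a * q + r) (λ _ → b) _ ⟩
      Σᴺ (a * q + r) (λ _ → b) + Σᴺ (a * q + r) (λ i → ind (x i <? s))
        ≡⟨ cong₂ _+_ (Σᴺ-const (a * q + r) b)
             (Σᴺ-periodic q _ (λ j → cong (λ y → ind (y <? s)) (per j)) a r) ⟩
      (a * q + r) * b + (a * Σᴺ q (λ i → ind (x i <? s)) + Σᴺ r (λ i → ind (x i <? s))) ∎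

    -- The contribution of the incomplete corner block, the only part in which the two counts can
    -- differ.
    gapDefect sumDefect : ℕ → ℕ → ℕ
    gapDefect r s = (s ⊓ (r ∸ suc h)) + (r ⊓ (s ∸ h))
    sumDefect r s = (r + s) ∸ q

    Σ-sumDefect : ∀ s → s ≤ q → ∀ r → r ≤ q → Σᴺ r (λ i → ind (h + h ∸ i % q <? s)) ≡ sumDefect r s
    Σ-sumDefect s s≤q zero    _   = sym (m≤n⇒m∸n≡0 s≤q)
    Σ-sumDefect s s≤q (suc r) r<q = begin
      Σᴺ (suc r) (λ i → ind (h + h ∸ i % q <? s)) ≡⟨ Σᴺ-last r _ ⟩
      Σᴺ r (λ i → ind (h + h ∸ i % q <? s)) + ind (h + h ∸ r % q <? s)
        ≡⟨ cong₂ (λ u v → u + ind (h + h ∸ v <? s)) (Σ-sumDefect s s≤q r (<⇒≤ r<q)) (m<n⇒m%n≡m r<q) ⟩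
      (r + s) ∸ q + ind (h + h ∸ r <? s) ≡⟨ last ⟩
      (r + s) ∸ (h + h) ∎
      where
      r≤ : r ≤ h + h
      r≤ = s≤s⁻¹ r<q
      last : (r + s) ∸ q + ind (h + h ∸ r <? s) ≡ (r + s) ∸ (h + h)
      last with h + h ∸ r <? s
      ... | yes lt = trans (cong (λ z → (r + s) ∸ q + z) (ind-yes (h + h ∸ r <? s) lt)) (begin
        (r + s) ∸ q + 1               ≡⟨ cong (_+ 1) (sym (pred[m∸n]≡m∸[1+n] (r + s) (h + h))) ⟩
        pred ((r + s) ∸ (h + h)) + 1  ≡⟨ +-comm _ 1 ⟩
        suc (pred ((r + s) ∸ (h + h)))
          ≡⟨ suc-pred _ {{>-nonZero (m<n⇒0<n∸m (subst (_< r + s) (m+[n∸m]≡n r≤) (+-monoʳ-< r lt)))}} ⟩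
        (r + s) ∸ (h + h) ∎)
      ... | no ¬lt = trans (cong (λ z → (r + s) ∸ q + z) (ind-no (h + h ∸ r <? s) ¬lt)) (begin
        (r + s) ∸ q + 0    ≡⟨ +-identityʳ _ ⟩
        (r + s) ∸ q        ≡⟨ m≤n⇒m∸n≡0 (m≤n⇒m≤1+n r+s≤) ⟩
        0                  ≡⟨ sym (m≤n⇒m∸n≡0 r+s≤) ⟩
        (r + s) ∸ (h + h)  ∎)
        where
        r+s≤ : r + s ≤ h + h
        r+s≤ = subst (r + s ≤_) (m+[n∸m]≡n r≤) (+-monoʳ-≤ r (≮⇒≥ ¬lt))

    ⊓-suc : ∀ x y → x ⊓ suc y ≡ x ⊓ y + ind (y <? x)
    ⊓-suc x y with y <? x
    ... | yes y<x = trans (begin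
      x ⊓ suc y ≡⟨ m≥n⇒m⊓n≡n y<x ⟩
      suc y     ≡⟨ +-comm 1 y ⟩
      y + 1     ≡⟨ cong (_+ 1) (sym (m≥n⇒m⊓n≡n (<⇒≤ y<x))) ⟩
      x ⊓ y + 1 ∎) (cong (λ z → x ⊓ y + z) (sym (ind-yes (y <? x) y<x)))
    ... | no ¬lt = trans (begin
      x ⊓ suc y ≡⟨ m≤n⇒m⊓n≡m (m≤n⇒m≤1+n (≮⇒≥ ¬lt)) ⟩
      x         ≡⟨ sym (m≤n⇒m⊓n≡m (≮⇒≥ ¬lt)) ⟩
      x ⊓ y     ≡⟨ sym (+-identityʳ _) ⟩
      x ⊓ y + 0 ∎) (cong (λ z → x ⊓ y + z) (sym (ind-no (y <? x) ¬lt)))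

    -- For i ≤ h the residue is i + h, without wrapping; for larger i it is i - h - 1. The two
    -- summands of `gapDefect` count these two ranges.
    Σ-gapDefect : ∀ s → s ≤ q → ∀ r → r ≤ q → Σᴺ r (λ i → ind ((i + h) % q <? s)) ≡ gapDefect r s
    Σ-gapDefect s s≤q zero    _   = sym (cong (_+ 0) (⊓-zeroʳ s))
    Σ-gapDefect s s≤q (suc r) r<q = begin
      Σᴺ (suc r) (λ i → ind ((i + h) % q <? s))          ≡⟨ Σᴺ-last r _ ⟩
      Σᴺ r (λ i → ind ((i + h) % q <? s)) + ind ((r + h) % q <? s)
        ≡⟨ cong (_+ ind ((r + h) % q <? s)) (Σ-gapDefect s s≤q r (<⇒≤ r<q)) ⟩
      gapDefect r s + ind ((r + h) % q <? s)             ≡⟨ last ⟩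
      gapDefect (suc r) s ∎
      where
      last : gapDefect r s + ind ((r + h) % q <? s) ≡ gapDefect (suc r) s
      last with r ≤? h
      ... | yes r≤h = begin
        s ⊓ (r ∸ suc h) + r ⊓ (s ∸ h) + ind ((r + h) % q <? s)
          ≡⟨ cong₂ (λ u v → s ⊓ u + r ⊓ (s ∸ h) + v) (m≤n⇒m∸n≡0 (m≤n⇒m≤1+n r≤h))
               (ind-⇔ (mk⇔ to from) ((r + h) % q <? s) (r <? s ∸ h)) ⟩
        s ⊓ 0 + r ⊓ (s ∸ h) + ind (r <? s ∸ h)
          ≡⟨ +-assoc (s ⊓ 0) _ _ ⟩
        s ⊓ 0 + (r ⊓ (s ∸ h) + ind (r <? s ∸ h))
          ≡⟨ cong₂ (λ u v → s ⊓ u + v) (sym (m≤n⇒m∸n≡0 r≤h))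
               (trans (cong (_+ ind (r <? s ∸ h)) (⊓-comm r (s ∸ h))) (trans (sym (⊓-suc (s ∸ h) r)) (⊓-comm (s ∸ h) (suc r)))) ⟩
        s ⊓ (r ∸ h) + suc r ⊓ (s ∸ h) ∎
        where
        small : (r + h) % q ≡ r + h
        small = m<n⇒m%n≡m (s≤s (+-monoˡ-≤ h r≤h))
        to : (r + h) % q < s → r < s ∸ h
        to lt = subst (_< s ∸ h) (m+n∸n≡m r h) (∸-monoˡ-< (subst (_< s) small lt) (m≤n+m h r))
        from : r < s ∸ h → (r + h) % q < s
        from lt = subst (_< s) (sym small) (subst (r + h <_) (m∸n+n≡m {s} {h} (<⇒≤ (m∸n≢0⇒n<m {s} {h} (>⇒≢ (≤-<-trans z≤n lt))))) (+-monoˡ-< h lt))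
      ... | no r≰h = begin
        s ⊓ (r ∸ suc h) + r ⊓ (s ∸ h) + ind ((r + h) % q <? s)
          ≡⟨ cong₂ (λ u v → s ⊓ (r ∸ suc h) + u + ind (v <? s)) (m≥n⇒m⊓n≡n s∸h≤r) wrap ⟩
        s ⊓ (r ∸ suc h) + (s ∸ h) + ind (r ∸ suc h <? s)
          ≡⟨ lem (s ⊓ (r ∸ suc h)) (s ∸ h) _ ⟩
        s ⊓ (r ∸ suc h) + ind (r ∸ suc h <? s) + (s ∸ h)
          ≡⟨ cong₂ _+_ (trans (sym (⊓-suc s (r ∸ suc h))) (cong (s ⊓_) (sym (+-∸-assoc 1 h<r))))
               (sym (m≥n⇒m⊓n≡n (m≤n⇒m≤1+n s∸h≤r))) ⟩
        s ⊓ (r ∸ h) + suc r ⊓ (s ∸ h) ∎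
        where
        h<r : h < r
        h<r = ≰⇒> r≰h
        lem : ∀ a b c → a + b + c ≡ a + c + b
        lem = solve-∀
        s∸h≤r : s ∸ h ≤ r
        s∸h≤r = ≤-trans (∸-monoˡ-≤ h s≤q) (≤-trans (≤-reflexive (m+n∸n≡m (suc h) h)) h<r)
        wrap : (r + h) % q ≡ r ∸ suc h
        wrap = begin
          (r + h) % q                 ≡⟨ cong (λ x → (x + h) % q) (sym (m∸n+n≡m h<r)) ⟩
          (r ∸ suc h + suc h + h) % q ≡⟨ cong (_% q) (+-assoc (r ∸ suc h) (suc h) h) ⟩
          (r ∸ suc h + q) % q         ≡⟨ [m+n]%n≡m%n (r ∸ suc h) q ⟩
          (r ∸ suc h) % q             ≡⟨ m<n⇒m%n≡m (≤-<-trans (m∸n≤m r (suc h)) r<q) ⟩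
          r ∸ suc h                   ∎

    gapDefect-full : ∀ s → s ≤ q → gapDefect q s ≡ s
    gapDefect-full s s≤q = begin
      s ⊓ (h + h ∸ h) + q ⊓ (s ∸ h)
        ≡⟨ cong₂ (λ u v → s ⊓ u + v) (m+n∸n≡m h h) (m≥n⇒m⊓n≡n (≤-trans (m∸n≤m s h) s≤q)) ⟩
      s ⊓ h + (s ∸ h) ≡⟨ cong (_+ (s ∸ h)) (⊓-comm s h) ⟩
      h ⊓ s + (s ∸ h) ≡⟨ m⊓n+n∸m≡n h s ⟩
      s ∎

    -- The bulk terms agree with those of `sumCount-formula`. The remainders may equal `q`, so that
    -- a length `a * q + suc κ` with κ < q needs no renormalisation.
    gapCount-formula : ∀ a r b s → r ≤ q → s ≤ q →
      gapCount q (a * q + r) (b * q + s) ≡ (a * q + r) * b + a * s + gapDefect r s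
    gapCount-formula a r b s r≤q s≤q = begin
      gapCount q (a * q + r) (b * q + s)
        ≡⟨ Σᴺ-cong (a * q + r) (λ i → Σᴺ-cong (b * q + s) (λ l →
             ind-⇔ (∣gap⇔ h i l) (q ∣? gap i l) ((i + h) % q ≟ l % q))) ⟩
      Σᴺ (a * q + r) (λ i → Σᴺ (b * q + s) (λ l → ind ((i + h) % q ≟ l % q)))
        ≡⟨ Σ-rows (λ i → (i + h) % q) (λ i → m%n<n (i + h) q)
             (λ i → trans (cong (_% q) (trans (+-assoc q i h) (+-comm q (i + h)))) ([m+n]%n≡m%n (i + h) q))
             a r b s s≤q ⟩
      (a * q + r) * b + (a * Σᴺ q (λ i → ind ((i + h) % q <? s)) + Σᴺ r (λ i → ind ((i + h) % q <? s)))
        ≡⟨ cong₂ (λ u v → (a * q + r) * b + (a * u + v))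
             (trans (Σ-gapDefect s s≤q q ≤-refl) (gapDefect-full s s≤q)) (Σ-gapDefect s s≤q r r≤q) ⟩
      (a * q + r) * b + (a * s + gapDefect r s) ≡⟨ sym (+-assoc ((a * q + r) * b) _ _) ⟩
      (a * q + r) * b + a * s + gapDefect r s ∎

    sumCount-formula : ∀ a r b s → r ≤ q → s ≤ q →
      sumCount q (a * q + r) (b * q + s) ≡ (a * q + r) * b + a * s + sumDefect r s
    sumCount-formula a r b s r≤q s≤q = begin
      sumCount q (a * q + r) (b * q + s)
        ≡⟨ Σᴺ-cong (a * q + r) (λ i → Σᴺ-cong (b * q + s) (λ l →
             ind-⇔ (∣sum⇔ h i l) (q ∣? suc (i + l)) (h + h ∸ i % q ≟ l % q))) ⟩
      Σᴺ (a * q + r) (λ i → Σᴺ (b * q + s) (λ l → ind (h + h ∸ i % q ≟ l % q)))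
        ≡⟨ Σ-rows (λ i → h + h ∸ i % q) (λ i → s≤s (m∸n≤m (h + h) (i % q)))
             (λ i → cong (h + h ∸_) (trans (cong (_% q) (+-comm q i)) ([m+n]%n≡m%n i q)))
             a r b s s≤q ⟩
      (a * q + r) * b + (a * Σᴺ q (λ i → ind (h + h ∸ i % q <? s)) + Σᴺ r (λ i → ind (h + h ∸ i % q <? s)))
        ≡⟨ cong₂ (λ u v → (a * q + r) * b + (a * u + v))
             (trans (Σ-sumDefect s s≤q q ≤-refl) (m+n∸m≡n q s)) (Σ-sumDefect s s≤q r r≤q) ⟩
      (a * q + r) * b + (a * s + sumDefect r s) ≡⟨ sym (+-assoc ((a * q + r) * b) _ _) ⟩
      (a * q + r) * b + a * s + sumDefect r s ∎

-- Comparison of the two counts, tile by tile.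

module Windows where

  open Counting
  open Weaving using (Half; half-view; even; odd)
  open import Data.Nat
  open import Data.Nat.Properties
  open import Data.Nat.DivMod
  open import Data.Nat.Divisibility
  open import Data.Nat.Tactic.RingSolver using (solve-∀)
  open import Data.Sum using (_⊎_; inj₁; inj₂)
  open import Data.Product using (_×_; _,_)
  open import Relation.Nullary using (yes; no; ¬_; contradiction)
  open import Relation.Binary.PropositionalEquality

  tileParity : ∀ q .{{_ : NonZero q}} → ℕ → ℕ
  tileParity q m = (m / q) % 2

  -- At scale q the wall is tiled by q × q squares. Those whose row index is even and column
  -- index odd vanish; those with row index odd and column index even vanish off their frame.
  data Dead (q : ℕ) .{{_ : NonZero q}} (m n : ℕ) : Set where
    outer : tileParity q m ≡ 0 → tileParity q n ≡ 1 → Dead q m n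
    inner : tileParity q m ≡ 1 → tileParity q n ≡ 0 →
            ¬ q ∣ m → ¬ q ∣ suc m → ¬ q ∣ n → ¬ q ∣ suc n → Dead q m n

  -- In the mixed quadrants `sumDefect` becomes an excess (x + y) ∸ k and `gapDefect` a minimum x ⊓
  -- y. Replacing one of the two terms by its upper bound `k` gives each half of the inequality.
  ⊓-excess-≤ : ∀ {x y k} → x ≤ k → y ≤ k → (x + y) ∸ k ≤ x ⊓ y
  ⊓-excess-≤ {x} {y} {k} x≤k y≤k = ⊓-glb
    (≤-trans (∸-monoˡ-≤ k (+-monoʳ-≤ x y≤k)) (≤-reflexive (m+n∸n≡m x k)))
    (≤-trans (∸-monoˡ-≤ k (+-monoˡ-≤ y x≤k)) (≤-reflexive (m+n∸m≡n k y)))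

  ⊓-excess-< : ∀ {x y k} → 0 < x → x < k → 0 < y → y < k → (x + y) ∸ k < x ⊓ y
  ⊓-excess-< {x} {y} {k} 0<x x<k 0<y y<k with ≤-total k (x + y)
  ... | inj₁ k≤ = ⊓-pres-m<
    (<-≤-trans (∸-monoˡ-< (+-monoʳ-< x y<k) k≤) (≤-reflexive (m+n∸n≡m x k)))
    (<-≤-trans (∸-monoˡ-< (+-monoˡ-< y x<k) k≤) (≤-reflexive (m+n∸m≡n k y)))
  ... | inj₂ ≤k = subst (_< x ⊓ y) (sym (m≤n⇒m∸n≡0 ≤k)) (⊓-pres-m< 0<x 0<y)

  module _ (h : ℕ) where

    private
      q = modulus h

    low-low : ∀ {r s} → r ≤ suc h → s ≤ h → sumDefect h r s ≡ gapDefect h r s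
    low-low {r} {s} r≤ s≤ = trans (m≤n⇒m∸n≡0 (+-mono-≤ r≤ s≤)) (sym (cong₂ _+_
      (trans (cong (s ⊓_) (m≤n⇒m∸n≡0 r≤)) (⊓-zeroʳ s))
      (trans (cong (r ⊓_) (m≤n⇒m∸n≡0 s≤)) (⊓-zeroʳ r))))

    cancel-threshold : ∀ x y z k → k + z ≡ q → (x + k) + y ∸ q ≡ (x + y) ∸ z
    cancel-threshold x y z k eq = trans (cong₂ _∸_ (lem x k y) (sym eq)) ([m+n]∸[m+o]≡n∸o k (x + y) z)
      where lem : ∀ x k y → (x + k) + y ≡ k + (x + y)
            lem = solve-∀

    high-high : ∀ {r s} → suc h ≤ r → h ≤ s → r ≤ q → s ≤ q → sumDefect h r s ≡ gapDefect h r s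
    high-high {r} {s} h<r h≤s r≤q s≤q = begin
      (r + s) ∸ q             ≡⟨ cong (_∸ q) (trans (cong₂ _+_ (sym (m∸n+n≡m h<r)) (sym (m∸n+n≡m h≤s))) (lem (r ∸ suc h) h (s ∸ h))) ⟩
      (r ∸ suc h + (s ∸ h)) + q ∸ q ≡⟨ m+n∸n≡m _ q ⟩
      r ∸ suc h + (s ∸ h)
        ≡⟨ sym (cong₂ _+_
             (m≥n⇒m⊓n≡n (≤-trans (∸-monoˡ-≤ (suc h) r≤q) (≤-trans (≤-reflexive (m+n∸m≡n (suc h) h)) h≤s)))
             (m≥n⇒m⊓n≡n (≤-trans (∸-monoˡ-≤ h s≤q) (≤-trans (≤-reflexive (m+n∸n≡m (suc h) h)) h<r)))) ⟩
      gapDefect h r s ∎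
      where
      open ≡-Reasoning
      lem : ∀ x h y → (x + suc h) + (y + h) ≡ (x + y) + suc (h + h)
      lem = solve-∀

    left-edge : ∀ {r} → r ≤ q → sumDefect h r 0 ≡ gapDefect h r 0
    left-edge {r} r≤q = trans (m≤n⇒m∸n≡0 (≤-trans (≤-reflexive (+-identityʳ r)) r≤q))
      (sym (trans (cong (r ⊓_) (0∸n≡0 h)) (⊓-zeroʳ r)))

    bottom-edge : ∀ {s} → s ≤ q → sumDefect h q s ≡ gapDefect h q s
    bottom-edge {s} s≤q = trans (m+n∸m≡n q s) (sym (gapDefect-full h s s≤q))

    sum-high-low : ∀ {r} s → suc h ≤ r → sumDefect h r s ≡ (r ∸ suc h + s) ∸ h
    sum-high-low {r} s h<r = trans (cong (λ x → x + s ∸ q) (sym (m∸n+n≡m h<r)))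
      (cancel-threshold (r ∸ suc h) s h (suc h) refl)

    sum-low-high : ∀ r {s} → h ≤ s → sumDefect h r s ≡ (s ∸ h + r) ∸ suc h
    sum-low-high r {s} h≤s = trans (cong (_∸ q) (trans (+-comm r s) (cong (_+ r) (sym (m∸n+n≡m h≤s)))))
      (cancel-threshold (s ∸ h) r (suc h) h (+-suc h h))

    h<r⇒r∸[1+h]≤h : ∀ {r} → r ≤ q → r ∸ suc h ≤ h
    h<r⇒r∸[1+h]≤h r≤q = ≤-trans (∸-monoˡ-≤ (suc h) r≤q) (≤-reflexive (m+n∸m≡n (suc h) h))

    s∸h≤1+h : ∀ {s} → s ≤ q → s ∸ h ≤ suc h
    s∸h≤1+h s≤q = ≤-trans (∸-monoˡ-≤ h s≤q) (≤-reflexive (m+n∸n≡m (suc h) h))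

    -- The lines r = h + 1 and s = h cut the block into quadrants: in the low-low and high-high ones
    -- the defects coincide, in the mixed ones `⊓-excess-≤` decides.
    defect-≤ : ∀ {r s} → r ≤ q → s ≤ q → sumDefect h r s ≤ gapDefect h r s
    defect-≤ {r} {s} r≤q s≤q with ≤-total r (suc h) | ≤-total s h
    ... | inj₁ r≤ | inj₁ s≤ = ≤-reflexive (low-low r≤ s≤)
    ... | inj₂ r≥ | inj₂ s≥ = ≤-reflexive (high-high r≥ s≥ r≤q s≤q)
    ... | inj₂ r≥ | inj₁ s≤ = subst (_≤ gapDefect h r s) (sym (sum-high-low s r≥))
      (≤-trans (⊓-excess-≤ (h<r⇒r∸[1+h]≤h r≤q) s≤)
        (≤-trans (≤-reflexive (⊓-comm (r ∸ suc h) s)) (m≤m+n _ _)))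
    ... | inj₁ r≤ | inj₂ s≥ = subst (_≤ gapDefect h r s) (sym (sum-low-high r s≥))
      (≤-trans (⊓-excess-≤ (s∸h≤1+h s≤q) r≤)
        (≤-trans (≤-reflexive (⊓-comm (s ∸ h) r)) (m≤n+m _ _)))

    -- In the open mixed quadrants the excess is strictly below the minimum. This one produces the
    -- interiors of windows; `steep-outer` produces the tiles that vanish entirely.
    steep-inner : ∀ {r s} → suc h < r → r < q → 0 < s → s < h → sumDefect h r s < gapDefect h r s
    steep-inner {r} {s} h<r r<q 0<s s<h = subst (_< gapDefect h r s) (sym (sum-high-low s (<⇒≤ h<r)))
      (<-≤-trans (⊓-excess-< (m<n⇒0<n∸m h<r)
          (subst (r ∸ suc h <_) (m+n∸m≡n (suc h) h) (∸-monoˡ-< r<q (<⇒≤ h<r))) 0<s s<h)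
        (≤-trans (≤-reflexive (⊓-comm (r ∸ suc h) s)) (m≤m+n _ _)))

    steep-outer : ∀ {r s} → 0 < r → r < suc h → h < s → s < q → sumDefect h r s < gapDefect h r s
    steep-outer {r} {s} 0<r r≤h h<s s<q = subst (_< gapDefect h r s) (sym (sum-low-high r (<⇒≤ h<s)))
      (<-≤-trans (⊓-excess-< (m<n⇒0<n∸m h<s)
          (subst (s ∸ h <_) (m+n∸n≡m (suc h) h) (∸-monoˡ-< s<q (<⇒≤ h<s))) 0<r r≤h)
        (≤-trans (≤-reflexive (⊓-comm (s ∸ h) r)) (m≤n+m _ _)))

    private
      counts : (_R_ : ℕ → ℕ → Set) → (∀ c {x y} → x R y → (c + x) R (c + y)) →
        ∀ a r b s → r ≤ q → s ≤ q → sumDefect h r s R gapDefect h r s →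
        sumCount q (a * q + r) (b * q + s) R gapCount q (a * q + r) (b * q + s)
      counts _R_ mono a r b s r≤q s≤q rel = subst₂ _R_
        (sym (sumCount-formula h a r b s r≤q s≤q)) (sym (gapCount-formula h a r b s r≤q s≤q))
        (mono ((a * q + r) * b + a * s) rel)

    count-< = counts _<_ (λ c → +-monoʳ-< c)
    count-≡ = counts _≡_ (λ c → cong (c +_))

    count-≤ : ∀ a r b s → r ≤ q → s ≤ q →
      sumCount q (a * q + r) (b * q + s) ≤ gapCount q (a * q + r) (b * q + s)
    count-≤ a r b s r≤q s≤q = counts _≤_ (λ c → +-monoʳ-≤ c) a r b s r≤q s≤q (defect-≤ r≤q s≤q)

    tileParity-low : ∀ c {x} → x < q → tileParity q (x + (c + c) * q) ≡ 0
    tileParity-low c {x} x<q = begin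
      (x + (c + c) * q) / q % 2       ≡⟨ cong (_% 2) (+-distrib-/-∣ʳ x (n∣m*n (c + c))) ⟩
      (x / q + (c + c) * q / q) % 2   ≡⟨ cong₂ (λ u v → (u + v) % 2) (m<n⇒m/n≡0 x<q) (m*n/n≡m (c + c) q) ⟩
      (c + c) % 2                     ≡⟨ cong (_% 2) (lem c) ⟩
      c * 2 % 2                       ≡⟨ m*n%n≡0 c 2 ⟩
      0 ∎
      where
      open ≡-Reasoning
      lem : ∀ c → c + c ≡ c * 2
      lem = solve-∀

    tileParity-high : ∀ c {x} → q ≤ x → x < q + q → tileParity q (x + (c + c) * q) ≡ 1
    tileParity-high c {x} q≤x x<2q = begin
      (x + (c + c) * q) / q % 2
        ≡⟨ cong (λ z → (z + (c + c) * q) / q % 2) (sym (m∸n+n≡m q≤x)) ⟩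
      (x ∸ q + q + (c + c) * q) / q % 2
        ≡⟨ cong (λ z → z / q % 2) (lem₀ (x ∸ q) q c) ⟩
      (x ∸ q + suc (c + c) * q) / q % 2
        ≡⟨ cong (_% 2) (+-distrib-/-∣ʳ (x ∸ q) (n∣m*n (suc (c + c)))) ⟩
      ((x ∸ q) / q + suc (c + c) * q / q) % 2
        ≡⟨ cong₂ (λ u v → (u + v) % 2)
             (m<n⇒m/n≡0 (subst (x ∸ q <_) (m+n∸n≡m q q) (∸-monoˡ-< x<2q q≤x))) (m*n/n≡m (suc (c + c)) q) ⟩
      suc (c + c) % 2                 ≡⟨ cong (_% 2) (lem c) ⟩
      (1 + c * 2) % 2                 ≡⟨ [m+kn]%n≡m%n 1 c 2 ⟩
      1 ∎
      where
      open ≡-Reasoning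
      lem₀ : ∀ x q c → x + q + (c + c) * q ≡ x + suc (c + c) * q
      lem₀ = solve-∀
      lem : ∀ c → suc (c + c) ≡ 1 + c * 2
      lem = solve-∀

    ∣-strip : ∀ c {x} → q ∣ x + (c + c) * q → q ∣ x
    ∣-strip c {x} q∣ = ∣m+n∣m⇒∣n (subst (q ∣_) (+-comm x _) q∣) (n∣m*n (c + c))

    ∤-low : ∀ c {x} → 0 < x → x < q → ¬ q ∣ x + (c + c) * q
    ∤-low c 0<x x<q q∣ = >⇒∤ {{>-nonZero 0<x}} x<q (∣-strip c q∣)

    ∤-high : ∀ c {x} → q < x → x < q + q → ¬ q ∣ x + (c + c) * q
    ∤-high c q<x x<2q q∣ with ∣-strip c q∣
    ... | divides zero refl = contradiction q<x λ ()
    ... | divides (suc zero) refl = n≮n q (subst (q <_) (+-identityʳ q) q<x)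
    ... | divides (suc (suc d)) refl = n≮n (q + q)
      (≤-<-trans (+-monoʳ-≤ q (m≤m+n q (d * q))) x<2q)

    private
      double : ∀ c x → (c * q + x) + (c * q + x) ≡ (x + x) + (c + c) * q
      double c x = lem c x q
        where lem : ∀ c x q → (c * q + x) + (c * q + x) ≡ (x + x) + (c + c) * q
              lem = solve-∀

      2x<q : ∀ {x} → x ≤ h → x + x < q
      2x<q x≤h = s≤s (+-mono-≤ x≤h x≤h)

      q<2x : ∀ {x} → h < x → q < x + x
      q<2x {x} h<x = subst (_≤ x + x) (cong suc (+-suc h h)) (+-mono-≤ h<x h<x)

      1+2x<2q : ∀ {x} → x < q → suc (x + x) < q + q
      1+2x<2q {x} x<q = subst (_≤ q + q) (cong suc (+-suc x x)) (+-mono-≤ x<q x<q)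

      2x<2q : ∀ {x} → x < q → x + x < q + q
      2x<2q x<q = <⇒≤ (1+2x<2q x<q)

      1+2x<q : ∀ {x} → x < h → suc (x + x) < q
      1+2x<q {x} x<h = <-trans (subst (suc (x + x) <_) (cong suc (sym (+-suc x x))) ≤-refl) (2x<q x<h)

    -- Doubling cq + x gives 2cq + 2x, whose tile index is 2c or 2c + 1: its parity only tells on
    -- which side of `h` the residue lies. The quadrants of `defect-≤` thus become the tile parities
    -- in `Dead`.
    even-low : ∀ c {x} → x ≤ h → tileParity q ((c * q + x) + (c * q + x)) ≡ 0
    even-low c {x} x≤h = trans (cong (tileParity q) (double c x)) (tileParity-low c (2x<q x≤h))

    even-high : ∀ c {x} → h < x → x < q → tileParity q ((c * q + x) + (c * q + x)) ≡ 1
    even-high c {x} h<x x<q = trans (cong (tileParity q) (double c x)) (tileParity-high c (<⇒≤ (q<2x h<x)) (2x<2q x<q))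

    odd-low : ∀ c {x} → x < h → tileParity q (suc ((c * q + x) + (c * q + x))) ≡ 0
    odd-low c {x} x<h = trans (cong (λ z → tileParity q (suc z)) (double c x)) (tileParity-low c (1+2x<q x<h))

    odd-high : ∀ c {x} → h ≤ x → x < q → tileParity q (suc ((c * q + x) + (c * q + x))) ≡ 1
    odd-high c {x} h≤x x<q = trans (cong (λ z → tileParity q (suc z)) (double c x))
      (tileParity-high c (s≤s (+-mono-≤ h≤x h≤x)) (1+2x<2q x<q))

    ∤-even-high : ∀ c {x} → h < x → x < q → ¬ q ∣ (c * q + x) + (c * q + x)
    ∤-even-high c {x} h<x x<q q∣ = ∤-high c (q<2x h<x) (2x<2q x<q) (subst (q ∣_) (double c x) q∣)

    ∤-suc-even-high : ∀ c {x} → h < x → x < q → ¬ q ∣ suc ((c * q + x) + (c * q + x))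
    ∤-suc-even-high c {x} h<x x<q q∣ = ∤-high c (<-trans (q<2x h<x) ≤-refl) (1+2x<2q x<q)
      (subst (λ z → q ∣ suc z) (double c x) q∣)

    ∤-even-low : ∀ c {x} → 0 < x → x ≤ h → ¬ q ∣ (c * q + x) + (c * q + x)
    ∤-even-low c {x} 0<x x≤h q∣ = ∤-low c (≤-trans 0<x (m≤m+n x x)) (2x<q x≤h) (subst (q ∣_) (double c x) q∣)

    ∤-suc-even-low : ∀ c {x} → x < h → ¬ q ∣ suc ((c * q + x) + (c * q + x))
    ∤-suc-even-low c {x} x<h q∣ = ∤-low c (s≤s z≤n) (1+2x<q x<h) (subst (λ z → q ∣ suc z) (double c x) q∣)

    private
      suc-double : ∀ c x → suc (suc ((c * q + x) + (c * q + x))) ≡ (c * q + suc x) + (c * q + suc x)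
      suc-double c x = lem (c * q) x
        where lem : ∀ y x → suc (suc ((y + x) + (y + x))) ≡ (y + suc x) + (y + suc x)
              lem = solve-∀

    ∤-suc-odd-high : ∀ c {x} → h ≤ x → suc x < q → ¬ q ∣ suc (suc ((c * q + x) + (c * q + x)))
    ∤-suc-odd-high c {x} h≤x x<q q∣ = ∤-even-high c (s≤s h≤x) x<q (subst (q ∣_) (suc-double c x) q∣)

    ∤-suc-odd-low : ∀ c {x} → x < h → ¬ q ∣ suc (suc ((c * q + x) + (c * q + x)))
    ∤-suc-odd-low c {x} x<h q∣ = ∤-even-low c (s≤s z≤n) x<h (subst (q ∣_) (suc-double c x) q∣)

    ∣-zero : ∀ c → q ∣ (c * q + 0) + (c * q + 0)
    ∣-zero c = divides (c + c) (lem c q)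
      where lem : ∀ c q → (c * q + 0) + (c * q + 0) ≡ (c + c) * q
            lem = solve-∀

    ∣-half : ∀ c → q ∣ suc ((c * q + h) + (c * q + h))
    ∣-half c = divides (suc (c + c)) (trans (cong suc (double c h)) refl)

    ∣-full : ∀ c → q ∣ suc (suc ((c * q + (h + h)) + (c * q + (h + h))))
    ∣-full c = divides (suc (suc (c + c))) (trans (suc-double c (h + h)) (trans (double c q) (lem q c)))
      where lem : ∀ q c → q + q + (c + c) * q ≡ suc (suc (c + c)) * q
            lem = solve-∀

    Verdict : (m n : ℕ) (S G : ℕ) → Set
    Verdict m n S G = (Dead q m n × S < G) ⊎ (¬ Dead q m n × S ≡ G)

    private
      even-even-row : ∀ {m n} → tileParity q m ≡ 0 → tileParity q n ≡ 0 → ¬ Dead q m n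
      even-even-row pm pn (outer _ n1) with () ← trans (sym pn) n1
      even-even-row pm pn (inner m1 _ _ _ _ _) with () ← trans (sym pm) m1

      odd-odd-row : ∀ {m n} → tileParity q m ≡ 1 → tileParity q n ≡ 1 → ¬ Dead q m n
      odd-odd-row pm pn (outer m0 _) with () ← trans (sym pm) m0
      odd-odd-row pm pn (inner _ n0 _ _ _ _) with () ← trans (sym pn) n0

      frame : ∀ {m n} → tileParity q m ≡ 1 → (q ∣ m ⊎ q ∣ suc m ⊎ q ∣ n ⊎ q ∣ suc n) → ¬ Dead q m n
      frame pm _ (outer m0 _) with () ← trans (sym pm) m0
      frame pm (inj₁ d) (inner _ _ ¬d _ _ _) = ¬d d
      frame pm (inj₂ (inj₁ d)) (inner _ _ _ ¬d _ _) = ¬d d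
      frame pm (inj₂ (inj₂ (inj₁ d))) (inner _ _ _ _ ¬d _) = ¬d d
      frame pm (inj₂ (inj₂ (inj₂ d))) (inner _ _ _ _ _ ¬d) = ¬d d

    -- For m = 2k and n = 2l the blocks have k + 1 and k rows. As neither count can go the wrong
    -- way, strictness in one block suffices, and the one off the boundary of its quadrant is
    -- chosen.
    verdict-even-even : 0 < h → ∀ α κ β σ → κ < q → σ < q →
      Verdict ((α * q + κ) + (α * q + κ)) ((β * q + σ) + (β * q + σ))
        (sumCount q (α * q + suc κ) (β * q + σ) + sumCount q (α * q + κ) (β * q + σ))
        (gapCount q (α * q + suc κ) (β * q + σ) + gapCount q (α * q + κ) (β * q + σ))
    verdict-even-even 0<h α κ β σ κ<q σ<q with κ ≤? h | σ ≤? h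
    ... | yes κ≤h | yes σ≤h = inj₂ (even-even-row (even-low α κ≤h) (even-low β σ≤h) , cong₂ _+_
      (count-≡ α (suc κ) β σ κ<q (<⇒≤ σ<q) (low-low (s≤s κ≤h) σ≤h))
      (count-≡ α κ β σ (<⇒≤ κ<q) (<⇒≤ σ<q) (low-low (m≤n⇒m≤1+n κ≤h) σ≤h)))
    ... | no κ≰h | no σ≰h = inj₂ (odd-odd-row (even-high α (≰⇒> κ≰h) κ<q) (even-high β (≰⇒> σ≰h) σ<q) , cong₂ _+_
      (count-≡ α (suc κ) β σ κ<q (<⇒≤ σ<q) (high-high (m≤n⇒m≤1+n (≰⇒> κ≰h)) (<⇒≤ (≰⇒> σ≰h)) κ<q (<⇒≤ σ<q)))
      (count-≡ α κ β σ (<⇒≤ κ<q) (<⇒≤ σ<q) (high-high (≰⇒> κ≰h) (<⇒≤ (≰⇒> σ≰h)) (<⇒≤ κ<q) (<⇒≤ σ<q))))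
    ... | yes κ≤h | no σ≰h = inj₁ (outer (even-low α κ≤h) (even-high β (≰⇒> σ≰h) σ<q) , strict κ κ≤h κ<q)
      where
      strict : ∀ κ → κ ≤ h → κ < q →
        sumCount q (α * q + suc κ) (β * q + σ) + sumCount q (α * q + κ) (β * q + σ)
        < gapCount q (α * q + suc κ) (β * q + σ) + gapCount q (α * q + κ) (β * q + σ)
      strict zero _ κ<q = +-mono-<-≤
        (count-< α 1 β σ κ<q (<⇒≤ σ<q) (steep-outer (s≤s z≤n) (s≤s 0<h) (≰⇒> σ≰h) σ<q))
        (count-≤ α 0 β σ z≤n (<⇒≤ σ<q))
      strict (suc κ) κ<h κ<q = +-mono-≤-<
        (count-≤ α (suc (suc κ)) β σ κ<q (<⇒≤ σ<q))
        (count-< α (suc κ) β σ (<⇒≤ κ<q) (<⇒≤ σ<q) (steep-outer (s≤s z≤n) (s≤s κ<h) (≰⇒> σ≰h) σ<q))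
    ... | no κ≰h | yes σ≤h with σ ≟ 0 | σ ≟ h
    -- The frame columns: σ = 0 means q ∣ n, and σ = h means q ∣ n + 1, since 2h + 1 = q.
    ...   | yes refl | _ = inj₂ (frame (even-high α (≰⇒> κ≰h) κ<q) (inj₂ (inj₂ (inj₁ (∣-zero β)))) , cong₂ _+_
      (count-≡ α (suc κ) β 0 κ<q z≤n (left-edge κ<q))
      (count-≡ α κ β 0 (<⇒≤ κ<q) z≤n (left-edge (<⇒≤ κ<q))))
    ...   | no _ | yes refl = inj₂ (frame (even-high α (≰⇒> κ≰h) κ<q) (inj₂ (inj₂ (inj₂ (∣-half β)))) , cong₂ _+_
      (count-≡ α (suc κ) β σ κ<q (<⇒≤ σ<q) (high-high (m≤n⇒m≤1+n (≰⇒> κ≰h)) ≤-refl κ<q (<⇒≤ σ<q)))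
      (count-≡ α κ β σ (<⇒≤ κ<q) (<⇒≤ σ<q) (high-high (≰⇒> κ≰h) ≤-refl (<⇒≤ κ<q) (<⇒≤ σ<q))))
    ...   | no σ≢0 | no σ≢h = inj₁ (inner (even-high α h<κ κ<q) (even-low β σ≤h)
        (∤-even-high α h<κ κ<q) (∤-suc-even-high α h<κ κ<q) (∤-even-low β 0<σ σ≤h) (∤-suc-even-low β σ<h) , strict)
      where
      h<κ = ≰⇒> κ≰h
      0<σ = n≢0⇒n>0 σ≢0
      σ<h = ≤∧≢⇒< σ≤h σ≢h
      strict : sumCount q (α * q + suc κ) (β * q + σ) + sumCount q (α * q + κ) (β * q + σ)
             < gapCount q (α * q + suc κ) (β * q + σ) + gapCount q (α * q + κ) (β * q + σ)
      -- At κ = 2h the larger block has r = q, on the boundary, so the smaller one is used; 0 < σ <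
      -- h gives h ≥ 2, hence h + 1 < 2h.
      strict with κ ≟ h + h
      ... | no κ≢ = +-mono-<-≤
        (count-< α (suc κ) β σ κ<q (<⇒≤ σ<q) (steep-inner (s≤s h<κ) (s≤s (≤∧≢⇒< (s≤s⁻¹ κ<q) κ≢)) 0<σ σ<h))
        (count-≤ α κ β σ (<⇒≤ κ<q) (<⇒≤ σ<q))
      ... | yes refl = +-mono-≤-<
        (count-≤ α (suc κ) β σ κ<q (<⇒≤ σ<q))
        (count-< α κ β σ (<⇒≤ κ<q) (<⇒≤ σ<q) (steep-inner (+-monoˡ-≤ h (≤-trans (s≤s 0<σ) σ<h)) κ<q 0<σ σ<h))

    -- Both blocks have the same dimensions, so one comparison is simply doubled. Here the frame
    -- also has rows: κ = h gives q ∣ m and κ = 2h gives q ∣ m + 1.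
    verdict-odd-even : ∀ α κ β σ → κ < q → σ < q →
      Verdict (suc ((α * q + κ) + (α * q + κ))) ((β * q + σ) + (β * q + σ))
        (sumCount q (α * q + suc κ) (β * q + σ) + sumCount q (α * q + suc κ) (β * q + σ))
        (gapCount q (α * q + suc κ) (β * q + σ) + gapCount q (α * q + suc κ) (β * q + σ))
    verdict-odd-even α κ β σ κ<q σ<q with κ <? h | σ ≤? h
    ... | yes κ<h | yes σ≤h = inj₂ (even-even-row (odd-low α κ<h) (even-low β σ≤h) , cong₂ _+_ flat flat)
      where flat = count-≡ α (suc κ) β σ κ<q (<⇒≤ σ<q) (low-low (m≤n⇒m≤1+n κ<h) σ≤h)
    ... | no κ≮h | no σ≰h =
      inj₂ (odd-odd-row (odd-high α (≮⇒≥ κ≮h) κ<q) (even-high β (≰⇒> σ≰h) σ<q) , cong₂ _+_ flat flat)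
      where flat = count-≡ α (suc κ) β σ κ<q (<⇒≤ σ<q)
                     (high-high (s≤s (≮⇒≥ κ≮h)) (<⇒≤ (≰⇒> σ≰h)) κ<q (<⇒≤ σ<q))
    ... | yes κ<h | no σ≰h = inj₁ (outer (odd-low α κ<h) (even-high β (≰⇒> σ≰h) σ<q) , +-mono-< steep steep)
      where steep = count-< α (suc κ) β σ κ<q (<⇒≤ σ<q) (steep-outer (s≤s z≤n) (s≤s κ<h) (≰⇒> σ≰h) σ<q)
    ... | no κ≮h | yes σ≤h with κ ≟ h | κ ≟ h + h | σ ≟ 0 | σ ≟ h
    ...   | yes refl | _ | _ | _ = inj₂ (frame (odd-high α ≤-refl κ<q) (inj₁ (∣-half α)) , cong₂ _+_ flat flat)
      where flat = count-≡ α (suc κ) β σ κ<q (<⇒≤ σ<q) (low-low ≤-refl σ≤h)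
    ...   | no _ | yes refl | _ | _ =
      inj₂ (frame (odd-high α (≮⇒≥ κ≮h) κ<q) (inj₂ (inj₁ (∣-full α))) , cong₂ _+_ flat flat)
      where flat = count-≡ α (suc κ) β σ κ<q (<⇒≤ σ<q) (bottom-edge (<⇒≤ σ<q))
    ...   | no _ | no _ | yes refl | _ =
      inj₂ (frame (odd-high α (≮⇒≥ κ≮h) κ<q) (inj₂ (inj₂ (inj₁ (∣-zero β)))) , cong₂ _+_ flat flat)
      where flat = count-≡ α (suc κ) β 0 κ<q z≤n (left-edge κ<q)
    ...   | no _ | no _ | no _ | yes refl =
      inj₂ (frame (odd-high α (≮⇒≥ κ≮h) κ<q) (inj₂ (inj₂ (inj₂ (∣-half β)))) , cong₂ _+_ flat flat)
      where flat = count-≡ α (suc κ) β σ κ<q (<⇒≤ σ<q) (high-high (s≤s (≮⇒≥ κ≮h)) ≤-refl κ<q (<⇒≤ σ<q))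
    ...   | no κ≢h | no κ≢2h | no σ≢0 | no σ≢h =
      inj₁ (inner (odd-high α h≤κ κ<q) (even-low β σ≤h)
              (∤-suc-even-high α h<κ κ<q) (∤-suc-odd-high α h≤κ 1+κ<q) (∤-even-low β 0<σ σ≤h) (∤-suc-even-low β σ<h)
           , +-mono-< steep steep)
      where
      h≤κ = ≮⇒≥ κ≮h
      h<κ = ≤∧≢⇒< h≤κ (≢-sym κ≢h)
      1+κ<q = s≤s (≤∧≢⇒< (s≤s⁻¹ κ<q) κ≢2h)
      0<σ = n≢0⇒n>0 σ≢0
      σ<h = ≤∧≢⇒< σ≤h σ≢h
      steep = count-< α (suc κ) β σ κ<q (<⇒≤ σ<q) (steep-inner (s≤s h<κ) 1+κ<q 0<σ σ<h)

    verdict-odd-odd : 0 < h → ∀ α κ β σ → κ < q → σ < q →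
      Verdict (suc ((α * q + κ) + (α * q + κ))) (suc ((β * q + σ) + (β * q + σ)))
        (sumCount q (α * q + suc κ) (β * q + suc σ) + sumCount q (α * q + suc κ) (β * q + σ))
        (gapCount q (α * q + suc κ) (β * q + suc σ) + gapCount q (α * q + suc κ) (β * q + σ))
    verdict-odd-odd 0<h α κ β σ κ<q σ<q with κ <? h | σ <? h
    ... | yes κ<h | yes σ<h = inj₂ (even-even-row (odd-low α κ<h) (odd-low β σ<h) , cong₂ _+_
      (count-≡ α (suc κ) β (suc σ) κ<q σ<q (low-low (m≤n⇒m≤1+n κ<h) σ<h))
      (count-≡ α (suc κ) β σ κ<q (<⇒≤ σ<q) (low-low (m≤n⇒m≤1+n κ<h) (<⇒≤ σ<h))))
    ... | no κ≮h | no σ≮h = inj₂ (odd-odd-row (odd-high α (≮⇒≥ κ≮h) κ<q) (odd-high β (≮⇒≥ σ≮h) σ<q) , cong₂ _+_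
      (count-≡ α (suc κ) β (suc σ) κ<q σ<q (high-high (s≤s (≮⇒≥ κ≮h)) (m≤n⇒m≤1+n (≮⇒≥ σ≮h)) κ<q σ<q))
      (count-≡ α (suc κ) β σ κ<q (<⇒≤ σ<q) (high-high (s≤s (≮⇒≥ κ≮h)) (≮⇒≥ σ≮h) κ<q (<⇒≤ σ<q))))
    ... | yes κ<h | no σ≮h = inj₁ (outer (odd-low α κ<h) (odd-high β (≮⇒≥ σ≮h) σ<q) , strict)
      where
      strict : sumCount q (α * q + suc κ) (β * q + suc σ) + sumCount q (α * q + suc κ) (β * q + σ)
             < gapCount q (α * q + suc κ) (β * q + suc σ) + gapCount q (α * q + suc κ) (β * q + σ)
      -- The two blocks have s = σ + 1 and s = σ. The first leaves the open quadrant at σ = 2h, the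
      -- second at σ = h.
      strict with σ ≟ h
      ... | yes refl = +-mono-<-≤
        (count-< α (suc κ) β (suc σ) κ<q σ<q (steep-outer (s≤s z≤n) (s≤s κ<h) ≤-refl (s≤s (≤-trans (+-monoˡ-≤ h 0<h) ≤-refl))))
        (count-≤ α (suc κ) β σ κ<q (<⇒≤ σ<q))
      ... | no σ≢h = +-mono-≤-<
        (count-≤ α (suc κ) β (suc σ) κ<q σ<q)
        (count-< α (suc κ) β σ κ<q (<⇒≤ σ<q) (steep-outer (s≤s z≤n) (s≤s κ<h) (≤∧≢⇒< (≮⇒≥ σ≮h) (≢-sym σ≢h)) σ<q))
    ... | no κ≮h | yes σ<h with κ ≟ h | κ ≟ h + h
    ...   | yes refl | _ = inj₂ (frame (odd-high α ≤-refl κ<q) (inj₁ (∣-half α)) , cong₂ _+_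
      (count-≡ α (suc κ) β (suc σ) κ<q σ<q (low-low ≤-refl σ<h))
      (count-≡ α (suc κ) β σ κ<q (<⇒≤ σ<q) (low-low ≤-refl (<⇒≤ σ<h))))
    ...   | no _ | yes refl = inj₂ (frame (odd-high α (≮⇒≥ κ≮h) κ<q) (inj₂ (inj₁ (∣-full α))) , cong₂ _+_
      (count-≡ α (suc κ) β (suc σ) κ<q σ<q (bottom-edge σ<q))
      (count-≡ α (suc κ) β σ κ<q (<⇒≤ σ<q) (bottom-edge (<⇒≤ σ<q))))
    ...   | no κ≢h | no κ≢2h = inj₁ (inner (odd-high α h≤κ κ<q) (odd-low β σ<h)
        (∤-suc-even-high α h<κ κ<q) (∤-suc-odd-high α h≤κ 1+κ<q) (∤-suc-even-low β σ<h) (∤-suc-odd-low β σ<h)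
        , strict σ σ<h σ<q)
      where
      h≤κ = ≮⇒≥ κ≮h
      h<κ = ≤∧≢⇒< h≤κ (≢-sym κ≢h)
      κ<2h = ≤∧≢⇒< (s≤s⁻¹ κ<q) κ≢2h
      1+κ<q = s≤s κ<2h
      -- From h < κ < 2h; it admits s = 1 as an interior value when σ = 0.
      1<h : 1 < h
      1<h = +-cancelʳ-≤ h 2 h (≤-trans (s≤s h<κ) κ<2h)
      strict : ∀ σ → σ < h → σ < q →
          sumCount q (α * q + suc κ) (β * q + suc σ) + sumCount q (α * q + suc κ) (β * q + σ)
        < gapCount q (α * q + suc κ) (β * q + suc σ) + gapCount q (α * q + suc κ) (β * q + σ)
      strict zero _ σ<q = +-mono-<-≤
        (count-< α (suc κ) β 1 κ<q σ<q (steep-inner (s≤s h<κ) 1+κ<q (s≤s z≤n) 1<h))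
        (count-≤ α (suc κ) β 0 κ<q z≤n)
      strict (suc σ) σ<h σ<q = +-mono-≤-<
        (count-≤ α (suc κ) β (suc (suc σ)) κ<q σ<q)
        (count-< α (suc κ) β (suc σ) κ<q (<⇒≤ σ<q) (steep-inner (s≤s h<κ) 1+κ<q (s≤s z≤n) σ<h))


    -- The matrix has size m + 1, hence the halves of `suc m`. For m even and n odd the board is not
    -- balanced and the product formula says nothing, so that case is excluded.
    verdict : 0 < h → ∀ m n → (∀ k l → m ≡ k + k → n ≢ suc (l + l)) →
      Verdict m n
        (sumCount q ⌈ suc m /2⌉ ⌈ n /2⌉ + sumCount q ⌊ suc m /2⌋ ⌊ n /2⌋)
        (gapCount q ⌈ suc m /2⌉ ⌈ n /2⌉ + gapCount q ⌊ suc m /2⌋ ⌊ n /2⌋)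
    verdict 0<h m n ¬checker = split (half-view m) (half-view n)
      where
      divide : ∀ k → (k / q) * q + k % q ≡ k
      divide k = trans (+-comm _ (k % q)) (sym (m≡m%n+[m/n]*n k q))

      divide-suc : ∀ k → (k / q) * q + suc (k % q) ≡ suc k
      divide-suc k = trans (+-suc _ (k % q)) (cong suc (divide k))

      Goal : (m n K₁ ν₁ K₂ ν₂ : ℕ) → Set
      Goal m n K₁ ν₁ K₂ ν₂ = Verdict m n (sumCount q K₁ ν₁ + sumCount q K₂ ν₂) (gapCount q K₁ ν₁ + gapCount q K₂ ν₂)

      transport : ∀ {m m′ n n′ K₁ K₁′ ν₁ ν₁′ K₂ K₂′ ν₂ ν₂′} →
        m ≡ m′ → n ≡ n′ → K₁ ≡ K₁′ → ν₁ ≡ ν₁′ → K₂ ≡ K₂′ → ν₂ ≡ ν₂′ →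
        Goal m n K₁ ν₁ K₂ ν₂ → Goal m′ n′ K₁′ ν₁′ K₂′ ν₂′
      transport refl refl refl refl refl refl v = v

      split : Half m → Half n → Goal m n ⌈ suc m /2⌉ ⌈ n /2⌉ ⌊ suc m /2⌋ ⌊ n /2⌋
      split (even k refl _) (odd l refl _) = contradiction refl (¬checker k l refl)
      split (even k refl _) (even l refl _) = transport
        (cong₂ _+_ (divide k) (divide k)) (cong₂ _+_ (divide l) (divide l))
        (trans (divide-suc k) (cong suc (n≡⌊n+n/2⌋ k))) (trans (divide l) (n≡⌈n+n/2⌉ l))
        (trans (divide k) (n≡⌈n+n/2⌉ k)) (trans (divide l) (n≡⌊n+n/2⌋ l))
        (verdict-even-even 0<h (k / q) (k % q) (l / q) (l % q) (m%n<n k q) (m%n<n l q))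
      split (odd k refl _) (even l refl _) = transport
        (cong suc (cong₂ _+_ (divide k) (divide k))) (cong₂ _+_ (divide l) (divide l))
        (trans (divide-suc k) (cong suc (n≡⌈n+n/2⌉ k))) (trans (divide l) (n≡⌈n+n/2⌉ l))
        (trans (divide-suc k) (cong suc (n≡⌊n+n/2⌋ k))) (trans (divide l) (n≡⌊n+n/2⌋ l))
        (verdict-odd-even (k / q) (k % q) (l / q) (l % q) (m%n<n k q) (m%n<n l q))
      split (odd k refl _) (odd l refl _) = transport
        (cong suc (cong₂ _+_ (divide k) (divide k))) (cong suc (cong₂ _+_ (divide l) (divide l)))
        (trans (divide-suc k) (cong suc (n≡⌈n+n/2⌉ k))) (trans (divide-suc l) (cong suc (n≡⌊n+n/2⌋ l)))
        (trans (divide-suc k) (cong suc (n≡⌊n+n/2⌋ k))) (trans (divide l) (n≡⌈n+n/2⌉ l))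
        (verdict-odd-odd 0<h (k / q) (k % q) (l / q) (l % q) (m%n<n k q) (m%n<n l q))

-- From divisibility counts to vanishing modulo `p`.

module Valuations where

  open Sums
  open Weaving
  open Counting using (gapCount; sumCount; modulus)
  open Windows
  open Determinants using (Det)
  open Elimination using (board; gap; numerator; denominator)
  open ProductFormula
  open import Data.Nat
  open import Data.Nat.Properties
  open import Data.Nat.DivMod
  open import Data.Nat.Divisibility
  open import Data.Nat.Primality using (Prime; euclidsLemma; prime⇒nonZero; prime⇒nonTrivial)
  open import Data.Nat.Tactic.RingSolver using (solve-∀)
  open import Data.Integer using (+_; ∣_∣)
  open import Data.Sum using (_⊎_; inj₁; inj₂; [_,_]′)
  open import Data.Product using (∃; _×_; _,_; proj₁; proj₂)
  import Data.Sum
  open import Function using (_∘_; _⇔_; mk⇔; Equivalence)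
  open import Relation.Nullary using (yes; no; ¬_; contradiction)
  open import Relation.Binary.PropositionalEquality

  term≤Σᴺ : ∀ n f j → j < n → f j ≤ Σᴺ n f
  term≤Σᴺ (suc n) f zero    _         = m≤m+n (f 0) _
  term≤Σᴺ (suc n) f (suc j) (s≤s j<n) = ≤-trans (term≤Σᴺ n (f ∘ suc) j j<n) (m≤n+m _ (f 0))

  term≤Σᴺ² : ∀ m n (f : ℕ → ℕ → ℕ) i j → i < m → j < n → f i j ≤ Σᴺ m (λ i → Σᴺ n (f i))
  term≤Σᴺ² m n f i j i<m j<n = ≤-trans (term≤Σᴺ n (f i) j j<n) (term≤Σᴺ m (λ i → Σᴺ n (f i)) i i<m)

  Σᴺ-mono : ∀ n {f g} → (∀ j → f j ≤ g j) → Σᴺ n f ≤ Σᴺ n g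
  Σᴺ-mono zero    f≤g = z≤n
  Σᴺ-mono (suc n) f≤g = +-mono-≤ (f≤g 0) (Σᴺ-mono n (f≤g ∘ suc))

  Σᴺ-strict : ∀ n {f g} j → j < n → (∀ j → f j ≤ g j) → f j < g j → Σᴺ n f < Σᴺ n g
  Σᴺ-strict (suc n) zero    _         f≤g f<g = +-mono-<-≤ f<g (Σᴺ-mono n (f≤g ∘ suc))
  Σᴺ-strict (suc n) (suc j) (s≤s j<n) f≤g f<g = +-mono-≤-< (f≤g 0) (Σᴺ-strict n j j<n (f≤g ∘ suc) f<g)

  Σᴺ-compare : ∀ n {f g} {P : ℕ → Set} → (∀ j → P j ⊎ f j ≡ g j) → ∃ P ⊎ Σᴺ n f ≡ Σᴺ n g
  Σᴺ-compare zero    cmp = inj₂ refl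
  Σᴺ-compare (suc n) cmp with cmp 0 | Σᴺ-compare n (cmp ∘ suc)
  ... | inj₁ p₀ | _               = inj₁ (0 , p₀)
  ... | inj₂ _  | inj₁ (j , pⱼ)   = inj₁ (suc j , pⱼ)
  ... | inj₂ e  | inj₂ es         = inj₂ (cong₂ _+_ e es)

  m<n^m : ∀ n m → 1 < n → m < n ^ m
  m<n^m n zero    1<n = s≤s z≤n
  m<n^m n (suc m) 1<n = ≤-trans (s≤s (m<n^m n m 1<n))
    (≤-trans (+-monoˡ-≤ (n ^ m) (m^n>0 n {{>-nonZero (<-trans (s≤s z≤n) 1<n)}} m))
      (≤-trans (≤-reflexive (cong (_+_ (n ^ m)) (sym (+-identityʳ (n ^ m))))) (*-monoˡ-≤ (n ^ m) 1<n)))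

  module _ (p : ℕ) (p-prime : Prime p) where

    private
      instance
        p≢0 : NonZero p
        p≢0 = prime⇒nonZero p-prime

      1<p : 1 < p
      1<p = nonTrivial⇒n>1 p {{prime⇒nonTrivial p-prime}}

    record HasVal (x k : ℕ) : Set where
      constructor hasVal
      field
        unit        : ℕ
        factorised  : x ≡ p ^ k * unit
        p∤unit      : ¬ p ∣ unit

    HasVal-1 : HasVal 1 0
    HasVal-1 = hasVal 1 refl λ p∣1 → n≮n 1 (subst (1 <_) (∣1⇒≡1 p∣1) 1<p)

    HasVal-* : ∀ {x y k l} → HasVal x k → HasVal y l → HasVal (x * y) (k + l)
    HasVal-* {k = k} {l} (hasVal u refl p∤u) (hasVal v refl p∤v) = hasVal (u * v)
      (trans (lem (p ^ k) u (p ^ l) v) (cong (_* (u * v)) (sym (^-distribˡ-+-* p k l))))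
      ([ p∤u , p∤v ]′ ∘ euclidsLemma u v p-prime)
      where lem : ∀ a u b v → a * u * (b * v) ≡ a * b * (u * v)
            lem = solve-∀

    -- The valuation as the number of powers p, p², ..., p^E that divide `x`. This form lets the sum
    -- over powers be exchanged with the product over factors.
    val : ℕ → ℕ → ℕ
    val E x = Σᴺ E (λ e → ind (p ^ suc e ∣? x))

    val-correct : ∀ E x .{{_ : NonZero x}} → x < p ^ E → HasVal x (val E x)
    val-correct zero x x<1 = contradiction (n<1⇒n≡0 x<1) (≢-nonZero⁻¹ x)
    val-correct (suc E) x x<p^E with p ∣? x
    ... | no p∤x = subst (HasVal x) (sym no-powers) (hasVal x (sym (+-identityʳ x)) p∤x)
      where
      no-powers : val (suc E) x ≡ 0
      no-powers = trans (Σᴺ-cong (suc E) (λ e → ind-no (p ^ suc e ∣? x) (p∤x ∘ ∣-trans (m∣m*n (p ^ e)))))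
        (trans (Σᴺ-const (suc E) 0) (*-zeroʳ (suc E)))
    ... | yes (divides-refl y) with val-correct E y {{m*n≢0⇒m≢0 y}} (*-cancelʳ-< p y (p ^ E) (subst (y * p <_) (*-comm p (p ^ E)) x<p^E))
    ...   | hasVal u y≡ p∤u = hasVal u (trans (cong (_* p) y≡) (trans (lem (p ^ val E y) u p) (cong (λ k → p ^ k * u) (sym step)))) p∤u
      where
      lem : ∀ a u p → a * u * p ≡ p * a * u
      lem = solve-∀
      step : val (suc E) (y * p) ≡ suc (val E y)
      step = cong₂ _+_
        (ind-yes (p ^ 1 ∣? y * p) (subst (_∣ y * p) (sym (*-identityʳ p)) (n∣m*n y)))
        (Σᴺ-cong E (λ e → ind-⇔ (mk⇔ (*-cancelʳ-∣ p ∘ subst (_∣ y * p) (*-comm p (p ^ suc e)))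
                                      (subst (_∣ y * p) (*-comm (p ^ suc e) p) ∘ *-monoˡ-∣ p))
          (p ^ suc (suc e) ∣? y * p) (p ^ suc e ∣? y)))

    ∏-HasVal : ∀ n {f g} → (∀ j → j < n → HasVal (f j) (g j)) → HasVal (∏ᴺ n f) (Σᴺ n g)
    ∏-HasVal zero    v = HasVal-1
    ∏-HasVal (suc n) v = HasVal-* (v 0 (s≤s z≤n)) (∏-HasVal n (λ j j<n → v (suc j) (s≤s j<n)))

    -- Exchanging sums turns the total valuation into one count per power of `p`. The bound on the
    -- sum of the factors keeps each of them below p^E, so no power is missed.
    ∏²-HasVal : ∀ E K ν (f : ℕ → ℕ → ℕ) → (∀ i l → NonZero (f i l)) →
      Σᴺ K (λ i → Σᴺ ν (f i)) ≤ E →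
      HasVal (∏ᴺ K (λ i → ∏ᴺ ν (f i))) (Σᴺ E (λ e → Σᴺ K (λ i → Σᴺ ν (λ l → ind (p ^ suc e ∣? f i l)))))
    ∏²-HasVal E K ν f f≢0 ≤E = subst (HasVal _)
      (trans (Σᴺ-cong K (λ i → Σᴺ-swap ν E _)) (Σᴺ-swap K E _))
      (∏-HasVal K (λ i i<K → ∏-HasVal ν (λ l l<ν → val-correct E (f i l) {{f≢0 i l}}
        (≤-<-trans (≤-trans (term≤Σᴺ² K ν f i l i<K l<ν) ≤E) (m<n^m p E 1<p)))))

    quotient-divisible⇔ : ∀ {w x y k l} → w * y ≡ x → HasVal x k → HasVal y l → p ∣ w ⇔ l < k
    quotient-divisible⇔ {w} {x} {y} {k} {l} eq (hasVal u x≡ p∤u) (hasVal v y≡ p∤v) = mk⇔ to from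
      where
      main : w * (p ^ l * v) ≡ p ^ k * u
      main = trans (cong (w *_) (sym y≡)) (trans eq x≡)
      to : p ∣ w → l < k
      to (divides-refl c) with k ≤? l
      ... | no k≰l = ≰⇒> k≰l
      ... | yes k≤l = contradiction (divides (c * p ^ (l ∸ k) * v) (*-cancelˡ-≡ _ _ (p ^ k) {{m^n≢0 p k}}
          (trans (sym main) (trans
            (cong (λ z → c * p * (z * v)) (trans (cong (p ^_) (sym (m+[n∸m]≡n k≤l))) (^-distribˡ-+-* p k (l ∸ k))))
            (lem c p (p ^ k) (p ^ (l ∸ k)) v))))) p∤u
        where lem : ∀ c p a b v → c * p * (a * b * v) ≡ a * (c * b * v * p)
              lem = solve-∀
      from : l < k → p ∣ w
      from l<k with euclidsLemma w v p-prime (divides (p ^ (k ∸ suc l) * u) (*-cancelˡ-≡ _ _ (p ^ l) {{m^n≢0 p l}}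
          (trans (lem₁ (p ^ l) w v) (trans main (trans
            (cong (_* u) (trans (cong (p ^_) (trans (sym (m+[n∸m]≡n l<k)) (sym (+-suc l (k ∸ suc l))))) (^-distribˡ-+-* p l (suc (k ∸ suc l)))))
            (lem₂ (p ^ l) p (p ^ (k ∸ suc l)) u))))))
        where
        lem₁ : ∀ a w v → a * (w * v) ≡ w * (a * v)
        lem₁ = solve-∀
        lem₂ : ∀ a p b u → a * (p * b) * u ≡ a * (b * u * p)
        lem₂ = solve-∀
      ... | inj₁ p∣w = p∣w
      ... | inj₂ p∣v = contradiction p∣v p∤v

    module _ (p-odd : p % 2 ≡ 1) where

      p^e-odd : ∀ e → p ^ e % 2 ≡ 1
      p^e-odd zero    = refl
      p^e-odd (suc e) = trans (%-distribˡ-* p (p ^ e) 2) (cong₂ (λ x y → x * y % 2) p-odd (p^e-odd e))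

      half-power : ∀ e → ∃ λ h → 0 < h × p ^ suc e ≡ modulus h
      half-power e = h , n≢0⇒n>0 h≢0 , eq
        where
        h = p ^ suc e / 2
        lem : ∀ h → 1 + h * 2 ≡ suc (h + h)
        lem = solve-∀
        eq : p ^ suc e ≡ modulus h
        eq = trans (m≡m%n+[m/n]*n (p ^ suc e) 2) (trans (cong (_+ h * 2) (p^e-odd (suc e))) (lem h))
        h≢0 : h ≢ 0
        h≢0 h≡0 = n≮n 1 (<-≤-trans 1<p (∣⇒≤ (subst (p ∣_) (trans eq (cong modulus h≡0)) (m∣m*n (p ^ e)))))

      DeadAt : ℕ → ℕ → ℕ → Set
      DeadAt e = Dead (p ^ e) {{m^n≢0 p e}}

      module _ (m n : ℕ) where

        checker : tileParity 1 m ≡ 0 → tileParity 1 n ≡ 1 → ∃ λ k → ∃ λ l → m ≡ k + k × n ≡ suc (l + l)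
        checker m-even n-odd with half-view m | half-view n
        ... | even k m≡ _ | odd l n≡ _ = k , l , m≡ , n≡
        ... | odd k refl _ | _ = contradiction
          (trans (sym m-even) (trans (cong (_% 2) (n/1≡n m)) (suc-double%2 k))) λ ()
        ... | even _ _ _ | even l refl _ = contradiction
          (trans (sym n-odd) (trans (cong (_% 2) (n/1≡n n)) (double%2 l))) λ ()

        private
          K₁ = ⌈ suc m /2⌉
          K₂ = ⌊ suc m /2⌋
          ν₁ = ⌈ n /2⌉
          ν₂ = ⌊ n /2⌋
          S G : ℕ → ℕ
          S e = sumCount (p ^ suc e) K₁ ν₁ + sumCount (p ^ suc e) K₂ ν₂
          G e = gapCount (p ^ suc e) K₁ ν₁ + gapCount (p ^ suc e) K₂ ν₂

        verdict-at : (∀ k l → m ≡ k + k → n ≢ suc (l + l)) → ∀ e →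
          (DeadAt (suc e) m n × S e < G e) ⊎ (¬ DeadAt (suc e) m n × S e ≡ G e)
        verdict-at ¬checker e = on-modulus (half-power e) (p ^ suc e) {{m^n≢0 p (suc e)}} (proj₂ (proj₂ (half-power e)))
          where
          -- The power is generalised to a variable `q`, so that its equation with `modulus h` can
          -- be matched as `refl`.
          on-modulus : (H : ∃ λ h → 0 < h × p ^ suc e ≡ modulus h) → ∀ q .{{_ : NonZero q}} → q ≡ modulus (proj₁ H) →
            (Dead q m n × sumCount q K₁ ν₁ + sumCount q K₂ ν₂ < gapCount q K₁ ν₁ + gapCount q K₂ ν₂)
            ⊎ (¬ Dead q m n × sumCount q K₁ ν₁ + sumCount q K₂ ν₂ ≡ gapCount q K₁ ν₁ + gapCount q K₂ ν₂)
          on-modulus (h , 0<h , _) q refl = verdict h 0<h m n ¬checker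

        -- `p` divides the quotient iff the summed counts of the numerator are larger. As S e ≤ G e
        -- at each scale, this happens iff some scale is strict, and `verdict` identifies the strict
        -- scales with the dead ones.
        board-criterion : ∀ s → Balanced s (suc m) → (∀ k l → m ≡ k + k → n ≢ suc (l + l)) →
          p ∣ ∣ Det (suc m) (board s 0 (+ ν₁) (+ ν₂)) ∣ ⇔ (∃ λ e → DeadAt e m n)
        board-criterion s bal ¬checker = mk⇔ to from
          where
          w = ∣ Det (suc m) (board s 0 (+ ν₁) (+ ν₂)) ∣
          gaps size : ℕ → ℕ → ℕ
          gaps K ν = Σᴺ K (λ i → Σᴺ ν (gap i))
          size K ν = gaps K ν + Σᴺ K (λ i → Σᴺ ν (λ l → suc (i + l)))
          gapCounts sumCounts : ℕ → ℕ → ℕ → ℕ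
          gapCounts K ν e = gapCount (p ^ suc e) K ν
          sumCounts K ν e = sumCount (p ^ suc e) K ν
          bound = size K₁ ν₁ + size K₂ ν₂
          num-val : ∀ E → bound ≤ E → HasVal (numerator 0 K₁ ν₁ * numerator 0 K₂ ν₂) (Σᴺ E G)
          num-val E bound≤E = subst (HasVal _) (sym (Σᴺ-+ E (gapCounts K₁ ν₁) (gapCounts K₂ ν₂))) (HasVal-*
            (∏²-HasVal E K₁ ν₁ gap gap≢0 (≤-trans (≤-trans (m≤m+n (gaps K₁ ν₁) _) (m≤m+n (size K₁ ν₁) _)) bound≤E))
            (∏²-HasVal E K₂ ν₂ gap gap≢0 (≤-trans (≤-trans (m≤m+n (gaps K₂ ν₂) _) (m≤n+m _ (size K₁ ν₁))) bound≤E)))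
          den-val : ∀ E → bound ≤ E → HasVal (denominator K₁ ν₁ * denominator K₂ ν₂) (Σᴺ E S)
          den-val E bound≤E = subst (HasVal _) (sym (Σᴺ-+ E (sumCounts K₁ ν₁) (sumCounts K₂ ν₂))) (HasVal-*
            (∏²-HasVal E K₁ ν₁ (λ i l → suc (i + l)) _ (≤-trans (≤-trans (m≤n+m _ (gaps K₁ ν₁)) (m≤m+n (size K₁ ν₁) _)) bound≤E))
            (∏²-HasVal E K₂ ν₂ (λ i l → suc (i + l)) _ (≤-trans (≤-trans (m≤n+m _ (gaps K₂ ν₂)) (m≤n+m _ (size K₁ ν₁))) bound≤E)))
          criterion : ∀ E → bound ≤ E → p ∣ w ⇔ Σᴺ E S < Σᴺ E G
          criterion E bound≤E = quotient-divisible⇔ (product-formula s (suc m) 0 ν₁ ν₂ bal) (num-val E bound≤E) (den-val E bound≤E)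
          to : p ∣ w → (∃ λ e → DeadAt e m n)
          to p∣w = [ (λ (e , dead) → suc e , dead)
                   , (λ ΣS≡ΣG → contradiction ΣS≡ΣG (<⇒≢ (Equivalence.to (criterion bound ≤-refl) p∣w))) ]′
            (Σᴺ-compare bound {S} {G} {λ e → DeadAt (suc e) m n} (λ e → Data.Sum.map proj₁ proj₂ (verdict-at ¬checker e)))
          S≤G : ∀ e → S e ≤ G e
          S≤G e = [ <⇒≤ ∘ proj₂ , ≤-reflexive ∘ proj₂ ]′ (verdict-at ¬checker e)
          from : (∃ λ e → DeadAt e m n) → p ∣ w
          from (zero , outer m-even n-odd) =
            contradiction (checker m-even n-odd) λ (k , l , m≡ , n≡) → ¬checker k l m≡ n≡
          from (zero , inner _ _ 1∤m _ _ _) = contradiction (1∣ m) 1∤m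
          from (suc e , dead) =
            -- A dead scale may lie beyond `bound`, so the cutoff is raised to include it.
            [ (λ (_ , S<G) → Equivalence.from (criterion (bound + suc e) (m≤m+n bound (suc e)))
                (Σᴺ-strict (bound + suc e) e (m≤n+m (suc e) bound) S≤G S<G))
            , (λ (¬dead , _) → contradiction dead ¬dead) ]′
            (verdict-at ¬checker e)

-- The letters of the substitution read off from base `p` digits.

module Substitution where

  open Windows using (tileParity; outer; inner)
  open Valuations using (DeadAt; m<n^m)
  open import Data.Bool using (Bool; true; false; if_then_else_; _∧_)
  open import Data.Bool.Properties using (∧-zeroʳ)
  open import Data.Nat
  open import Data.Nat.Properties
  open import Data.Nat.DivMod
  open import Data.Nat.Divisibility
  open import Data.Nat.Primality using (Prime)
  open import Data.Sum using (_⊎_; inj₁; inj₂)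
  open import Data.Product using (∃; _×_; _,_; proj₁; proj₂)
  open import Function using (_⇔_; mk⇔; Equivalence)
  open import Relation.Nullary using (Dec; yes; no; does; ¬_)
  open import Relation.Nullary.Decidable using (does-⇔; dec-true; _×-dec_)
  open import Relation.Binary.Definitions using (tri<; tri≈; tri>)
  open import Relation.Binary.PropositionalEquality

  -- The letter of a window cell, given whether the cell lies on the north, south, west, east side.
  window : Bool → Bool → Bool → Bool → Letter
  window true  true  true  true  = F
  window true  false true  false = CNW
  window true  false false true  = CNE
  window true  false false false = EN
  window false true  true  false = CSW
  window false true  false true  = CSE
  window false true  false false = ES
  window false false true  false = EW
  window false false false true  = EE
  window _     _     _     _     = Z

  -- Opposite sides meet only in a window of one cell, the letter `F`. In every refinement first and
  -- last position differ.
  data Sides : Bool → Bool → Bool → Bool → Set where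
    whole : Sides true true true true
    part  : ∀ {n s w e} → n ∧ s ≡ false → w ∧ e ≡ false → Sides n s w e

  module _ (r : ℕ) where

    private
      p = suc (suc (suc r))
      ↑ ↓ : ℕ → Bool
      ↑ i = i ≡ᵇ 0
      ↓ i = i ≡ᵇ suc (suc r)

    first-not-last : ∀ i → ↑ i ∧ ↓ i ≡ false
    first-not-last zero    = refl
    first-not-last (suc i) = refl

    -- A cell of the image lies on a side of the window iff its parent does and its own digit is
    -- extreme in that direction. In this encoding all letters except `A` and `B` follow a single
    -- rule.
    img-window : ∀ {n s w e} i j → Sides n s w e →
      img p (window n s w e) i j ≡ window (n ∧ ↑ i) (s ∧ ↓ i) (w ∧ ↑ j) (e ∧ ↓ j)
    img-window zero zero whole = refl
    img-window zero (suc j) whole with ↓ (suc j)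
    ... | true = refl
    ... | false = refl
    img-window (suc i) zero whole with ↓ (suc i)
    ... | true = refl
    ... | false = refl
    img-window (suc i) (suc j) whole with ↓ (suc i) | ↓ (suc j)
    ... | true  | true  = refl
    ... | true  | false = refl
    ... | false | true  = refl
    ... | false | false = refl
    img-window {true} {false} {true} {false} i j (part _ _) with ↑ i | ↑ j
    ... | true  | true  = refl
    ... | true  | false = refl
    ... | false | true  = refl
    ... | false | false = refl
    img-window {true} {false} {false} {true} i j (part _ _) with ↑ i | ↓ j
    ... | true  | true  = refl
    ... | true  | false = refl
    ... | false | true  = refl
    ... | false | false = refl
    img-window {true} {false} {false} {false} i j (part _ _) with ↑ i
    ... | true  = refl
    ... | false = refl
    img-window {false} {true} {true} {false} i j (part _ _) with ↓ i | ↑ j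
    ... | true  | true  = refl
    ... | true  | false = refl
    ... | false | true  = refl
    ... | false | false = refl
    img-window {false} {true} {false} {true} i j (part _ _) with ↓ i | ↓ j
    ... | true  | true  = refl
    ... | true  | false = refl
    ... | false | true  = refl
    ... | false | false = refl
    img-window {false} {true} {false} {false} i j (part _ _) with ↓ i
    ... | true  = refl
    ... | false = refl
    img-window {false} {false} {true} {false} i j (part _ _) with ↑ j
    ... | true  = refl
    ... | false = refl
    img-window {false} {false} {false} {true} i j (part _ _) with ↓ j
    ... | true  = refl
    ... | false = refl
    img-window {false} {false} {false} {false} i j (part _ _) = refl

    sides-step : ∀ {n s w e} i j → Sides n s w e → Sides (n ∧ ↑ i) (s ∧ ↓ i) (w ∧ ↑ j) (e ∧ ↓ j)
    sides-step i j whole = part (first-not-last i) (first-not-last j)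
    sides-step {n} {s} {w} {e} i j (part ns we) = part (disjoint n s (↑ i) (↓ i) ns) (disjoint w e (↑ j) (↓ j) we)
      where
      disjoint : ∀ a b c d → a ∧ b ≡ false → (a ∧ c) ∧ (b ∧ d) ≡ false
      disjoint true  false c d _ = ∧-zeroʳ c
      disjoint false b     c d _ = refl

  Π-window : ∀ {n s w e} → Sides n s w e →
    (n ≡ false × s ≡ false × w ≡ false × e ≡ false × Π (window n s w e) ≡ O)
    ⊎ ((n ≡ true ⊎ s ≡ true) × Π (window n s w e) ≡ X)
    ⊎ ((w ≡ true ⊎ e ≡ true) × Π (window n s w e) ≡ X)
  Π-window whole = inj₂ (inj₁ (inj₁ refl , refl))
  Π-window {true}  {false} {true}  {false} (part _ _) = inj₂ (inj₁ (inj₁ refl , refl))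
  Π-window {true}  {false} {false} {true}  (part _ _) = inj₂ (inj₁ (inj₁ refl , refl))
  Π-window {true}  {false} {false} {false} (part _ _) = inj₂ (inj₁ (inj₁ refl , refl))
  Π-window {false} {true}  {true}  {false} (part _ _) = inj₂ (inj₁ (inj₂ refl , refl))
  Π-window {false} {true}  {false} {true}  (part _ _) = inj₂ (inj₁ (inj₂ refl , refl))
  Π-window {false} {true}  {false} {false} (part _ _) = inj₂ (inj₁ (inj₂ refl , refl))
  Π-window {false} {false} {true}  {false} (part _ _) = inj₂ (inj₂ (inj₁ refl , refl))
  Π-window {false} {false} {false} {true}  (part _ _) = inj₂ (inj₂ (inj₂ refl , refl))
  Π-window {false} {false} {false} {false} (part _ _) = inj₁ (refl , refl , refl , refl , refl)

  m<2⇒m≡0∨1 : ∀ m → m < 2 → m ≡ 0 ⊎ m ≡ 1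
  m<2⇒m≡0∨1 zero          _ = inj₁ refl
  m<2⇒m≡0∨1 (suc zero)    _ = inj₂ refl
  m<2⇒m≡0∨1 (suc (suc m)) (s≤s (s≤s ()))

  does-true : {P : Set} (d : Dec P) → does d ≡ true → P
  does-true (yes p) _ = p

  does-false : {P : Set} (d : Dec P) → does d ≡ false → ¬ P
  does-false (no ¬p) _ = ¬p

  module _ (r : ℕ) (p-odd : suc (suc (suc r)) % 2 ≡ 1) (p-prime : Prime (suc (suc (suc r)))) where

    private
      p = suc (suc (suc r))
      Dead′ : ℕ → ℕ → ℕ → Set
      Dead′ = DeadAt p p-prime p-odd

    row : ℕ → ℕ → ℕ
    row e m = tileParity (p ^ e) {{m^n≢0 p e}} m

    row-suc : ∀ e m → row (suc e) m ≡ row e (m / p)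
    row-suc e m = cong (_% 2) (sym (m/n/o≡m/[n*o] m p (p ^ e) {{_}} {{m^n≢0 p e}} {{m^n≢0 p (suc e)}}))

    row-zero : ∀ m → row 0 m ≡ m % 2
    row-zero m = cong (_% 2) (n/1≡n m)

    -- Since `p` is odd, (m / p) * p has the parity of m / p.
    m%2 : ∀ m → m % 2 ≡ (m % p % 2 + row 0 (m / p)) % 2
    m%2 m = begin
      m % 2                                   ≡⟨ cong (_% 2) (m≡m%n+[m/n]*n m p) ⟩
      (m % p + (m / p) * p) % 2               ≡⟨ %-distribˡ-+ (m % p) ((m / p) * p) 2 ⟩
      (m % p % 2 + (m / p) * p % 2) % 2       ≡⟨ cong (λ z → (m % p % 2 + z) % 2) odd-multiple ⟩
      (m % p % 2 + row 0 (m / p)) % 2         ∎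
      where
      open ≡-Reasoning
      odd-multiple : (m / p) * p % 2 ≡ row 0 (m / p)
      odd-multiple = begin
        (m / p) * p % 2              ≡⟨ %-distribˡ-* (m / p) p 2 ⟩
        (m / p % 2) * (p % 2) % 2    ≡⟨ cong (λ z → (m / p % 2) * z % 2) p-odd ⟩
        (m / p % 2) * 1 % 2          ≡⟨ cong (_% 2) (*-identityʳ (m / p % 2)) ⟩
        m / p % 2 % 2                ≡⟨ m%n%n≡m%n (m / p) 2 ⟩
        m / p % 2                    ≡⟨ sym (row-zero (m / p)) ⟩
        row 0 (m / p)                ∎

    row-zero-from : ∀ m {a b} → m % p % 2 ≡ a → row 0 (m / p) ≡ b → row 0 m ≡ (a + b) % 2
    row-zero-from m d r′ = trans (row-zero m) (trans (m%2 m) (cong₂ (λ x y → (x + y) % 2) d r′))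

    onFirst onLast : ℕ → ℕ → Bool
    onFirst e m = does (p ^ e ∣? m)
    onLast  e m = does (p ^ e ∣? suc m)

    ∣-step : ∀ e m → p ^ suc e ∣ m ⇔ (p ^ e ∣ m / p × m % p ≡ 0)
    ∣-step e m = mk⇔ to from
      where
      to : p ^ suc e ∣ m → p ^ e ∣ m / p × m % p ≡ 0
      to d = *-cancelʳ-∣ p (subst₂ _∣_ (*-comm p (p ^ e)) (trans (m≡m%n+[m/n]*n m p) (cong (_+ (m / p) * p) m%p≡0)) d) , m%p≡0
        where m%p≡0 = n∣m⇒m%n≡0 m p (∣-trans (m∣m*n (p ^ e)) d)
      from : p ^ e ∣ m / p × m % p ≡ 0 → p ^ suc e ∣ m
      from (d , m%p≡0) = subst₂ _∣_ (*-comm (p ^ e) p) (sym (trans (m≡m%n+[m/n]*n m p) (cong (_+ (m / p) * p) m%p≡0))) (*-monoˡ-∣ p d)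

    -- Adding one must carry out of the last digit, which is therefore p - 1, and the carry reaches
    -- m / p.
    ∣-suc-step : ∀ e m → p ^ suc e ∣ suc m ⇔ (p ^ e ∣ suc (m / p) × m % p ≡ suc (suc r))
    ∣-suc-step e m = mk⇔ to from
      where
      carry : m % p ≡ suc (suc r) → suc m ≡ suc (m / p) * p
      carry eq = cong suc (trans (m≡m%n+[m/n]*n m p) (cong (_+ (m / p) * p) eq))
      to : p ^ suc e ∣ suc m → p ^ e ∣ suc (m / p) × m % p ≡ suc (suc r)
      to d = *-cancelʳ-∣ p (subst₂ _∣_ (*-comm p (p ^ e)) (carry last) d) , last
        where
        p∣ : p ∣ suc m
        p∣ = ∣-trans (m∣m*n (p ^ e)) d
        last : m % p ≡ suc (suc r)
        last = %-pred-≡0 {m} {p} (n∣m⇒m%n≡0 (suc m) p p∣)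
      from : p ^ e ∣ suc (m / p) × m % p ≡ suc (suc r) → p ^ suc e ∣ suc m
      from (d , eq) = subst₂ _∣_ (*-comm (p ^ e) p) (sym (carry eq)) (*-monoˡ-∣ p d)

    onFirst-suc : ∀ e m → onFirst (suc e) m ≡ onFirst e (m / p) ∧ (m % p ≡ᵇ 0)
    onFirst-suc e m = does-⇔ (∣-step e m) (p ^ suc e ∣? m) ((p ^ e ∣? m / p) ×-dec (m % p ≟ 0))

    onLast-suc : ∀ e m → onLast (suc e) m ≡ onLast e (m / p) ∧ (m % p ≡ᵇ suc (suc r))
    onLast-suc e m = does-⇔ (∣-suc-step e m) (p ^ suc e ∣? suc m) ((p ^ e ∣? suc (m / p)) ×-dec (m % p ≟ suc (suc r)))

    windowAt : ℕ → ℕ → ℕ → Letter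
    windowAt e m n = window (onFirst e m) (onLast e m) (onFirst e n) (onLast e n)

    sidesAt : ∀ e m n → Sides (onFirst e m) (onLast e m) (onFirst e n) (onLast e n)
    sidesAt zero m n
      rewrite dec-true (1 ∣? m) (1∣ m) | dec-true (1 ∣? n) (1∣ n) = whole
    sidesAt (suc e) m n
      rewrite onFirst-suc e m | onLast-suc e m | onFirst-suc e n | onLast-suc e n
      = sides-step r (m % p) (n % p) (sidesAt e (m / p) (n / p))

    windowAt-zero : ∀ m n → windowAt 0 m n ≡ F
    windowAt-zero m n
      rewrite dec-true (1 ∣? m) (1∣ m) | dec-true (1 ∣? n) (1∣ n) = refl

    windowAt-suc : ∀ e m n → img p (windowAt e (m / p) (n / p)) (m % p) (n % p) ≡ windowAt (suc e) m n
    windowAt-suc e m n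
      rewrite onFirst-suc e m | onLast-suc e m | onFirst-suc e n | onLast-suc e n
      = img-window r (m % p) (n % p) (sidesAt e (m / p) (n / p))

    -- The letter at (m, n) is decided at the largest scale p^e where the tile parities of m and n differ.
    data Decided (m n : ℕ) : Letter → Set where
      never-even : (∀ e → row e m ≡ row e n) → row 0 m ≡ 0 → Decided m n A
      never-odd  : (∀ e → row e m ≡ row e n) → row 0 m ≡ 1 → Decided m n B
      zero-tile  : ∀ e → row e m ≡ 0 → row e n ≡ 1 → Decided m n Z
      in-window  : ∀ e → row e m ≡ 1 → row e n ≡ 0 → (∀ f → e < f → row f m ≡ row f n) →
                   Decided m n (windowAt e m n)

    img-A : ∀ i j {a b} → i % 2 ≡ a → j % 2 ≡ b →
      img p A i j ≡ (if a ≡ᵇ 0 then (if b ≡ᵇ 0 then A else Z) else (if b ≡ᵇ 0 then F else B))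
    img-A i j refl refl = refl

    img-B : ∀ i j {a b} → i % 2 ≡ a → j % 2 ≡ b →
      img p B i j ≡ (if a ≡ᵇ 0 then (if b ≡ᵇ 0 then B else F) else (if b ≡ᵇ 0 then Z else A))
    img-B i j refl refl = refl

    private
      lift-rows : ∀ m n → (∀ e → row e (m / p) ≡ row e (n / p)) → ∀ e → row (suc e) m ≡ row (suc e) n
      lift-rows m n eq e = trans (row-suc e m) (trans (eq e) (sym (row-suc e n)))

      all-rows : ∀ m n → row 0 m ≡ row 0 n → (∀ e → row e (m / p) ≡ row e (n / p)) → ∀ e → row e m ≡ row e n
      all-rows m n eq₀ eq zero    = eq₀
      all-rows m n eq₀ eq (suc e) = lift-rows m n eq e

      above : ∀ m n → (∀ e → row e (m / p) ≡ row e (n / p)) → ∀ f → 0 < f → row f m ≡ row f n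
      above m n eq (suc f) _ = lift-rows m n eq f

    -- Dropping the last digit lowers every scale by one, so a decision already taken moves up one
    -- scale. For `A` and `B` all higher parities agree, and the parities of the two new digits
    -- decide at scale 1.
    decided-step : ∀ m n {L} → Decided (m / p) (n / p) L → Decided m n (img p L (m % p) (n % p))
    decided-step m n (never-even eq m₀) with m<2⇒m≡0∨1 (m % p % 2) (m%n<n (m % p) 2) | m<2⇒m≡0∨1 (n % p % 2) (m%n<n (n % p) 2)
    ... | inj₁ i | inj₁ j = subst (Decided m n) (sym (img-A (m % p) (n % p) i j)) (never-even
      (all-rows m n (trans (row-zero-from m i m₀) (sym (row-zero-from n j (trans (sym (eq 0)) m₀)))) eq) (row-zero-from m i m₀))
    ... | inj₁ i | inj₂ j = subst (Decided m n) (sym (img-A (m % p) (n % p) i j))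
      (zero-tile 0 (row-zero-from m i m₀) (row-zero-from n j (trans (sym (eq 0)) m₀)))
    ... | inj₂ i | inj₁ j = subst (Decided m n) (trans (windowAt-zero m n) (sym (img-A (m % p) (n % p) i j)))
      (in-window 0 (row-zero-from m i m₀) (row-zero-from n j (trans (sym (eq 0)) m₀)) (above m n eq))
    ... | inj₂ i | inj₂ j = subst (Decided m n) (sym (img-A (m % p) (n % p) i j)) (never-odd
      (all-rows m n (trans (row-zero-from m i m₀) (sym (row-zero-from n j (trans (sym (eq 0)) m₀)))) eq) (row-zero-from m i m₀))
    decided-step m n (never-odd eq m₁) with m<2⇒m≡0∨1 (m % p % 2) (m%n<n (m % p) 2) | m<2⇒m≡0∨1 (n % p % 2) (m%n<n (n % p) 2)
    ... | inj₁ i | inj₁ j = subst (Decided m n) (sym (img-B (m % p) (n % p) i j)) (never-odd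
      (all-rows m n (trans (row-zero-from m i m₁) (sym (row-zero-from n j (trans (sym (eq 0)) m₁)))) eq) (row-zero-from m i m₁))
    ... | inj₁ i | inj₂ j = subst (Decided m n) (trans (windowAt-zero m n) (sym (img-B (m % p) (n % p) i j)))
      (in-window 0 (row-zero-from m i m₁) (row-zero-from n j (trans (sym (eq 0)) m₁)) (above m n eq))
    ... | inj₂ i | inj₁ j = subst (Decided m n) (sym (img-B (m % p) (n % p) i j))
      (zero-tile 0 (row-zero-from m i m₁) (row-zero-from n j (trans (sym (eq 0)) m₁)))
    ... | inj₂ i | inj₂ j = subst (Decided m n) (sym (img-B (m % p) (n % p) i j)) (never-even
      (all-rows m n (trans (row-zero-from m i m₁) (sym (row-zero-from n j (trans (sym (eq 0)) m₁)))) eq) (row-zero-from m i m₁))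
    decided-step m n (zero-tile e m₀ n₁) = zero-tile (suc e) (trans (row-suc e m) m₀) (trans (row-suc e n) n₁)
    decided-step m n (in-window e m₁ n₀ eq) = subst (Decided m n) (sym (windowAt-suc e m n))
      (in-window (suc e) (trans (row-suc e m) m₁) (trans (row-suc e n) n₀)
        λ { (suc f) (s≤s e<f) → trans (row-suc f m) (trans (eq f e<f) (sym (row-suc f n))) })

    decided : ∀ k m n → m < p ^ k → n < p ^ k → Decided m n (Φ^ p k m n)
    decided zero    m n m<1 n<1 with refl ← n<1⇒n≡0 m<1 | refl ← n<1⇒n≡0 n<1 = never-even (λ _ → refl) refl
    decided (suc k) m n m<  n<  = decided-step m n (decided k (m / p) (n / p) (down m m<) (down n n<))
      where
      down : ∀ m → m < p ^ suc k → m / p < p ^ k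
      down m m< = m<n*o⇒m/o<n {m} {p ^ k} {p} (subst (m <_) (*-comm p (p ^ k)) m<)

    OnEdge : ℕ → ℕ → Set
    OnEdge e m = onFirst e m ≡ true ⊎ onLast e m ≡ true

    edge-descend : ∀ e m → OnEdge (suc e) m → OnEdge e (m / p)
    edge-descend e m (inj₁ f) = inj₁ (dec-true (p ^ e ∣? m / p)
      (proj₁ (Equivalence.to (∣-step e m) (does-true (p ^ suc e ∣? m) f))))
    edge-descend e m (inj₂ l) = inj₂ (dec-true (p ^ e ∣? suc (m / p))
      (proj₁ (Equivalence.to (∣-suc-step e m) (does-true (p ^ suc e ∣? suc m) l))))

    -- On an edge each of the last `e` digits is 0 or p - 1, all even, so removing digits does not
    -- change the parity. A frame cell thus shows the same tile parity at all smaller scales.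
    edge-parity : ∀ e m → OnEdge e m → row 0 m ≡ row e m
    edge-parity zero    m _ = refl
    edge-parity (suc e) m edge = trans (digit-even edge) (trans (edge-parity e (m / p) (edge-descend e m edge)) (sym (row-suc e m)))
      where
      last-even : suc (suc r) % 2 ≡ 0
      last-even with m<2⇒m≡0∨1 (suc (suc r) % 2) (m%n<n (suc (suc r)) 2)
      ... | inj₁ eq = eq
      ... | inj₂ eq with () ← trans (sym p-odd) (trans (%-distribˡ-+ 1 (suc (suc r)) 2) (cong (λ z → (1 + z) % 2) eq))
      digit-zero : m % p % 2 ≡ 0 → row 0 m ≡ row 0 (m / p)
      digit-zero d = trans (row-zero-from m d refl) (trans (cong (_% 2) (row-zero (m / p)))
        (trans (m%n%n≡m%n (m / p) 2) (sym (row-zero (m / p)))))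
      digit-even : OnEdge (suc e) m → row 0 m ≡ row 0 (m / p)
      digit-even (inj₁ f) = digit-zero (cong (_% 2)
        (proj₂ (Equivalence.to (∣-step e m) (does-true (p ^ suc e ∣? m) f))))
      digit-even (inj₂ l) = digit-zero (trans (cong (_% 2)
        (proj₂ (Equivalence.to (∣-suc-step e m) (does-true (p ^ suc e ∣? suc m) l)))) last-even)

    edge-parity-≤ : ∀ f e m → f ≤ e → OnEdge e m → row f m ≡ row e m
    edge-parity-≤ zero    e       m _         edge = edge-parity e m edge
    edge-parity-≤ (suc f) (suc e) m (s≤s f≤e) edge =
      trans (row-suc f m) (trans (edge-parity-≤ f e (m / p) f≤e (edge-descend e m edge)) (sym (row-suc e m)))

    p^-∣ : ∀ {f e} → f ≤ e → p ^ f ∣ p ^ e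
    p^-∣ {f} {e} f≤e = divides (p ^ (e ∸ f)) (trans (cong (p ^_) (sym (m∸n+n≡m f≤e))) (^-distribˡ-+-* p (e ∸ f) f))

    edge-divides : ∀ f e m → f ≤ e → OnEdge e m → p ^ f ∣ m ⊎ p ^ f ∣ suc m
    edge-divides f e m f≤e (inj₁ o) = inj₁ (∣-trans (p^-∣ f≤e) (does-true (p ^ e ∣? m) o))
    edge-divides f e m f≤e (inj₂ o) = inj₂ (∣-trans (p^-∣ f≤e) (does-true (p ^ e ∣? suc m) o))

    private
      equal-rows : ∀ {m n} f → row f m ≡ row f n → ¬ Dead′ f m n
      equal-rows f eq (outer m₀ n₁) with () ← trans (sym m₀) (trans eq n₁)
      equal-rows f eq (inner m₁ n₀ _ _ _ _) with () ← trans (sym n₀) (trans (sym eq) m₁)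

      row-edge : ∀ {m n} f → row f m ≡ 1 → p ^ f ∣ m ⊎ p ^ f ∣ suc m → ¬ Dead′ f m n
      row-edge f m₁ _        (outer m₀ _) with () ← trans (sym m₀) m₁
      row-edge f _  (inj₁ d) (inner _ _ ¬d _ _ _) = ¬d d
      row-edge f _  (inj₂ d) (inner _ _ _ ¬d _ _) = ¬d d

      column-edge : ∀ {m n} f → row f n ≡ 0 → p ^ f ∣ n ⊎ p ^ f ∣ suc n → ¬ Dead′ f m n
      column-edge f n₀ _        (outer _ n₁) with () ← trans (sym n₀) n₁
      column-edge f _  (inj₁ d) (inner _ _ _ _ ¬d _) = ¬d d
      column-edge f _  (inj₂ d) (inner _ _ _ _ _ ¬d) = ¬d d

    -- For a frame cell of a window at scale `e`, larger scales have equal parities. At `e` and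
    -- below, the edge coordinate keeps its parity, excluding `outer`, and stays on an edge,
    -- excluding `inner`.
    Π-decided : ∀ {m n L} → Decided m n L →
      ((∃ λ e → Dead′ e m n) × Π L ≡ O) ⊎ (¬ (∃ λ e → Dead′ e m n) × Π L ≡ X)
    Π-decided (never-even eq _) = inj₂ ((λ (f , d) → equal-rows f (eq f) d) , refl)
    Π-decided (never-odd eq _)  = inj₂ ((λ (f , d) → equal-rows f (eq f) d) , refl)
    Π-decided (zero-tile e m₀ n₁) = inj₁ ((e , outer m₀ n₁) , refl)
    Π-decided {m} {n} (in-window e m₁ n₀ eq) with Π-window (sidesAt e m n)
    ... | inj₁ (¬N , ¬S , ¬W , ¬E , ΠL≡O) = inj₁ ((e , inner m₁ n₀
      (does-false (p ^ e ∣? m) ¬N) (does-false (p ^ e ∣? suc m) ¬S)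
      (does-false (p ^ e ∣? n) ¬W) (does-false (p ^ e ∣? suc n) ¬E)) , ΠL≡O)
    ... | inj₂ (inj₁ (edge , ΠL≡X)) = inj₂ ((λ (f , d) → alive f (<-cmp e f) d) , ΠL≡X)
      where
      on-edge : ∀ f → f ≤ e → ¬ Dead′ f m n
      on-edge f f≤e = row-edge f (trans (edge-parity-≤ f e m f≤e edge) m₁) (edge-divides f e m f≤e edge)
      alive : ∀ f → _ → ¬ Dead′ f m n
      alive f (tri< e<f _ _)  = equal-rows f (eq f e<f)
      alive f (tri≈ _ refl _) = on-edge f ≤-refl
      alive f (tri> _ _ f<e)  = on-edge f (<⇒≤ f<e)
    ... | inj₂ (inj₂ (edge , ΠL≡X)) = inj₂ ((λ (f , d) → alive f (<-cmp e f) d) , ΠL≡X)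
      where
      on-edge : ∀ f → f ≤ e → ¬ Dead′ f m n
      on-edge f f≤e = column-edge f (trans (edge-parity-≤ f e n f≤e edge) n₀) (edge-divides f e n f≤e edge)
      alive : ∀ f → _ → ¬ Dead′ f m n
      alive f (tri< e<f _ _)  = equal-rows f (eq f e<f)
      alive f (tri≈ _ refl _) = on-edge f ≤-refl
      alive f (tri> _ _ f<e)  = on-edge f (<⇒≤ f<e)

    Φ∞-criterion : ∀ m n →
      ((∃ λ e → Dead′ e m n) × Π (Φ∞ p m n) ≡ O) ⊎ (¬ (∃ λ e → Dead′ e m n) × Π (Φ∞ p m n) ≡ X)
    Φ∞-criterion m n = Π-decided (decided (suc (m + n)) m n (bound (m≤m+n m n)) (bound (m≤n+m n m)))
      where
      bound : ∀ {x} → x ≤ m + n → x < p ^ suc (m + n)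
      bound x≤ = <-trans (s≤s x≤) (m<n^m p (suc (m + n)) (s≤s (s≤s z≤n)))

-- Congruence modulo `p` on integers and determinants.

module Congruences where

  open Determinants
  open import Data.Nat as ℕ using (ℕ; zero; suc)
  open import Data.Nat.Divisibility as ℕ∣ using ()
  open import Data.Nat.Primality using (Prime; euclidsLemma)
  open import Data.Integer using (ℤ; +_; 0ℤ; _+_; _-_; _*_; -_; ∣_∣)
  open import Data.Integer.Properties
  open import Data.Integer.Divisibility.Signed as ℤ∣ using (∣ᵤ⇒∣; ∣⇒∣ᵤ)
  open import Data.Integer.Tactic.RingSolver using (solve-∀)
  open import Data.Sum using (_⊎_; inj₁; inj₂)
  open import Function using (_∘_)
  open import Relation.Nullary using (¬_; contradiction)
  open import Relation.Binary.PropositionalEquality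

  module _ (p : ℕ) where

    infix 4 _≈_
    -- With an explicit quotient, matching on the equation reduces each congruence law to a ring
    -- identity.
    record _≈_ (x y : ℤ) : Set where
      constructor by
      field
        quotient   : ℤ
        difference : x ≡ y + quotient * + p

    ≡⇒≈ : ∀ {x y} → x ≡ y → x ≈ y
    ≡⇒≈ {x} refl = by 0ℤ (lem x (+ p))
      where lem : ∀ x p → x ≡ x + 0ℤ * p
            lem = solve-∀

    ≈-refl : ∀ {x} → x ≈ x
    ≈-refl = ≡⇒≈ refl

    ≈-sym : ∀ {x y} → x ≈ y → y ≈ x
    ≈-sym {y = y} (by q refl) = by (- q) (lem y q (+ p))
      where lem : ∀ y q p → y ≡ y + q * p + (- q) * p
            lem = solve-∀

    ≈-trans : ∀ {x y z} → x ≈ y → y ≈ z → x ≈ z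
    ≈-trans {z = z} (by q refl) (by r refl) = by (r + q) (lem z q r (+ p))
      where lem : ∀ z q r p → z + r * p + q * p ≡ z + (r + q) * p
            lem = solve-∀

    +-≈ : ∀ {x x′ y y′} → x ≈ x′ → y ≈ y′ → x + y ≈ x′ + y′
    +-≈ {x′ = x} {y′ = y} (by q refl) (by r refl) = by (q + r) (lem x y q r (+ p))
      where lem : ∀ x y q r p → x + q * p + (y + r * p) ≡ x + y + (q + r) * p
            lem = solve-∀

    *-≈ : ∀ {x x′ y y′} → x ≈ x′ → y ≈ y′ → x * y ≈ x′ * y′
    *-≈ {x′ = x} {y′ = y} (by q refl) (by r refl) = by (x * r + q * y + q * r * + p) (lem x y q r (+ p))
      where lem : ∀ x y q r p → (x + q * p) * (y + r * p) ≡ x * y + (x * r + q * y + q * r * p) * p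
            lem = solve-∀

    neg-≈ : ∀ {x x′} → x ≈ x′ → - x ≈ - x′
    neg-≈ {x′ = x} (by q refl) = by (- q) (lem x q (+ p))
      where lem : ∀ x q p → - (x + q * p) ≡ - x + (- q) * p
            lem = solve-∀

    ≈-resp : ∀ {x x′ y y′} → x ≡ x′ → y ≡ y′ → x ≈ y → x′ ≈ y′
    ≈-resp refl refl c = c

    ∣⇒≈0 : ∀ {x} → p ℕ∣.∣ ∣ x ∣ → x ≈ 0ℤ
    ∣⇒≈0 p∣x with ℤ∣.divides q eq ← ∣ᵤ⇒∣ {+ p} p∣x = by q (trans eq (sym (+-identityˡ _)))

    ≈0⇒∣ : ∀ {x} → x ≈ 0ℤ → p ℕ∣.∣ ∣ x ∣
    ≈0⇒∣ (by q eq) = ∣⇒∣ᵤ {+ p} (ℤ∣.divides q (trans eq (+-identityˡ _)))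

    ≈-cancel : Prime p → ∀ c {x y} → ¬ p ℕ∣.∣ c → + c * x ≈ + c * y → x ≈ y
    ≈-cancel p-prime c {x} {y} p∤c cx≈cy = cases (euclidsLemma c (∣ x - y ∣) p-prime p∣product)
      where
      lem₁ : ∀ c x y → c * x + - (c * y) ≡ c * (x - y)
      lem₁ = solve-∀
      lem₂ : ∀ z → z + - z ≡ 0ℤ
      lem₂ = solve-∀
      lem₃ : ∀ x y → x - y + y ≡ x
      lem₃ = solve-∀
      difference : + c * x + - (+ c * y) ≈ + c * y + - (+ c * y)
      difference = +-≈ {+ c * x} {+ c * y} cx≈cy (≈-refl { - (+ c * y)})
      product : + c * (x - y) ≈ 0ℤ
      product = ≈-resp (lem₁ (+ c) x y) (lem₂ (+ c * y)) difference
      p∣product : p ℕ∣.∣ c ℕ.* ∣ x - y ∣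
      p∣product = subst (p ℕ∣.∣_) (abs-* (+ c) (x - y)) (≈0⇒∣ product)
      cases : p ℕ∣.∣ c ⊎ p ℕ∣.∣ ∣ x - y ∣ → x ≈ y
      cases (inj₁ p∣c)   = contradiction p∣c p∤c
      cases (inj₂ p∣x-y) = ≈-resp (lem₃ x y) (+-identityˡ y) (+-≈ (∣⇒≈0 {x - y} p∣x-y) (≈-refl {y}))

    alt-≈ : ∀ n {f g} → (∀ j → f j ≈ g j) → alt n f ≈ alt n g
    alt-≈ zero    f≈g = ≈-refl
    alt-≈ (suc n) f≈g = +-≈ (f≈g 0) (neg-≈ (alt-≈ n (f≈g ∘ suc)))

    Det-≈ : ∀ n {M M′} → (∀ i j → M i j ≈ M′ i j) → Det n M ≈ Det n M′
    Det-≈ zero    M≈M′ = ≈-refl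
    Det-≈ (suc n) M≈M′ = alt-≈ (suc n) (λ j → *-≈ (M≈M′ 0 j) (Det-≈ n (λ i k → M≈M′ (suc i) (skip j k))))

-- Lucas congruences for the coefficients of (1 + 4x)^(-1/2).

module Lucas where

  open Binomials
  open Congruences
  open Elimination using (sign; β; γ; β-ratio)
  open Weaving
  open import Data.Nat as ℕ using (ℕ; zero; suc; s≤s; z≤n)
  import Data.Nat.Properties as ℕP
  open import Data.Nat.Divisibility as ℕ∣ using (divides)
  open import Data.Nat.Combinatorics using (_C_; k>n⇒nCk≡0; nCn≡1)
  open import Data.Nat.Primality using (Prime; euclidsLemma)
  import Data.Nat.Tactic.RingSolver as ℕSolver
  open import Data.Integer using (+_; 0ℤ; 1ℤ; _+_; _-_; _*_; -_; ∣_∣)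
  open import Data.Integer.Properties
  open import Data.Integer.Tactic.RingSolver using (solve-∀)
  open import Data.Sum using (inj₁; inj₂)
  open import Relation.Nullary using (¬_; yes; no; contradiction)
  open import Relation.Binary.PropositionalEquality

  module _ (r : ℕ) (p-prime : Prime (suc (suc r))) where

    private
      p = suc (suc r)
      infix 4 _∼_
      _∼_ = _≈_ p

    p∤ : ∀ {c} → 0 ℕ.< c → c ℕ.< p → ¬ p ℕ∣.∣ c
    p∤ 0<c c<p = ℕ∣.>⇒∤ {{ℕ.>-nonZero 0<c}} c<p

    pCj∼0 : ∀ j → 0 ℕ.< j → j ℕ.< p → + (p C j) ∼ 0ℤ
    pCj∼0 (suc j) 0<j j<p with euclidsLemma (suc j) (p C suc j) p-prime
        (divides (suc r C j) (trans (absorption (suc r) j) (ℕP.*-comm p (suc r C j))))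
    ... | inj₁ p∣j = contradiction p∣j (p∤ 0<j j<p)
    ... | inj₂ p∣C = ∣⇒≈0 p p∣C

    +-pascal : ∀ n k → + (suc n C suc k) ≡ + (n C k) + + (n C suc k)
    +-pascal n k = cong (λ z → + z) (pascal n k)

    shift-low : ∀ m j → j ℕ.< p → + ((m ℕ.+ p) C j) ∼ + (m C j)
    shift-low m       zero    _   = ≈-refl p
    shift-low zero    (suc j) j<p = ≈-trans p (pCj∼0 (suc j) (s≤s z≤n) j<p)
      (≡⇒≈ p (cong (λ z → + z) (sym (k>n⇒nCk≡0 {0} {suc j} (s≤s z≤n)))))
    shift-low (suc m) (suc j) j<p = ≈-resp p (sym (+-pascal (m ℕ.+ p) j)) (sym (+-pascal m j))
      (+-≈ p (shift-low m j (ℕP.<⇒≤ j<p)) (shift-low m (suc j) j<p))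

    -- Coefficient comparison in (1 + x)^(m + p) ≡ (1 + x)^m (1 + x^p); `shift-low` is the part in
    -- degrees below `p`.
    shift-high : ∀ m j → + ((m ℕ.+ p) C (j ℕ.+ p)) ∼ + (m C j) + + (m C (j ℕ.+ p))
    shift-high zero zero = ≡⇒≈ p (trans (cong (λ z → + z) (nCn≡1 p))
      (sym (cong (λ z → 1ℤ + + z) (k>n⇒nCk≡0 {0} {p} (s≤s z≤n)))))
    shift-high zero (suc j) = ≡⇒≈ p (trans
      (cong (λ z → + z) (k>n⇒nCk≡0 {p} {suc j ℕ.+ p} (s≤s (ℕP.m≤n+m p j))))
      (sym (cong₂ (λ x y → + x + + y) (k>n⇒nCk≡0 {0} {suc j} (s≤s z≤n)) (k>n⇒nCk≡0 {0} {suc j ℕ.+ p} (s≤s z≤n)))))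
    shift-high (suc m) zero = ≈-resp p (sym (+-pascal (m ℕ.+ p) (suc r)))
      (trans (lem (+ (m C suc r)) (+ (m C p))) (cong (_+_ 1ℤ) (sym (+-pascal m (suc r)))))
      (+-≈ p (shift-low m (suc r) ℕP.≤-refl) (shift-high m zero))
      where lem : ∀ x y → x + (1ℤ + y) ≡ 1ℤ + (x + y)
            lem = solve-∀
    shift-high (suc m) (suc j) = ≈-resp p (sym (+-pascal (m ℕ.+ p) (j ℕ.+ p)))
      (trans (lem (+ (m C j)) (+ (m C (j ℕ.+ p))) (+ (m C suc j)) (+ (m C suc (j ℕ.+ p))))
             (sym (cong₂ _+_ (+-pascal m j) (+-pascal m (j ℕ.+ p)))))
      (+-≈ p (shift-high m j) (shift-high m (suc j)))
      where lem : ∀ a b c d → a + b + (c + d) ≡ a + c + (b + d)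
            lem = solve-∀

    lucas : ∀ n k {a b} → a ℕ.< p → b ℕ.< p →
      + ((n ℕ.* p ℕ.+ a) C (k ℕ.* p ℕ.+ b)) ∼ + (n C k) * + (a C b)
    lucas zero zero {a} {b} _ _ = ≡⇒≈ p (sym (*-identityˡ (+ (a C b))))
    lucas zero (suc k) {a} {b} a<p _ = ≡⇒≈ p (trans
      (cong (λ z → + z) (k>n⇒nCk≡0 {a} {suc k ℕ.* p ℕ.+ b}
        (ℕP.<-≤-trans a<p (ℕP.≤-trans (ℕP.m≤m+n p (k ℕ.* p)) (ℕP.m≤m+n _ b)))))
      (sym (cong (λ z → + z * + (a C b)) (k>n⇒nCk≡0 {0} {suc k} (s≤s z≤n)))))
    lucas (suc n) zero {a} {b} a<p b<p = ≈-trans p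
      (≈-resp p (cong (λ z → + (z C b)) (lem p (n ℕ.* p) a)) refl (shift-low (n ℕ.* p ℕ.+ a) b b<p))
      (lucas n zero a<p b<p)
      where lem : ∀ p x a → x ℕ.+ a ℕ.+ p ≡ p ℕ.+ x ℕ.+ a
            lem = ℕSolver.solve-∀
    lucas (suc n) (suc k) {a} {b} a<p b<p = ≈-trans p
      (≈-resp p (cong₂ (λ x y → + (x C y)) (lem p (n ℕ.* p) a) (lem p (k ℕ.* p) b)) refl
        (shift-high (n ℕ.* p ℕ.+ a) (k ℕ.* p ℕ.+ b)))
      (≈-resp p (cong (λ z → + ((n ℕ.* p ℕ.+ a) C (k ℕ.* p ℕ.+ b)) + + ((n ℕ.* p ℕ.+ a) C z)) (sym (lem p (k ℕ.* p) b)))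
        (trans (sym (*-distribʳ-+ (+ (a C b)) (+ (n C k)) (+ (n C suc k)))) (cong (_* + (a C b)) (sym (+-pascal n k))))
        (+-≈ p (lucas n k a<p b<p) (lucas n (suc k) a<p b<p)))
      where lem : ∀ p x a → x ℕ.+ a ℕ.+ p ≡ p ℕ.+ x ℕ.+ a
            lem = ℕSolver.solve-∀

    -- Doubling Kp + s carries: the last digit of the top is 2s - p, which is smaller than `s`, so
    -- the last factor in `lucas` is zero.
    central-high : ∀ K {s} → s ℕ.< p → p ℕ.≤ s ℕ.+ s → + central (K ℕ.* p ℕ.+ s) ∼ 0ℤ
    central-high K {s} s<p p≤2s = ≈-resp p
      (cong (λ z → + (z C (K ℕ.* p ℕ.+ s))) (trans (lem₁ (K ℕ.* p) p a)
        (trans (cong (λ z → K ℕ.* p ℕ.+ K ℕ.* p ℕ.+ z) (ℕP.m∸n+n≡m p≤2s)) (lem₂ (K ℕ.* p) s))))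
      (trans (cong (λ z → + (suc (K ℕ.+ K) C K) * + z) (k>n⇒nCk≡0 {a} {s} a<s)) (*-zeroʳ (+ (suc (K ℕ.+ K) C K))))
      (≈-resp p (cong (λ z → + ((z ℕ.+ a) C (K ℕ.* p ℕ.+ s))) (lem₀ K p)) refl
        (lucas (suc (K ℕ.+ K)) K (ℕP.<-trans a<s s<p) s<p))
      where
      a = s ℕ.+ s ℕ.∸ p
      a<s : a ℕ.< s
      a<s = ℕP.<-≤-trans (ℕP.∸-monoˡ-< (ℕP.+-monoʳ-< s s<p) p≤2s) (ℕP.≤-reflexive (ℕP.m+n∸n≡m s p))
      lem₀ : ∀ K p → suc (K ℕ.+ K) ℕ.* p ≡ p ℕ.+ (K ℕ.* p ℕ.+ K ℕ.* p)
      lem₀ = ℕSolver.solve-∀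
      lem₁ : ∀ x p a → p ℕ.+ (x ℕ.+ x) ℕ.+ a ≡ x ℕ.+ x ℕ.+ (a ℕ.+ p)
      lem₁ = ℕSolver.solve-∀
      lem₂ : ∀ x s → x ℕ.+ x ℕ.+ (s ℕ.+ s) ≡ x ℕ.+ s ℕ.+ (x ℕ.+ s)
      lem₂ = ℕSolver.solve-∀

    -- Without a carry the top is 2K · p + 2s and `lucas` applies; with a carry both sides vanish.
    central-lucas : ∀ K {s} → s ℕ.< p → + central (K ℕ.* p ℕ.+ s) ∼ + central K * + central s
    central-lucas K {s} s<p with p ℕ.≤? s ℕ.+ s
    ... | yes p≤2s = ≈-trans p (central-high K s<p p≤2s) (≈-resp p (*-zeroʳ (+ central K)) refl
      (*-≈ p (≈-refl p {+ central K}) (≈-sym p (central-high 0 s<p p≤2s))))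
    ... | no p≰2s = ≈-resp p (cong (λ z → + (z C (K ℕ.* p ℕ.+ s))) (lem K p s)) refl
      (lucas (K ℕ.+ K) K (ℕP.≰⇒> p≰2s) s<p)
      where lem : ∀ K p s → (K ℕ.+ K) ℕ.* p ℕ.+ (s ℕ.+ s) ≡ K ℕ.* p ℕ.+ s ℕ.+ (K ℕ.* p ℕ.+ s)
            lem = ℕSolver.solve-∀

    sign-+ : ∀ m n → sign (m ℕ.+ n) ≡ sign m * sign n
    sign-+ zero    n = sym (*-identityˡ (sign n))
    sign-+ (suc m) n = trans (cong -_ (sign-+ m n)) (neg-distribˡ-* (sign m) (sign n))

    sign² : ∀ m → sign m * sign m ≡ 1ℤ
    sign² zero    = refl
    sign² (suc m) = trans (lem (sign m)) (sign² m)
      where lem : ∀ s → - s * - s ≡ s * s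
            lem = solve-∀

    module _ (h : ℕ) (p≡ : p ≡ suc (h ℕ.+ h)) where

      sign-*p : ∀ K → sign (K ℕ.* p) ≡ sign K
      sign-*p zero    = refl
      sign-*p (suc K) = trans (sign-+ p (K ℕ.* p)) (trans (cong₂ _*_ sign-p (sign-*p K)) (-1*i≡-i (sign K)))
        where sign-p : sign p ≡ - 1ℤ
              sign-p = trans (cong sign p≡) (cong -_ (trans (sign-+ h h) (sign² h)))

      β-lucas : ∀ K {s} → s ℕ.< p → β 0 (+ (K ℕ.* p ℕ.+ s)) ∼ β 0 (+ K) * β 0 (+ s)
      β-lucas K {s} s<p = ≈-resp p
        (cong (_* + central (K ℕ.* p ℕ.+ s)) (sym (trans (sign-+ (K ℕ.* p) s) (cong (_* sign s) (sign-*p K)))))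
        (lem (sign K) (sign s) (+ central K) (+ central s))
        (*-≈ p (≈-refl p {sign K * sign s}) (central-lucas K s<p))
        where lem : ∀ a b x y → a * b * (x * y) ≡ a * x * (b * y)
              lem = solve-∀

      β-high : ∀ {s} → s ℕ.< p → p ℕ.≤ s ℕ.+ s → β 0 (+ s) ∼ 0ℤ
      β-high {s} s<p p≤2s = ≈-resp p refl (*-zeroʳ (sign s)) (*-≈ p (≈-refl p {sign s}) (central-high 0 s<p p≤2s))

      -- (1 + 4x)^(-1/2) ≡ (1 + 4x)^h below degree p, since h = (p-1)/2 ≡ -1/2.
      β-small : ∀ k → k ℕ.< p → + (4 ℕ.^ k) * + (h C k) ∼ β 0 (+ k)
      β-small zero    _   = ≈-refl p
      β-small (suc k) k<p = ≈-cancel p p-prime (suc k) (p∤ (s≤s z≤n) k<p)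
        (≈-trans p (≡⇒≈ p left) (≈-trans p (*-≈ p coefficient (β-small k (ℕP.<⇒≤ k<p))) (≡⇒≈ p right)))
        where
        open ≡-Reasoning
        x = + (h C k)
        y = + (h C suc k)
        c = + (4 ℕ.^ k)
        absorb : + suc k * y ≡ (+ h - + k) * x
        absorb = begin
          + suc k * y                            ≡⟨ lem (+ suc k * y) (+ k * x) ⟩
          (+ suc k * y + + k * x) - + k * x
            ≡⟨ cong (_- + k * x) (trans (sym (cong₂ _+_ (pos-* (suc k) (h C suc k)) (pos-* k (h C k))))
                 (trans (cong (λ z → + z) (C-suc h k)) (pos-* h (h C k)))) ⟩
          + h * x - + k * x                      ≡⟨ lem′ (+ h) (+ k) x ⟩
          (+ h - + k) * x ∎
          where
          lem : ∀ a b → a ≡ (a + b) - b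
          lem = solve-∀
          lem′ : ∀ a b x → a * x - b * x ≡ (a - b) * x
          lem′ = solve-∀
        left : + suc k * (+ (4 ℕ.^ suc k) * y) ≡ (+ 4 * (+ h - + k)) * (c * x)
        left = begin
          + suc k * (+ (4 ℕ.^ suc k) * y)        ≡⟨ cong (λ z → + suc k * (z * y)) (pos-* 4 (4 ℕ.^ k)) ⟩
          + suc k * (+ 4 * c * y)                ≡⟨ lem (+ suc k) c y ⟩
          + 4 * c * (+ suc k * y)                ≡⟨ cong (λ z → + 4 * c * z) absorb ⟩
          + 4 * c * ((+ h - + k) * x)            ≡⟨ lem′ (+ h - + k) c x ⟩
          (+ 4 * (+ h - + k)) * (c * x) ∎
          where
          lem : ∀ k c y → k * (+ 4 * c * y) ≡ + 4 * c * (k * y)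
          lem = solve-∀
          lem′ : ∀ d c x → + 4 * c * (d * x) ≡ (+ 4 * d) * (c * x)
          lem′ = solve-∀
        coefficient : + 4 * (+ h - + k) ∼ γ 0ℤ (+ suc k)
        -- The quotient 2 comes from 4h = 2p - 2.
        coefficient = by (+ 2) (trans (lem (+ h) (+ k)) (cong (λ z → γ 0ℤ (+ suc k) + + 2 * + z) (sym p≡)))
          where lem : ∀ h k → + 4 * (h - k) ≡ (+ 4 * 0ℤ + + 2 - + 4 * (1ℤ + k)) + + 2 * (1ℤ + (h + h))
                lem = solve-∀
        right : γ 0ℤ (+ suc k) * β 0 (+ k) ≡ + suc k * β 0 (+ suc k)
        right = sym (β-ratio 0 (+ suc k))

      [p-1]Cj : ∀ j → j ℕ.< p → + (suc r C j) ∼ sign j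
      [p-1]Cj zero    _   = ≈-refl p
      [p-1]Cj (suc j) j<p = ≈-resp p (lem (+ (suc r C j)) (+ (suc r C suc j))) (+-identityˡ (- sign j))
        (+-≈ p (≈-resp p (+-pascal (suc r) j) refl (pCj∼0 (suc j) (s≤s z≤n) j<p)) (neg-≈ p ([p-1]Cj j (ℕP.<⇒≤ j<p))))
        where lem : ∀ a b → a + b + - a ≡ b
              lem = solve-∀

      -- Since 2^p = 2 · 4^h, it suffices that 4^h ≡ 1: `β-small` at k = h gives 4^h ≡ (-1)^h
      -- binom(2h, h), and binom(p - 1, h) ≡ (-1)^h.
      fermat-2 : + (2 ℕ.^ p) ∼ + 2
      fermat-2 = ≈-resp p (trans (sym (pos-* 2 (4 ℕ.^ h))) (cong (λ z → + z) 2^p)) refl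
        (*-≈ p (≈-refl p {+ 2}) 4^h)
        where
        h<p : h ℕ.< p
        h<p = subst (h ℕ.<_) (sym p≡) (s≤s (ℕP.m≤m+n h h))
        2^p : 2 ℕ.* 4 ℕ.^ h ≡ 2 ℕ.^ p
        2^p = trans (cong (2 ℕ.*_) (trans (ℕP.^-*-assoc 2 2 h) (cong (2 ℕ.^_) (cong (h ℕ.+_) (ℕP.+-identityʳ h)))))
          (cong (2 ℕ.^_) (sym p≡))
        4^h : + (4 ℕ.^ h) ∼ 1ℤ
        4^h = ≈-trans p (≡⇒≈ p (trans (sym (*-identityʳ (+ (4 ℕ.^ h)))) (cong (λ z → + (4 ℕ.^ h) * + z) (sym (nCn≡1 h)))))
          (≈-trans p (β-small h h<p) (≈-resp p
            (cong (λ z → sign h * + (z C h)) (ℕP.suc-injective p≡))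
            (sign² h)
            (*-≈ p (≈-refl p {sign h}) ([p-1]Cj h h<p))))

-- The Cantor sequence as coefficients of an inverse square root.

module Cantor where

  open Binomials
  open Congruences
  open Lucas
  open Elimination using (β)
  open Weaving
  open Valuations using (m<n^m)
  open import Data.Bool using (if_then_else_)
  open import Data.List using (List; []; _∷_; _++_; map; upTo; applyUpTo; length)
  open import Data.List.Properties using (length-map; length-upTo; map-upTo)
  open import Data.Nat as ℕ using (ℕ; zero; suc; s≤s; z≤n; s≤s⁻¹)
  import Data.Nat.Properties as ℕP
  open import Data.Nat.DivMod as ℕD using (_%_; _/_)
  open import Data.Nat.Combinatorics using (_C_)
  open import Data.Nat.Primality using (Prime)
  import Data.Nat.Tactic.RingSolver as ℕSolver
  open import Data.Integer using (ℤ; +_; 0ℤ; _+_; _*_)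
  open import Data.Integer.Properties
  open import Data.Integer.Tactic.RingSolver using (solve-∀)
  open import Function using (_∘_)
  open import Relation.Binary.PropositionalEquality

  at-++ˡ : ∀ xs ys i → i ℕ.< length xs → at (xs ++ ys) i ≡ at xs i
  at-++ˡ (x ∷ xs) ys zero    _         = refl
  at-++ˡ (x ∷ xs) ys (suc i) (s≤s i<n) = at-++ˡ xs ys i i<n

  at-++ʳ : ∀ xs ys i → at (xs ++ ys) (length xs ℕ.+ i) ≡ at ys i
  at-++ʳ []       ys i = refl
  at-++ʳ (x ∷ xs) ys i = at-++ʳ xs ys i

  at-applyUpTo : ∀ (f : ℕ → ℕ) n i → i ℕ.< n → at (applyUpTo f n) i ≡ f i
  at-applyUpTo f (suc n) zero    _         = refl
  at-applyUpTo f (suc n) (suc i) (s≤s i<n) = at-applyUpTo (f ∘ suc) n i i<n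

  module _ (r : ℕ) where

    private
      p = suc (suc r)

    at-φ : ∀ w k {i} → i ℕ.< p → at (φ p w) (k ℕ.* p ℕ.+ i) ≡ (at w k ℕ.* coef p i) % p
    -- Past the end of the word both sides are the default value 0.
    at-φ []      k       i<p = refl
    at-φ (x ∷ w) k {i} i<p = go k
      where
      block : List ℕ
      block = map (λ i → modP p (x ℕ.* coef p i)) (upTo p)
      block-length : length block ≡ p
      block-length = trans (length-map _ (upTo p)) (length-upTo p)
      go : ∀ k → at (block ++ φ p w) (k ℕ.* p ℕ.+ i) ≡ (at (x ∷ w) k ℕ.* coef p i) % p
      go zero    = trans (at-++ˡ block (φ p w) i (subst (i ℕ.<_) (sym block-length) i<p))
        (trans (cong (λ xs → at xs i) (map-upTo (λ i → modP p (x ℕ.* coef p i)) p))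
               (at-applyUpTo (λ i → modP p (x ℕ.* coef p i)) p i i<p))
      go (suc k) = trans
        (cong (at (block ++ φ p w)) (trans (ℕP.+-assoc p (k ℕ.* p) i) (cong (ℕ._+ (k ℕ.* p ℕ.+ i)) (sym block-length))))
        (trans (at-++ʳ block (φ p w) (k ℕ.* p ℕ.+ i)) (at-φ w k i<p))

    letter : ℕ → ℕ → ℕ
    letter k = at (φ^ p k (1 ∷ []))

    module _ (p-prime : Prime p) (h : ℕ) (p≡ : p ≡ suc (h ℕ.+ h)) where

      private
        infix 4 _∼_
        _∼_ = _≈_ p

      private
        evens odds : ℕ → ℤ
        evens k = β 0 (+ k)
        odds  _ = 0ℤ

      -- The coefficients of (1 + 4x²)^(-1/2).
      central² : ℕ → ℤ
      central² = weave evens odds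

      -- Coefficientwise this is F(x) ≡ F(x^p) · (F cut off at degree p), the functional equation
      -- encoded by the substitution. With `I` odd the right side is zero; the left side is an odd
      -- coefficient for `s` even and vanishes through a carry for `s` odd.
      central²-lucas : ∀ I {s} → s ℕ.< p → central² (I ℕ.* p ℕ.+ s) ∼ central² I * central² s
      central²-lucas I {s} s<p with half-view I | half-view s
      ... | even K refl w | even t refl v = ≈-resp p
        (sym (trans (cong central² (lem K p t)) (weave-double evens odds (K ℕ.* p ℕ.+ t))))
        (sym (cong₂ _*_ (w evens odds) (v evens odds)))
        (β-lucas r p-prime h p≡ K (ℕP.≤-<-trans (ℕP.m≤m+n t t) s<p))
        where
        lem : ∀ K p t → (K ℕ.+ K) ℕ.* p ℕ.+ (t ℕ.+ t) ≡ (K ℕ.* p ℕ.+ t) ℕ.+ (K ℕ.* p ℕ.+ t)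
        lem = ℕSolver.solve-∀
      ... | even K refl w | odd t refl v = ≡⇒≈ p (trans
        (trans (cong central² (lem K p t)) (weave-suc-double evens odds (K ℕ.* p ℕ.+ t)))
        (sym (trans (cong (central² (K ℕ.+ K) *_) (v evens odds)) (*-zeroʳ (central² (K ℕ.+ K))))))
        where lem : ∀ K p t → (K ℕ.+ K) ℕ.* p ℕ.+ suc (t ℕ.+ t) ≡ suc ((K ℕ.* p ℕ.+ t) ℕ.+ (K ℕ.* p ℕ.+ t))
              lem = ℕSolver.solve-∀
      ... | odd K refl w | even t refl v = ≡⇒≈ p (trans
        (trans (cong central² (trans (cong (λ z → z ℕ.+ (K ℕ.+ K) ℕ.* p ℕ.+ (t ℕ.+ t)) p≡) (lem K p t h)))
               (weave-suc-double evens odds (K ℕ.* p ℕ.+ h ℕ.+ t)))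
        (sym (cong (_* central² (t ℕ.+ t)) (w evens odds))))
        where lem : ∀ K p t h → suc (h ℕ.+ h) ℕ.+ (K ℕ.+ K) ℕ.* p ℕ.+ (t ℕ.+ t)
                               ≡ suc ((K ℕ.* p ℕ.+ h ℕ.+ t) ℕ.+ (K ℕ.* p ℕ.+ h ℕ.+ t))
              lem = ℕSolver.solve-∀
      ... | odd K refl w | odd t refl v = ≈-resp p
        (sym (trans (cong central² (trans (cong (λ z → z ℕ.+ (K ℕ.+ K) ℕ.* p ℕ.+ suc (t ℕ.+ t)) p≡) (lem K p t h)))
                    (weave-double evens odds (K ℕ.* p ℕ.+ s′))))
        (sym (trans (cong (_* central² (suc (t ℕ.+ t))) (w evens odds)) (sym (*-zeroʳ (β 0 (+ K))))))
        (≈-trans p (β-lucas r p-prime h p≡ K s′<p)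
          (*-≈ p (≈-refl p {β 0 (+ K)}) (β-high r p-prime h p≡ s′<p p≤2s′)))
        where
        -- Because p = 2h + 1, the index (2K + 1) p + 2t + 1 equals 2 (Kp + s′), and 2s′ ≥ p is the
        -- carry.
        s′ = suc (h ℕ.+ t)
        t<h : t ℕ.< h
        t<h = ℕP.≰⇒> (λ h≤t → ℕP.<⇒≱ (s≤s⁻¹ (subst (suc (t ℕ.+ t) ℕ.<_) p≡ s<p)) (ℕP.+-mono-≤ h≤t h≤t))
        s′<p : s′ ℕ.< p
        s′<p = subst (s′ ℕ.<_) (sym p≡) (s≤s (ℕP.+-monoʳ-< h t<h))
        p≤2s′ : p ℕ.≤ s′ ℕ.+ s′
        p≤2s′ = subst (ℕ._≤ s′ ℕ.+ s′) (sym p≡)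
          (s≤s (ℕP.+-mono-≤ (ℕP.m≤m+n h t) (ℕP.≤-trans (ℕP.m≤m+n h t) (ℕP.n≤1+n _))))
        lem : ∀ K p t h → suc (h ℕ.+ h) ℕ.+ (K ℕ.+ K) ℕ.* p ℕ.+ suc (t ℕ.+ t)
                         ≡ (K ℕ.* p ℕ.+ suc (h ℕ.+ t)) ℕ.+ (K ℕ.* p ℕ.+ suc (h ℕ.+ t))
        lem = ℕSolver.solve-∀

      double/2 : ∀ k → (k ℕ.+ k) / 2 ≡ k
      double/2 k = trans (cong (_/ 2) (lem k)) (ℕD.m*n/n≡m k 2)
        where lem : ∀ k → k ℕ.+ k ≡ k ℕ.* 2
              lem = ℕSolver.solve-∀

      half-p : half p ≡ h
      half-p = trans (cong (_/ 2) (ℕP.suc-injective p≡)) (double/2 h)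

      coef-even : ∀ k → coef p (k ℕ.+ k) ≡ h C k
      coef-even k = trans (cong (λ z → if z ℕ.≡ᵇ 0 then half p C ((k ℕ.+ k) / 2) else 0) (double%2 k))
        (cong₂ _C_ half-p (double/2 k))

      coef-odd : ∀ k → coef p (suc (k ℕ.+ k)) ≡ 0
      coef-odd k = cong (λ z → if z ℕ.≡ᵇ 0 then half p C (suc (k ℕ.+ k) / 2) else 0) (suc-double%2 k)

      2^[k+k] : ∀ k → 2 ℕ.^ (k ℕ.+ k) ≡ 4 ℕ.^ k
      2^[k+k] k = trans (cong (2 ℕ.^_) (lem k)) (sym (ℕP.^-*-assoc 2 2 k))
        where lem : ∀ k → k ℕ.+ k ≡ 2 ℕ.* k
              lem = ℕSolver.solve-∀

      central²-small : ∀ s → s ℕ.< p → + (2 ℕ.^ s) * + coef p s ∼ central² s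
      central²-small s s<p with half-view s
      ... | even k refl w = ≈-resp p
        (sym (cong₂ (λ x y → + x * + y) (2^[k+k] k) (coef-even k))) (sym (w evens odds))
        (β-small r p-prime h p≡ k (ℕP.≤-<-trans (ℕP.m≤m+n k k) s<p))
      ... | odd k refl w = ≡⇒≈ p (trans (cong (λ y → + (2 ℕ.^ suc (k ℕ.+ k)) * + y) (coef-odd k))
        (trans (*-zeroʳ (+ (2 ℕ.^ suc (k ℕ.+ k)))) (sym (w evens odds))))

      fermat-2-power : ∀ I → + (2 ℕ.^ (I ℕ.* p)) ∼ + (2 ℕ.^ I)
      fermat-2-power zero    = ≈-refl p
      fermat-2-power (suc I) = ≈-resp p
        (sym (trans (cong (λ z → + z) (ℕP.^-distribˡ-+-* 2 p (I ℕ.* p))) (pos-* (2 ℕ.^ p) (2 ℕ.^ (I ℕ.* p)))))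
        (sym (pos-* 2 (2 ℕ.^ I)))
        (*-≈ p (fermat-2 r p-prime h p≡) (fermat-2-power I))

      %-≈ : ∀ x → + (x % p) ∼ + x
      %-≈ x = ≈-sym p (by (+ (x / p)) (trans (cong (λ z → + z) (ℕD.m≡m%n+[m/n]*n x p))
        (cong (_+_ (+ (x % p))) (pos-* (x / p) p))))

      -- Induction on the number of base `p` digits, with i = Ip + s. The substitution multiplies
      -- letter `I` by `coef p s`, `central²` factors in the same way, and 2^(Ip) ≡ 2^I reconciles
      -- the powers of 2.
      letter-≈ : ∀ k i → i ℕ.< p ℕ.^ k → + (2 ℕ.^ i) * + letter k i ∼ central² i
      letter-≈ zero zero _ = ≈-refl p
      letter-≈ zero (suc i) (s≤s ())
      letter-≈ (suc k) i i<p^k = subst (λ i → + (2 ℕ.^ i) * + letter (suc k) i ∼ central² i) (sym i≡)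
        (≈-trans p (≈-resp p (sym left) refl (≈-trans p expand (*-≈ p (letter-≈ k I I<p^k) (central²-small s s<p))))
          (≈-sym p (central²-lucas I s<p)))
        where
        I = i / p
        s = i % p
        s<p = ℕD.m%n<n i p
        i≡ : i ≡ I ℕ.* p ℕ.+ s
        i≡ = trans (ℕD.m≡m%n+[m/n]*n i p) (ℕP.+-comm s (I ℕ.* p))
        I<p^k : I ℕ.< p ℕ.^ k
        I<p^k = ℕD.m<n*o⇒m/o<n {i} {p ℕ.^ k} {p} (subst (i ℕ.<_) (ℕP.*-comm p (p ℕ.^ k)) i<p^k)
        f = letter k I
        c = coef p s
        left : + (2 ℕ.^ (I ℕ.* p ℕ.+ s)) * + letter (suc k) (I ℕ.* p ℕ.+ s)
             ≡ + (2 ℕ.^ (I ℕ.* p)) * + (2 ℕ.^ s) * + ((f ℕ.* c) % p)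
        left = cong₂ (λ x y → x * + y)
          (trans (cong (λ z → + z) (ℕP.^-distribˡ-+-* 2 (I ℕ.* p) s)) (pos-* (2 ℕ.^ (I ℕ.* p)) (2 ℕ.^ s)))
          (at-φ (φ^ p k (1 ∷ [])) I s<p)
        expand : + (2 ℕ.^ (I ℕ.* p)) * + (2 ℕ.^ s) * + ((f ℕ.* c) % p)
               ∼ (+ (2 ℕ.^ I) * + f) * (+ (2 ℕ.^ s) * + c)
        expand = ≈-resp p refl (lem (+ (2 ℕ.^ I)) (+ (2 ℕ.^ s)) (+ f) (+ c))
          (*-≈ p (*-≈ p (fermat-2-power I) (≈-refl p {+ (2 ℕ.^ s)}))
            (≈-resp p refl (pos-* f c) (%-≈ (f ℕ.* c))))
          where lem : ∀ a b f c → a * b * (f * c) ≡ (a * f) * (b * c)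
                lem = solve-∀

      cantor-≈ : ∀ i → + (2 ℕ.^ i) * + cantor p i ∼ central² i
      cantor-≈ i = letter-≈ (suc i) i (ℕP.<-trans ℕP.≤-refl (m<n^m p (suc i) (s≤s (s≤s z≤n))))

-- The number wall entries as boards, and the conclusion.

module NumberWall where

  open Determinants
  open Congruences
  open Elimination using (β; board; evenRow; oddRow)
  open ProductFormula using (Balanced; unbalanced-singular)
  open Weaving
  open Cantor
  open Valuations using (DeadAt; board-criterion)
  open Windows using (outer)
  open Substitution using (Φ∞-criterion)
  open import Data.Bool using (true; false; if_then_else_)
  open import Data.Nat as ℕ using (ℕ; zero; suc; s≤s; z≤n)
  import Data.Nat.Properties as ℕP
  open import Data.Nat.DivMod as ℕD using (_%_; _/_)
  open import Data.Nat.Divisibility as ℕ∣ using (_∣_; _∣?_)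
  open import Data.Nat.Primality using (Prime; euclidsLemma)
  open import Data.Integer using (ℤ; +_; -[1+_]; 0ℤ; 1ℤ; _+_; _-_; _*_; -_; ∣_∣)
  open import Data.Integer.Properties
  open import Data.Integer.Tactic.RingSolver using (solve-∀)
  import Data.Nat.Tactic.RingSolver as ℕSolver
  open import Data.Product using (∃; _,_)
  open import Data.Sum using (inj₁; inj₂; [_,_]′)
  open import Data.Unit using (tt)
  open import Function using (_∘_; _⇔_; mk⇔; Equivalence)
  open import Relation.Nullary using (¬_; contradiction)
  open import Relation.Nullary.Decidable using (dec-true; dec-false)
  open import Relation.Binary.PropositionalEquality
  open Equivalence using (to; from)

  extend : (ℕ → ℤ) → ℤ → ℤ
  extend u (+ k)    = u k
  extend u -[1+ k ] = 0ℤ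

  spread : ℤ → ℤ
  spread = extend (weave (λ k → β 0 (+ k)) (λ _ → 0ℤ))

  spread-even : ∀ k → spread (k + k) ≡ β 0 k
  spread-even (+ k)    = weave-double (λ k → β 0 (+ k)) (λ _ → 0ℤ) k
  spread-even -[1+ k ] = refl

  spread-odd : ∀ k → spread (1ℤ + (k + k)) ≡ 0ℤ
  spread-odd (+ k)    = weave-suc-double (λ k → β 0 (+ k)) (λ _ → 0ℤ) k
  spread-odd -[1+ k ] = refl

  private
    at-even : ∀ {z} k → z ≡ k + k → β 0 k ≡ spread z
    at-even k refl = sym (spread-even k)

    at-odd : ∀ {z} k → z ≡ 1ℤ + (k + k) → 0ℤ ≡ spread z
    at-odd k refl = sym (spread-odd k)

    zeros : ℕ → ℤ
    zeros _ = 0ℤ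

    row : ℤ → ℕ → ℕ → ℤ
    row a k l = β 0 (a + + k - + l)

  board-even : ∀ ν i j → board true 0 (+ ν) (+ ν) i j ≡ spread (+ i - + j + + (ν ℕ.+ ν))
  board-even ν i j with half-view i | half-view j
  ... | even k refl w | even l refl v = trans (cong-app (w (evenRow 0 (+ ν)) (oddRow 0 (+ ν))) j) (trans (v (row (+ ν) k) zeros)
    (at-even (+ ν + + k - + l) (lem (+ ν) (+ k) (+ l))))
    where lem : ∀ v k l → k + k - (l + l) + (v + v) ≡ v + k - l + (v + k - l)
          lem = solve-∀
  ... | even k refl w | odd l refl v = trans (cong-app (w (evenRow 0 (+ ν)) (oddRow 0 (+ ν))) j) (trans (v (row (+ ν) k) zeros)
    -- An even row and an odd column have index difference 2 (k - l) - 1, hence the borrowed unit.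
    (at-odd (+ ν + + k - + l - 1ℤ) (lem (+ ν) (+ k) (+ l))))
    where lem : ∀ v k l → k + k - (1ℤ + (l + l)) + (v + v) ≡ 1ℤ + (v + k - l - 1ℤ + (v + k - l - 1ℤ))
          lem = solve-∀
  ... | odd k refl w | even l refl v = trans (cong-app (w (evenRow 0 (+ ν)) (oddRow 0 (+ ν))) j) (trans (v zeros (row (+ ν) k))
    (at-odd (+ ν + + k - + l) (lem (+ ν) (+ k) (+ l))))
    where lem : ∀ v k l → 1ℤ + (k + k) - (l + l) + (v + v) ≡ 1ℤ + (v + k - l + (v + k - l))
          lem = solve-∀
  ... | odd k refl w | odd l refl v = trans (cong-app (w (evenRow 0 (+ ν)) (oddRow 0 (+ ν))) j) (trans (v zeros (row (+ ν) k))
    (at-even (+ ν + + k - + l) (lem (+ ν) (+ k) (+ l))))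
    where lem : ∀ v k l → 1ℤ + (k + k) - (1ℤ + (l + l)) + (v + v) ≡ v + k - l + (v + k - l)
          lem = solve-∀

  board-odd : ∀ ν i j → board false 0 (+ suc ν) (+ ν) i j ≡ spread (+ i - + j + + suc (ν ℕ.+ ν))
  board-odd ν i j with half-view i | half-view j
  ... | even k refl w | even l refl v = trans (cong-app (w (oddRow 0 (+ ν)) (evenRow 0 (+ suc ν))) j) (trans (v zeros (row (+ ν) k))
    (at-odd (+ ν + + k - + l) (lem (+ ν) (+ k) (+ l))))
    where lem : ∀ v k l → k + k - (l + l) + (1ℤ + (v + v)) ≡ 1ℤ + (v + k - l + (v + k - l))
          lem = solve-∀
  ... | even k refl w | odd l refl v = trans (cong-app (w (oddRow 0 (+ ν)) (evenRow 0 (+ suc ν))) j) (trans (v zeros (row (+ ν) k))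
    (at-even (+ ν + + k - + l) (lem (+ ν) (+ k) (+ l))))
    where lem : ∀ v k l → k + k - (1ℤ + (l + l)) + (1ℤ + (v + v)) ≡ v + k - l + (v + k - l)
          lem = solve-∀
  ... | odd k refl w | even l refl v = trans (cong-app (w (oddRow 0 (+ ν)) (evenRow 0 (+ suc ν))) j) (trans (v (row (+ suc ν) k) zeros)
    (at-even (+ suc ν + + k - + l) (lem (+ ν) (+ k) (+ l))))
    where lem : ∀ v k l → 1ℤ + (k + k) - (l + l) + (1ℤ + (v + v)) ≡ 1ℤ + v + k - l + (1ℤ + v + k - l)
          lem = solve-∀
  ... | odd k refl w | odd l refl v = trans (cong-app (w (oddRow 0 (+ ν)) (evenRow 0 (+ suc ν))) j) (trans (v (row (+ suc ν) k) zeros)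
    (at-odd (+ ν + + k - + l) (lem (+ ν) (+ k) (+ l))))
    where lem : ∀ v k l → 1ℤ + (k + k) - (1ℤ + (l + l)) + (1ℤ + (v + v)) ≡ 1ℤ + (v + k - l + (v + k - l))
          lem = solve-∀

  module _ (r : ℕ) (p-prime : Prime (suc (suc (suc r)))) (p-odd : suc (suc (suc r)) % 2 ≡ 1) where

    private
      p = suc (suc (suc r))

      infix 4 _∼_
      _∼_ = _≈_ p

      h = p / 2

      p≡ : p ≡ suc (h ℕ.+ h)
      p≡ = trans (ℕD.m≡m%n+[m/n]*n p 2) (trans (cong (ℕ._+ h ℕ.* 2) p-odd) (lem h))
        where lem : ∀ h → 1 ℕ.+ h ℕ.* 2 ≡ suc (h ℕ.+ h)
              lem = ℕSolver.solve-∀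

    p∤2^ : ∀ k → ¬ p ∣ 2 ℕ.^ k
    p∤2^ zero    p∣1 = ℕ∣.>⇒∤ (s≤s (s≤s z≤n)) p∣1
    p∤2^ (suc k) p∣  = [ ℕ∣.>⇒∤ (s≤s (s≤s (s≤s z≤n))) , p∤2^ k ]′ (euclidsLemma 2 (2 ℕ.^ k) p-prime p∣)

    p∤∏ : ∀ n (f : ℕ → ℕ) → ¬ p ∣ ∣ ∏ n (λ j → + (2 ℕ.^ f j)) ∣
    p∤∏ zero    f p∣1 = ℕ∣.>⇒∤ (s≤s (s≤s z≤n)) p∣1
    p∤∏ (suc n) f p∣  = [ p∤2^ (f 0) , p∤∏ n (f ∘ suc) ]′
      (euclidsLemma _ _ p-prime (subst (p ∣_) (abs-* (+ (2 ℕ.^ f 0)) (∏ n (λ j → + (2 ℕ.^ f (suc j))))) p∣))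

    ∣-unit-multiple : ∀ x y → ¬ p ∣ ∣ x ∣ → p ∣ ∣ x * y ∣ → p ∣ ∣ y ∣
    ∣-unit-multiple x y p∤x p∣xy with euclidsLemma (∣ x ∣) (∣ y ∣) p-prime (subst (p ∣_) (abs-* x y) p∣xy)
    ... | inj₁ p∣x = contradiction p∣x p∤x
    ... | inj₂ p∣y = p∣y

    wallMatrix : ℕ → Matrix
    wallMatrix n i j = cantorL p (+ i - + j + + n)

    -- The factor 2^z with z = i - j + n is split between the two sides to avoid negative exponents.
    -- `z` is kept abstract so that it can be split by sign; at negative indices both sequences are
    -- zero.
    entry-≈ : ∀ n i j z → + i - + j + + n ≡ z → + (2 ℕ.^ j) * spread z ∼ + (2 ℕ.^ (n ℕ.+ i)) * cantorL p z
    entry-≈ n i j (+ d) eq = ≈-resp p refl split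
      (*-≈ p (≈-refl p {+ (2 ℕ.^ j)}) (≈-sym p (cantor-≈ (suc r) p-prime h p≡ d)))
      where
      j+d : j ℕ.+ d ≡ n ℕ.+ i
      j+d = +-injective (trans (cong (_+_ (+ j)) (sym eq)) (lem (+ i) (+ j) (+ n)))
        where lem : ∀ i j n → j + (i - j + n) ≡ n + i
              lem = solve-∀
      split : + (2 ℕ.^ j) * (+ (2 ℕ.^ d) * + cantor p d) ≡ + (2 ℕ.^ (n ℕ.+ i)) * + cantor p d
      split = trans (sym (*-assoc (+ (2 ℕ.^ j)) (+ (2 ℕ.^ d)) (+ cantor p d)))
        (cong (_* + cantor p d) (trans (sym (pos-* (2 ℕ.^ j) (2 ℕ.^ d)))
          (cong (λ z → + z) (trans (sym (ℕP.^-distribˡ-+-* 2 j d)) (cong (2 ℕ.^_) j+d)))))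
    entry-≈ n i j -[1+ d ] eq = ≡⇒≈ p (trans (*-zeroʳ (+ (2 ℕ.^ j))) (sym (*-zeroʳ (+ (2 ℕ.^ (n ℕ.+ i))))))

    -- The scaled matrices are congruent entry by entry, so V · Det M ≡ U · Det W, where `U` and `V`
    -- are products of powers of 2 and therefore prime to `p`.
    wall-board : ∀ N n (M : Matrix) → (∀ i j → M i j ≡ spread (+ i - + j + + n)) →
      (p ∣ ∣ Det N (wallMatrix n) ∣) ⇔ (p ∣ ∣ Det N M ∣)
    wall-board N n M M≡ = mk⇔
      (λ p∣W → ∣-unit-multiple V (Det N M) (p∤∏ N (λ j → j))
        (≈0⇒∣ p (≈-trans p scaled (≈-resp p refl (*-zeroʳ U) (*-≈ p (≈-refl p {U}) (∣⇒≈0 p p∣W))))))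
      (λ p∣D → ∣-unit-multiple U (Det N (wallMatrix n)) (p∤∏ N (n ℕ.+_))
        (≈0⇒∣ p (≈-trans p (≈-sym p scaled) (≈-resp p refl (*-zeroʳ V) (*-≈ p (≈-refl p {V}) (∣⇒≈0 p p∣D))))))
      where
      U = ∏ N (λ i → + (2 ℕ.^ (n ℕ.+ i)))
      V = ∏ N (λ j → + (2 ℕ.^ j))
      scaled : V * Det N M ∼ U * Det N (wallMatrix n)
      scaled = ≈-resp p
        (Det-scale-columns N (λ j → + (2 ℕ.^ j)) M)
        (Det-scale-rows N (λ i → + (2 ℕ.^ (n ℕ.+ i))) (wallMatrix n))
        (Det-≈ p N (λ i j → ≈-resp p (cong (+ (2 ℕ.^ j) *_) (sym (M≡ i j))) refl
          (entry-≈ n i j (+ i - + j + + n) refl)))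

    wall≡Det : ∀ m n → wall (cantorL p) (+ m) (+ n) ≡ Det (suc m) (wallMatrix n)
    wall≡Det m n = det≡Det (suc m) _ (wallMatrix n) (λ i j → refl)

    balanced-double : ∀ k → Balanced false (k ℕ.+ k)
    balanced-double zero    = tt
    balanced-double (suc k) = subst (Balanced false ∘ suc) (sym (ℕP.+-suc k k)) (balanced-double k)

    even≢odd : ∀ k l → k ℕ.+ k ≢ suc (l ℕ.+ l)
    even≢odd k l eq with () ← trans (sym (double%2 k)) (trans (cong (_% 2) eq) (suc-double%2 l))

    wall-criterion : ∀ m n → p ∣ ∣ wall (cantorL p) (+ m) (+ n) ∣ ⇔ (∃ λ e → DeadAt p p-prime p-odd e m n)
    wall-criterion m n = subst (λ w → p ∣ ∣ w ∣ ⇔ (∃ λ e → DeadAt p p-prime p-odd e m n)) (sym (wall≡Det m n))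
      (criterion (half-view m) (half-view n))
      where
      criterion : Half m → Half n → p ∣ ∣ Det (suc m) (wallMatrix n) ∣ ⇔ (∃ λ e → DeadAt p p-prime p-odd e m n)
      criterion _ (even l refl _) = mk⇔ (to board⇔ ∘ to wall⇔) (from wall⇔ ∘ from board⇔)
        where
        wall⇔ = wall-board (suc m) n (board true 0 (+ l) (+ l)) (board-even l)
        board⇔ : p ∣ ∣ Det (suc m) (board true 0 (+ l) (+ l)) ∣ ⇔ (∃ λ e → DeadAt p p-prime p-odd e m n)
        board⇔ = subst₂ (λ a b → p ∣ ∣ Det (suc m) (board true 0 (+ a) (+ b)) ∣ ⇔ (∃ λ e → DeadAt p p-prime p-odd e m n))
          (sym (ℕP.n≡⌈n+n/2⌉ l)) (sym (ℕP.n≡⌊n+n/2⌋ l))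
          (board-criterion p p-prime p-odd m n true tt (λ _ l′ _ → even≢odd l l′))
      criterion (odd k refl _) (odd l refl _) = mk⇔ (to board⇔ ∘ to wall⇔) (from wall⇔ ∘ from board⇔)
        where
        wall⇔ = wall-board (suc m) n (board false 0 (+ suc l) (+ l)) (board-odd l)
        board⇔ : p ∣ ∣ Det (suc m) (board false 0 (+ suc l) (+ l)) ∣ ⇔ (∃ λ e → DeadAt p p-prime p-odd e m n)
        board⇔ = subst₂ (λ a b → p ∣ ∣ Det (suc m) (board false 0 (+ a) (+ b)) ∣ ⇔ (∃ λ e → DeadAt p p-prime p-odd e m n))
          (cong suc (sym (ℕP.n≡⌊n+n/2⌋ l))) (sym (ℕP.n≡⌈n+n/2⌉ l))
          (board-criterion p p-prime p-odd m n false (balanced-double k) (λ k′ _ m≡ _ → even≢odd k′ k (sym m≡)))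
      -- The zero tiles at scale 1: both sides of the equivalence hold outright, since the
      -- unbalanced board is singular.
      criterion (even k refl _) (odd l refl _) = mk⇔ (λ _ → 0 , dead) (λ _ → from wall⇔ singular)
        where
        wall⇔ = wall-board (suc m) n (board false 0 (+ suc l) (+ l)) (board-odd l)
        singular : p ∣ ∣ Det (suc m) (board false 0 (+ suc l) (+ l)) ∣
        singular = subst (λ d → p ∣ ∣ d ∣) (sym (unbalanced-singular k 0 (suc l) l)) (p ℕ∣.∣0)
        dead : DeadAt p p-prime p-odd 0 m n
        dead = outer (trans (cong (_% 2) (ℕD.n/1≡n m)) (double%2 k)) (trans (cong (_% 2) (ℕD.n/1≡n n)) (suc-double%2 l))

    profile : ∀ m n → χ p (wall (cantorL p) (+ m) (+ n)) ≡ Π (Φ∞ p m n)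
    profile m n with Φ∞-criterion r p-odd p-prime m n
    ... | inj₁ (dead , Π≡O) = trans
      (cong (if_then O else X) (dec-true (p ∣? ∣ wall (cantorL p) (+ m) (+ n) ∣) (from (wall-criterion m n) dead))) (sym Π≡O)
    ... | inj₂ (alive , Π≡X) = trans
      (cong (if_then O else X) (dec-false (p ∣? ∣ wall (cantorL p) (+ m) (+ n) ∣) (alive ∘ to (wall-criterion m n)))) (sym Π≡X)

open import Data.Nat using (ℕ; _%_; suc)
open import Data.Nat.Primality using (Prime; ¬prime[1])
open import Data.Integer using (+_)
open import Relation.Nullary using (contradiction)
open import Relation.Binary.PropositionalEquality using (_≡_)

theorem5p1 : (p : ℕ) → Prime p → p % 2 ≡ 1 →
    (m n : ℕ) → χ p (wall (cantorL p) (+ m) (+ n)) ≡ Π (Φ∞ p m n)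
-- The parity assumption refutes 0 and 2 by computation, so apart from 1 every `p` has the form r +
-- 3.
theorem5p1 (suc (suc (suc r))) p-prime p-odd m n = NumberWall.profile r p-prime p-odd m n
theorem5p1 1 p-prime _ = contradiction p-prime ¬prime[1]
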